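{- Let $K$ be a real number field of degree greater than $1$, with $s\ge1$ real embeddings and $2t\ge0$ non-real embeddings into $\mathbb{C}$, labelled $\sigma_1,\dots,\sigma_{s+2t}$ as in the context. Then the set $$\{(\sigma_2(\theta),\dots,\sigma_{s+t}(\theta)) : \theta\in\wp_K\}$$ is dense in $[-1,1]^{s-1}\times\{z\in\mathbb{C} : |z|\le 1\}^{t}$.
   Context: A real number field $K$ is a subfield of $\mathbb{R}$ of finite degree over $\mathbb{Q}$. It has $s\ge1$ real embeddings and $2t\ge 0$ non-real embeddings into $\mathbb{C}$, with $d=s+2t=[K:\mathbb{Q}]$. The distinct embeddings $\sigma_1,\dots,\sigma_d$ of $K$ into $\mathbb{C}$ are labelled so that $\sigma_1$ is the identity (inclusion) of $K$, $\sigma_j$ is real if and only if $j\le s$, and for $j\in\{1,\dots,t\}$ the embedding $\sigma_{s+t+j}$ is the composition of complex conjugation with $\sigma_{s+j}$. A Pisot number is a real algebraic integer greater than $1$ whose other conjugates over $\mathbb{Q}$ are all of modulus less than $1$; $S$ is the set of Pisot numbers, and $$\wp_K:=\{\theta : \theta\in S\cap K \text{ and } K=\mathbb{Q}(\theta)\}.$$ -}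

module Defs where

open import Level using (Level; 0ℓ; _⊔_) renaming (suc to lsuc)
open import Algebra.Bundles using (RawRing)
open import Algebra.Morphism.Structures using (module RingMorphisms)
import Algebra.Definitions.RawSemiring as SemiringOps
open import Data.Fin.Base using (Fin; zero; suc; toℕ; _↑ˡ_; _↑ʳ_)
open import Data.Integer.Base using (ℤ)
open import Data.Nat.Base as ℕ using (ℕ)
import Data.Nat.Properties as ℕₚ
open import Data.Product.Base using (∃; _×_; _,_; proj₁; proj₂)
open import Data.Rational.Base as ℚ using (ℚ; 0ℚ; 1ℚ; ½; ∣_∣)
import Data.Rational.Properties as ℚₚ
open import Data.Rational.Solver using (module +-*-Solver)
open import Data.Sum.Base using ([_,_]′)
open import Data.Vec.Functional using (Vector)
open import Function.Base using (_∘_)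
open import Function.Bundles using (_⇔_)
open import Function.Definitions using (Bijective)
open import Relation.Binary.PropositionalEquality
  using (_≡_; refl; sym; trans; cong; cong₂; subst; subst₂)
open import Relation.Nullary.Negation using (¬_)
open import Relation.Unary using (Pred; _∈_; _⊆_; _≐_)

private
  variable
    ℓ ℓ₁ ℓ₂ : Level

------------------------------------------------------------------------
-- Real numbers: Cauchy sequences of rationals up to _≈ʳ_.  The Cauchy
-- proofs are abstract; every relation below depends only on seq.

IsCauchy : (ℕ → ℚ) → Set
IsCauchy x = ∀ ε → 0ℚ ℚ.< ε →
  ∃ λ N → ∀ m n → N ℕ.≤ m → N ℕ.≤ n → ∣ x m ℚ.- x n ∣ ℚ.< ε

record ℝ : Set where
  constructor mkℝ
  field
    seq    : ℕ → ℚ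
    cauchy : IsCauchy seq

open ℝ public

abstract

  private
    half>0 : ∀ {ε} → 0ℚ ℚ.< ε → 0ℚ ℚ.< ½ ℚ.* ε
    half>0 {ε} 0<ε =
      subst (ℚ._< ½ ℚ.* ε) (ℚₚ.*-zeroʳ ½) (ℚₚ.*-monoʳ-<-pos ½ 0<ε)

    half+half : ∀ ε → ½ ℚ.* ε ℚ.+ ½ ℚ.* ε ≡ ε
    half+half = solve 1 (λ e → con ½ :* e :+ con ½ :* e := e) refl
      where open +-*-Solver

    ∣p∣≤∣q∣+∣p-q∣ : ∀ p q → ∣ p ∣ ℚ.≤ ∣ q ∣ ℚ.+ ∣ p ℚ.- q ∣
    ∣p∣≤∣q∣+∣p-q∣ p q = subst (λ u → ∣ u ∣ ℚ.≤ ∣ q ∣ ℚ.+ ∣ p ℚ.- q ∣) (identity p q)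
      (ℚₚ.∣p+q∣≤∣p∣+∣q∣ q (p ℚ.- q))
      where
      open +-*-Solver
      identity : ∀ p q → q ℚ.+ (p ℚ.- q) ≡ p
      identity = solve 2 (λ p q → q :+ (p :- q) := p) refl

    ∣p-q∣≡∣q-p∣ : ∀ p q → ∣ p ℚ.- q ∣ ≡ ∣ q ℚ.- p ∣
    ∣p-q∣≡∣q-p∣ p q = trans (cong ∣_∣ (identity p q)) (ℚₚ.∣-p∣≡∣p∣ (q ℚ.- p))
      where
      open +-*-Solver
      identity : ∀ p q → p ℚ.- q ≡ ℚ.- (q ℚ.- p)
      identity = solve 2 (λ p q → p :- q := :- (q :- p)) refl

  const-cauchy : ∀ q → IsCauchy (λ _ → q)
  const-cauchy q ε 0<ε = 0 , λ _ _ _ _ →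
    subst (ℚ._< ε) (sym (cong ∣_∣ (ℚₚ.+-inverseʳ q))) 0<ε

  +-cauchy : ∀ {x y} → IsCauchy x → IsCauchy y → IsCauchy (λ n → x n ℚ.+ y n)
  +-cauchy {x} {y} cx cy ε 0<ε
    with cx (½ ℚ.* ε) (half>0 0<ε) | cy (½ ℚ.* ε) (half>0 0<ε)
  ... | M , hx | N , hy = M ℕ.+ N , λ m n M+N≤m M+N≤n → begin-strict
    ∣ (x m ℚ.+ y m) ℚ.- (x n ℚ.+ y n) ∣
      ≡⟨ cong ∣_∣ (identity (x m) (y m) (x n) (y n)) ⟩
    ∣ (x m ℚ.- x n) ℚ.+ (y m ℚ.- y n) ∣
      ≤⟨ ℚₚ.∣p+q∣≤∣p∣+∣q∣ (x m ℚ.- x n) (y m ℚ.- y n) ⟩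
    ∣ x m ℚ.- x n ∣ ℚ.+ ∣ y m ℚ.- y n ∣
      <⟨ ℚₚ.+-mono-<
           (hx m n (ℕₚ.m+n≤o⇒m≤o M M+N≤m) (ℕₚ.m+n≤o⇒m≤o M M+N≤n))
           (hy m n (ℕₚ.m+n≤o⇒n≤o M M+N≤m) (ℕₚ.m+n≤o⇒n≤o M M+N≤n)) ⟩
    ½ ℚ.* ε ℚ.+ ½ ℚ.* ε
      ≡⟨ half+half ε ⟩
    ε ∎
    where
    open ℚₚ.≤-Reasoning
    open +-*-Solver
    identity : ∀ a b c d →
      (a ℚ.+ b) ℚ.- (c ℚ.+ d) ≡ (a ℚ.- c) ℚ.+ (b ℚ.- d)
    identity = solve 4
      (λ a b c d → (a :+ b) :- (c :+ d) := (a :- c) :+ (b :- d)) refl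

  neg-cauchy : ∀ {x} → IsCauchy x → IsCauchy (λ n → ℚ.- x n)
  neg-cauchy {x} cx ε 0<ε with cx ε 0<ε
  ... | N , hx = N , λ m n N≤m N≤n →
    subst (ℚ._< ε) (cong ∣_∣ (identity (x n) (x m))) (hx n m N≤n N≤m)
    where
    open +-*-Solver
    identity : ∀ p q → p ℚ.- q ≡ ℚ.- q ℚ.- (ℚ.- p)
    identity = solve 2 (λ p q → p :- q := (:- q) :- (:- p)) refl

  private
    eventuallyBounded : ∀ {x} → IsCauchy x →
      ∃ λ B → 0ℚ ℚ.< B × (∃ λ N → ∀ n → N ℕ.≤ n → ∣ x n ∣ ℚ.≤ B)
    eventuallyBounded {x} cx with cx 1ℚ (ℚₚ.positive⁻¹ 1ℚ)
    ... | N , hx = ∣ x N ∣ ℚ.+ 1ℚ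
      , ℚₚ.+-mono-≤-< (ℚₚ.0≤∣p∣ (x N)) (ℚₚ.positive⁻¹ 1ℚ)
      , N , λ n N≤n → ℚₚ.≤-trans (∣p∣≤∣q∣+∣p-q∣ (x n) (x N))
          (ℚₚ.+-monoʳ-≤ ∣ x N ∣ (ℚₚ.<⇒≤ (hx n N N≤n ℕₚ.≤-refl)))

    divide : ∀ {B ε} → 0ℚ ℚ.< B → 0ℚ ℚ.< ε →
      ∃ λ δ → 0ℚ ℚ.< δ × B ℚ.* δ ≡ ε
    divide {B} {ε} 0<B 0<ε = ℚ.1/ B ℚ.* ε , 0<δ , Bδ≡ε
      where
      instance
        posB : ℚ.Positive B
        posB = ℚ.positive 0<B
        nzB : ℚ.NonZero B
        nzB = ℚₚ.pos⇒nonZero B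
        posB⁻¹ : ℚ.Positive (ℚ.1/ B)
        posB⁻¹ = ℚₚ.1/pos⇒pos B
      0<δ : 0ℚ ℚ.< ℚ.1/ B ℚ.* ε
      0<δ = subst (ℚ._< ℚ.1/ B ℚ.* ε) (ℚₚ.*-zeroʳ (ℚ.1/ B))
        (ℚₚ.*-monoʳ-<-pos (ℚ.1/ B) 0<ε)
      Bδ≡ε : B ℚ.* (ℚ.1/ B ℚ.* ε) ≡ ε
      Bδ≡ε = trans (sym (ℚₚ.*-assoc B (ℚ.1/ B) ε))
        (trans (cong (ℚ._* ε) (ℚₚ.*-inverseʳ B)) (ℚₚ.*-identityˡ ε))

    ∣p*q∣< : ∀ {p q B δ} → 0ℚ ℚ.< B → ∣ p ∣ ℚ.≤ B → ∣ q ∣ ℚ.< δ →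
      ∣ p ℚ.* q ∣ ℚ.< B ℚ.* δ
    ∣p*q∣< {p} {q} {B} {δ} 0<B p≤B q<δ = begin-strict
      ∣ p ℚ.* q ∣       ≡⟨ ℚₚ.∣p*q∣≡∣p∣*∣q∣ p q ⟩
      ∣ p ∣ ℚ.* ∣ q ∣   ≤⟨ ℚₚ.*-monoʳ-≤-nonNeg ∣ q ∣ {{ℚₚ.∣-∣-nonNeg q}} p≤B ⟩
      B ℚ.* ∣ q ∣       <⟨ ℚₚ.*-monoʳ-<-pos B {{ℚ.positive 0<B}} q<δ ⟩
      B ℚ.* δ           ∎
      where
      open ℚₚ.≤-Reasoning

    product-bound : ∀ {a b c d A B α β ε} → 0ℚ ℚ.< A → 0ℚ ℚ.< B →
      A ℚ.* α ≡ ½ ℚ.* ε → B ℚ.* β ≡ ½ ℚ.* ε →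
      ∣ a ∣ ℚ.≤ A → ∣ b ℚ.- d ∣ ℚ.< α → ∣ d ∣ ℚ.≤ B → ∣ a ℚ.- c ∣ ℚ.< β →
      ∣ a ℚ.* b ℚ.- c ℚ.* d ∣ ℚ.< ε
    product-bound {a} {b} {c} {d} {A} {B} {α} {β} {ε} 0<A 0<B Aα Bβ ha hbd hd hac =
      begin-strict
      ∣ a ℚ.* b ℚ.- c ℚ.* d ∣
        ≡⟨ cong ∣_∣ (identity a b c d) ⟩
      ∣ a ℚ.* (b ℚ.- d) ℚ.+ d ℚ.* (a ℚ.- c) ∣
        ≤⟨ ℚₚ.∣p+q∣≤∣p∣+∣q∣ (a ℚ.* (b ℚ.- d)) (d ℚ.* (a ℚ.- c)) ⟩
      ∣ a ℚ.* (b ℚ.- d) ∣ ℚ.+ ∣ d ℚ.* (a ℚ.- c) ∣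
        <⟨ ℚₚ.+-mono-< (∣p*q∣< {a} {b ℚ.- d} 0<A ha hbd) (∣p*q∣< {d} {a ℚ.- c} 0<B hd hac) ⟩
      A ℚ.* α ℚ.+ B ℚ.* β
        ≡⟨ cong₂ ℚ._+_ Aα Bβ ⟩
      ½ ℚ.* ε ℚ.+ ½ ℚ.* ε
        ≡⟨ half+half ε ⟩
      ε ∎
      where
      open ℚₚ.≤-Reasoning
      open +-*-Solver
      identity : ∀ a b c d →
        a ℚ.* b ℚ.- c ℚ.* d ≡ a ℚ.* (b ℚ.- d) ℚ.+ d ℚ.* (a ℚ.- c)
      identity = solve 4
        (λ a b c d → a :* b :- c :* d := a :* (b :- d) :+ d :* (a :- c)) refl

  *-cauchy : ∀ {x y} → IsCauchy x → IsCauchy y → IsCauchy (λ n → x n ℚ.* y n)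
  *-cauchy {x} {y} cx cy ε 0<ε =
    let A , 0<A , Nx , xb = eventuallyBounded {x} cx
        B , 0<B , Ny , yb = eventuallyBounded {y} cy
        α , 0<α , Aα = divide 0<A (half>0 0<ε)
        β , 0<β , Bβ = divide 0<B (half>0 0<ε)
        Mx , hx = cx β 0<β
        My , hy = cy α 0<α
        left  = λ {k} → ℕₚ.m+n≤o⇒m≤o (Nx ℕ.+ Ny) {Mx ℕ.+ My} {k}
        right = λ {k} → ℕₚ.m+n≤o⇒n≤o (Nx ℕ.+ Ny) {Mx ℕ.+ My} {k}
    in (Nx ℕ.+ Ny) ℕ.+ (Mx ℕ.+ My) , λ m n N≤m N≤n →
      product-bound {x m} {y m} {x n} {y n} 0<A 0<B Aα Bβ
        (xb m (ℕₚ.m+n≤o⇒m≤o Nx (left N≤m)))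
        (hy m n (ℕₚ.m+n≤o⇒n≤o Mx (right N≤m)) (ℕₚ.m+n≤o⇒n≤o Mx (right N≤n)))
        (yb n (ℕₚ.m+n≤o⇒n≤o Nx (left N≤n)))
        (hx m n (ℕₚ.m+n≤o⇒m≤o Mx (right N≤m)) (ℕₚ.m+n≤o⇒m≤o Mx (right N≤n)))

  abs-cauchy : ∀ {x} → IsCauchy x → IsCauchy (λ n → ∣ x n ∣)
  abs-cauchy {x} cx ε 0<ε with cx ε 0<ε
  ... | N , hx = N , λ m n N≤m N≤n →
    ℚₚ.≤-<-trans (reverse (x m) (x n)) (hx m n N≤m N≤n)
    where
    open +-*-Solver
    cancel : ∀ a b → (a ℚ.+ b) ℚ.- a ≡ b
    cancel = solve 2 (λ a b → (a :+ b) :- a := b) refl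
    below : ∀ p q → ∣ p ∣ ℚ.- ∣ q ∣ ℚ.≤ ∣ p ℚ.- q ∣
    below p q = subst (∣ p ∣ ℚ.- ∣ q ∣ ℚ.≤_) (cancel ∣ q ∣ ∣ p ℚ.- q ∣)
      (ℚₚ.+-monoˡ-≤ (ℚ.- ∣ q ∣) (∣p∣≤∣q∣+∣p-q∣ p q))
    swap : ∀ a b → b ℚ.- a ≡ ℚ.- (a ℚ.- b)
    swap = solve 2 (λ a b → b :- a := :- (a :- b)) refl
    reverse : ∀ p q → ∣ ∣ p ∣ ℚ.- ∣ q ∣ ∣ ℚ.≤ ∣ p ℚ.- q ∣
    reverse p q =
      [ (λ eq → subst (ℚ._≤ ∣ p ℚ.- q ∣) (sym eq) (below p q))
      , (λ eq → subst₂ ℚ._≤_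
          (trans (swap (∣ p ∣) (∣ q ∣)) (sym eq)) (∣p-q∣≡∣q-p∣ q p) (below q p))
      ]′ (ℚₚ.∣p∣≡p∨∣p∣≡-p (∣ p ∣ ℚ.- ∣ q ∣))

infix  4 _≈ʳ_ _<ʳ_ _≤ʳ_
infixl 6 _+ʳ_ _-ʳ_
infixl 7 _*ʳ_
infix  8 -ʳ_

record _≈ʳ_ (x y : ℝ) : Set where
  constructor mk≈
  field
    close : ∀ ε → 0ℚ ℚ.< ε →
      ∃ λ N → ∀ n → N ℕ.≤ n → ∣ seq x n ℚ.- seq y n ∣ ℚ.< ε

record _<ʳ_ (x y : ℝ) : Set where
  constructor mk<
  field
    gap   : ℚ
    gap>0 : 0ℚ ℚ.< gap
    apart : ∃ λ N → ∀ n → N ℕ.≤ n → seq x n ℚ.+ gap ℚ.≤ seq y n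

_≤ʳ_ : ℝ → ℝ → Set
x ≤ʳ y = ¬ (y <ʳ x)

fromℚ : ℚ → ℝ
fromℚ q = mkℝ (λ _ → q) (const-cauchy q)

0ʳ 1ʳ : ℝ
0ʳ = fromℚ 0ℚ
1ʳ = fromℚ 1ℚ

_+ʳ_ : ℝ → ℝ → ℝ
x +ʳ y = mkℝ (λ n → seq x n ℚ.+ seq y n) (+-cauchy {seq x} {seq y} (cauchy x) (cauchy y))

_*ʳ_ : ℝ → ℝ → ℝ
x *ʳ y = mkℝ (λ n → seq x n ℚ.* seq y n) (*-cauchy {seq x} {seq y} (cauchy x) (cauchy y))

-ʳ_ : ℝ → ℝ
-ʳ x = mkℝ (λ n → ℚ.- seq x n) (neg-cauchy {seq x} (cauchy x))

_-ʳ_ : ℝ → ℝ → ℝ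
x -ʳ y = x +ʳ (-ʳ y)

absʳ : ℝ → ℝ
absʳ x = mkℝ (λ n → ∣ seq x n ∣) (abs-cauchy {seq x} (cauchy x))

ℝ-rawRing : RawRing 0ℓ 0ℓ
ℝ-rawRing = record
  { Carrier = ℝ ; _≈_ = _≈ʳ_
  ; _+_ = _+ʳ_ ; _*_ = _*ʳ_ ; -_ = -ʳ_ ; 0# = 0ʳ ; 1# = 1ʳ }

------------------------------------------------------------------------
-- Complex numbers

record ℂ : Set where
  constructor _+i_
  field
    re im : ℝ

open ℂ public

infix  4 _≈ᶜ_
infixl 6 _+ᶜ_ _-ᶜ_
infixl 7 _*ᶜ_
infix  8 -ᶜ_

record _≈ᶜ_ (z w : ℂ) : Set where
  constructor mk≈ᶜ
  field
    re≈ : re z ≈ʳ re w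
    im≈ : im z ≈ʳ im w

_+ᶜ_ : ℂ → ℂ → ℂ
z +ᶜ w = (re z +ʳ re w) +i (im z +ʳ im w)

_*ᶜ_ : ℂ → ℂ → ℂ
z *ᶜ w = (re z *ʳ re w -ʳ im z *ʳ im w) +i (re z *ʳ im w +ʳ im z *ʳ re w)

-ᶜ_ : ℂ → ℂ
-ᶜ z = (-ʳ re z) +i (-ʳ im z)

_-ᶜ_ : ℂ → ℂ → ℂ
z -ᶜ w = z +ᶜ (-ᶜ w)

conj : ℂ → ℂ
conj z = re z +i (-ʳ im z)

fromℝ : ℝ → ℂ
fromℝ x = x +i 0ʳ

-- The squared modulus; ∣z∣ < r and ∣z∣ ≤ r (r ≥ 0) are written
-- normSq z <ʳ r *ʳ r and normSq z ≤ʳ r *ʳ r, avoiding square roots.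
normSq : ℂ → ℝ
normSq z = re z *ʳ re z +ʳ im z *ʳ im z

ℂ-rawRing : RawRing 0ℓ 0ℓ
ℂ-rawRing = record
  { Carrier = ℂ ; _≈_ = _≈ᶜ_
  ; _+_ = _+ᶜ_ ; _*_ = _*ᶜ_ ; -_ = -ᶜ_ ; 0# = fromℝ 0ʳ ; 1# = fromℝ 1ʳ }

------------------------------------------------------------------------
-- Algebraic integers, conjugates, Pisot numbers

-- The monic polynomial Xⁿ + aₙ₋₁ Xⁿ⁻¹ + … + a₀ is given by the vector a.
evalMonic : ∀ {n} → Vector ℚ n → ℂ → ℂ
evalMonic {n} a z =
  (z ^ n) +ᶜ sum (λ i → fromℝ (fromℚ (a i)) *ᶜ (z ^ toℕ i))
  where open SemiringOps (RawRing.rawSemiring ℂ-rawRing)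

_IsRootOf_ : ∀ {n} → ℂ → Vector ℚ n → Set
z IsRootOf a = evalMonic a z ≈ᶜ fromℝ 0ʳ

fromℤ : ℤ → ℚ
fromℤ k = k ℚ./ 1

IsAlgebraicInteger : ℂ → Set
IsAlgebraicInteger z = ∃ λ n → ∃ λ (a : Vector ℤ n) → z IsRootOf (fromℤ ∘ a)

record IsMinimalPolynomial {n} (a : Vector ℚ n) (z : ℂ) : Set where
  field
    root    : z IsRootOf a
    minimal : ∀ {m} (b : Vector ℚ m) → z IsRootOf b → n ℕ.≤ m

IsConjugate : ℂ → ℂ → Set
IsConjugate z w =
  ∃ λ n → ∃ λ (a : Vector ℚ n) → IsMinimalPolynomial a z × w IsRootOf a

record IsPisot (θ : ℝ) : Set where
  field
    isAlgebraicInteger : IsAlgebraicInteger (fromℝ θ)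
    >1                 : 1ʳ <ʳ θ
    conjugates<1       : ∀ w → IsConjugate (fromℝ θ) w → ¬ (w ≈ᶜ fromℝ θ) →
                         normSq w <ʳ 1ʳ

------------------------------------------------------------------------
-- Real number fields

record IsSubfield (P : Pred ℝ ℓ) : Set ℓ where
  field
    resp       : ∀ {x y} → x ≈ʳ y → x ∈ P → y ∈ P
    0∈         : 0ʳ ∈ P
    1∈         : 1ʳ ∈ P
    +-closed   : ∀ {x y} → x ∈ P → y ∈ P → x +ʳ y ∈ P
    *-closed   : ∀ {x y} → x ∈ P → y ∈ P → x *ʳ y ∈ P
    neg-closed : ∀ {x} → x ∈ P → -ʳ x ∈ P
    -- y is the inverse of x; a real has one exactly when it is nonzero.
    inv-closed : ∀ {x y} → x *ʳ y ≈ʳ 1ʳ → x ∈ P → y ∈ P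

-- The smallest subfield of ℝ containing θ.
data ℚ⟨_⟩ (θ : ℝ) : Pred ℝ 0ℓ where
  gen  : θ ∈ ℚ⟨ θ ⟩
  eqv  : ∀ {x y} → x ≈ʳ y → x ∈ ℚ⟨ θ ⟩ → y ∈ ℚ⟨ θ ⟩
  0gen : 0ʳ ∈ ℚ⟨ θ ⟩
  1gen : 1ʳ ∈ ℚ⟨ θ ⟩
  add  : ∀ {x y} → x ∈ ℚ⟨ θ ⟩ → y ∈ ℚ⟨ θ ⟩ → x +ʳ y ∈ ℚ⟨ θ ⟩
  mul  : ∀ {x y} → x ∈ ℚ⟨ θ ⟩ → y ∈ ℚ⟨ θ ⟩ → x *ʳ y ∈ ℚ⟨ θ ⟩
  neg  : ∀ {x} → x ∈ ℚ⟨ θ ⟩ → -ʳ x ∈ ℚ⟨ θ ⟩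
  inv  : ∀ {x y} → x *ʳ y ≈ʳ 1ʳ → x ∈ ℚ⟨ θ ⟩ → y ∈ ℚ⟨ θ ⟩

combination : ∀ {n} → Vector ℚ n → Vector ℝ n → ℝ
combination c b = sum (λ i → fromℚ (c i) *ʳ b i)
  where open SemiringOps (RawRing.rawSemiring ℝ-rawRing)

record IsℚBasis {n} (b : Vector ℝ n) (P : Pred ℝ ℓ) : Set ℓ where
  field
    basis∈      : ∀ i → b i ∈ P
    spanning    : ∀ {x} → x ∈ P → ∃ λ c → x ≈ʳ combination c b
    independent : ∀ c → combination c b ≈ʳ 0ʳ → ∀ i → c i ≡ 0ℚ

record RealNumberField ℓ : Set (lsuc ℓ) where
  field
    member     : Pred ℝ ℓ
    isSubfield : IsSubfield member
    degree     : ℕ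
    basis      : Vector ℝ degree
    isBasis    : IsℚBasis basis member

  open IsSubfield isSubfield public

  Element : Set ℓ
  Element = ∃ member

  rawRing : RawRing ℓ 0ℓ
  rawRing = record
    { Carrier = Element
    ; _≈_ = λ x y → proj₁ x ≈ʳ proj₁ y
    ; _+_ = λ x y → _ , +-closed (proj₂ x) (proj₂ y)
    ; _*_ = λ x y → _ , *-closed (proj₂ x) (proj₂ y)
    ; -_  = λ x → _ , neg-closed (proj₂ x)
    ; 0#  = _ , 0∈
    ; 1#  = _ , 1∈
    }

-- The set ℘_K, as a predicate on the elements of K.
℘ : (K : RealNumberField ℓ) → Pred (RealNumberField.Element K) ℓ
℘ K (θ , _) = IsPisot θ × (RealNumberField.member K ≐ ℚ⟨ θ ⟩)

------------------------------------------------------------------------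
-- Embeddings into ℂ

module _ (K : RealNumberField ℓ) where
  open RealNumberField K
  open RingMorphisms rawRing ℂ-rawRing using (IsRingMonomorphism)

  record Embedding : Set ℓ where
    field
      ⟦_⟧                : Element → ℂ
      isRingMonomorphism : IsRingMonomorphism ⟦_⟧

open Embedding public using (⟦_⟧)

module _ {K : RealNumberField ℓ} where

  infix 4 _≈ᵉ_
  _≈ᵉ_ : Embedding K → Embedding K → Set ℓ
  σ ≈ᵉ τ = ∀ x → ⟦ σ ⟧ x ≈ᶜ ⟦ τ ⟧ x

  IsRealEmbedding : Embedding K → Set ℓ
  IsRealEmbedding σ = ∀ x → im (⟦ σ ⟧ x) ≈ʳ 0ʳ

-- A labelling σ₁, …, σ_{s+2t} of the embeddings of K, where s = suc s-1.
-- Indices start at 0: σ_{k+1} is σ j for the j with toℕ j ≡ k.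
record Labelling (K : RealNumberField ℓ) : Set ℓ where
  open RealNumberField K using (degree)
  field
    s-1 t : ℕ

  s : ℕ
  s = ℕ.suc s-1

  field
    degree≡s+2t : degree ≡ s ℕ.+ (t ℕ.+ t)
    σ           : Fin (s ℕ.+ (t ℕ.+ t)) → Embedding K
    enumerates  : Bijective _≡_ _≈ᵉ_ σ
    σ₁-identity : ∀ x → ⟦ σ zero ⟧ x ≈ᶜ fromℝ (proj₁ x)
    σ-real      : ∀ j → IsRealEmbedding (σ j) ⇔ toℕ j ℕ.< s
    σ-conj      : ∀ (j : Fin t) x →
                  ⟦ σ (s ↑ʳ (t ↑ʳ j)) ⟧ x ≈ᶜ conj (⟦ σ (s ↑ʳ (j ↑ˡ t)) ⟧ x)

------------------------------------------------------------------------
-- ℝᵐ × ℂⁿ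

Point : ℕ → ℕ → Set
Point m n = Vector ℝ m × Vector ℂ n

module _ {m n : ℕ} where

  infix 4 _≈ᵖ_
  _≈ᵖ_ : Point m n → Point m n → Set
  (x , z) ≈ᵖ (y , w) = (∀ i → x i ≈ʳ y i) × (∀ j → z j ≈ᶜ w j)

  Within : ℝ → Point m n → Point m n → Set
  Within ε (x , z) (y , w) =
    (∀ i → absʳ (x i -ʳ y i) <ʳ ε) × (∀ j → normSq (z j -ᶜ w j) <ʳ ε *ʳ ε)

  _IsDenseIn_ : Pred (Point m n) ℓ₁ → Pred (Point m n) ℓ₂ → Set (ℓ₁ ⊔ ℓ₂)
  A IsDenseIn B = A ⊆ B ×
    (∀ {q} → q ∈ B → ∀ ε → 0ʳ <ʳ ε → ∃ λ p → p ∈ A × Within ε p q)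

-- [-1,1]ᵐ × {z ∈ ℂ : ∣z∣ ≤ 1}ⁿ
Polydisc : ∀ m n → Pred (Point m n) 0ℓ
Polydisc m n (x , z) =
  (∀ i → -ʳ 1ʳ ≤ʳ x i × x i ≤ʳ 1ʳ) × (∀ j → normSq (z j) ≤ʳ 1ʳ)

module _ {K : RealNumberField ℓ} (L : Labelling K) where
  open RealNumberField K using (Element)
  open Labelling L

  -- (σ₂(θ), …, σ_{s+t}(θ)), the first s-1 coordinates being real.
  conjugateTuple : Element → Point s-1 t
  conjugateTuple θ = (λ i → re (⟦ σ (suc i ↑ˡ (t ℕ.+ t)) ⟧ θ))
                   , (λ j → ⟦ σ (s ↑ʳ (j ↑ˡ t)) ⟧ θ)

  conjugateTuples : Pred (Point s-1 t) ℓ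
  conjugateTuples p = ∃ λ θ → θ ∈ ℘ K × p ≈ᵖ conjugateTuple θ

{-# OPTIONS --safe #-}
module Submission where

-- Let S = (σ_j(b_i)) for a ℚ-basis b of K.  By Dedekind S is invertible, and SᵀS = T is the
-- rational matrix of the trace form, so T⁻¹Sᵀ is an explicit inverse of S: every target
-- compatible with complex conjugation is hit by real coefficients.  Let D clear the
-- denominators of the structure constants; then ⊕ ℤ·D b_i is closed under products.  By the
-- pigeonhole principle it has an element β ≠ 0 all of whose conjugates but the first are
-- small.  Solving for the target Q_j/σ_j(β), rounding the coefficients and multiplying by β
-- gives θ with σ_j(θ) − Q_j = O(σ_j(β)).  With Q_j = (1 − η) q_j for j ≥ 2 and Q_1 large, θ > 1
-- and its other conjugates lie in the open disc, close to the given q_j.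
--
-- Such a θ generates K: if θ were a root of a monic rational polynomial of degree k < d, some
-- y ≠ 0 would be trace-orthogonal to 1, θ, …, θᵏ⁻¹, hence to all powers of θ, and in
-- ∑ σ_j(y) σ_j(θ)ⁿ = 0 the coefficient y of the isolated θ must vanish.  So the powers of θ span
-- K, and θ is integral because two large powers have congruent numerators over 1, …, θᵈ⁻¹.
--
-- Real equality and the inclusion in the closed polydisc are ¬¬-stable, which allows
-- classical reasoning (inverse of S, minimal polynomials) inside their proofs.

open import Algebra.Bundles using (CommutativeRing; RawRing)
open import Data.Empty using (⊥; ⊥-elim)
open import Data.Fin.Base using (Fin; zero; suc; toℕ; fromℕ; fromℕ<; inject₁; inject≤; punchIn; combine; funToFin; finToFun; _↑ˡ_; _↑ʳ_)
import Data.Fin.Properties as Finₚ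
open import Data.Integer.Base as ℤ using (ℤ; +_; -[1+_]; 0ℤ; 1ℤ)
import Data.Integer.Properties as ℤₚ
open import Data.Maybe.Base using (Maybe; just; nothing)
open import Data.Nat.Base as ℕ using (ℕ; zero; suc)
import Data.Nat.Properties as ℕₚ
open import Data.Product.Base using (∃; _×_; _,_; proj₁; proj₂)
open import Data.Rational.Base as ℚ using (ℚ; 0ℚ; 1ℚ; ½; ∣_∣)
import Data.Rational.Properties as ℚₚ
open import Data.Sum.Base using (_⊎_; inj₁; inj₂)
open import Data.Vec.Functional using (Vector; insertAt; _∷_; _++_)
import Data.Vec.Functional.Properties as Vecₚ
open import Function.Base using (_∘_; id)
open import Level using (0ℓ)
open import Relation.Binary.PropositionalEquality as ≡ using (_≡_; _≢_)
open import Relation.Nullary using (¬_; Dec; yes; no)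

-- The obstacle is constructive content. Density asks for an actual `θ`, and `conjugates<1` asks for
-- a strict inequality with an explicit gap; neither is stable under double negation, so an inverse
-- of `S` that exists only classically cannot produce the coefficients. The trace form repairs this:
-- its matrix is rational, equality of rationals is decidable, and elimination over ℚ computes
-- `T⁻¹`. Likewise the linear forms are replaced by rational approximations before the pigeonhole
-- search, and case distinctions on reals leave an overlap between the cases.
--
-- Shrinking by `1 − η` is needed because the target may lie on the boundary of the polydisc, while
-- the conjugates of a Pisot number lie strictly inside. The first conjugate of `β` is not
-- controlled, so at that place the error is only known to be below some `M`; the target `2 + M`
-- forces `θ ≥ 2`, which gives `θ > 1` and also separates `θ` from its other conjugates. The bound
-- on the rounding error before multiplication by `β` depends only on the field and its basis, so
-- `β` can be chosen afterwards, as small as that bound requires.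

-- Rational inequalities, integers inside ℚ, rounding

module Rationals where

  open import Defs using (fromℤ)
  open import Data.Rational.Base
  open import Data.Rational.Properties
  open import Data.Rational.Solver using (module +-*-Solver)
  import Data.Rational.Unnormalised.Base as ℚᵘ
  import Data.Rational.Unnormalised.Properties as ℚᵘₚ
  open import Relation.Binary.PropositionalEquality
  open +-*-Solver

  -- The slack `t` serves as a certificate: it is written as a sum of products of visibly
  -- nonnegative terms, and what remains is a ring identity for the solver. Most estimates below
  -- have this shape.
  ≤-cert : ∀ {p q t} → 0ℚ ≤ t → p + t ≡ q → p ≤ q
  ≤-cert {p} {q} {t} 0≤t eq =
    subst₂ _≤_ (+-identityʳ p) eq (+-monoʳ-≤ p 0≤t)

  <-cert : ∀ {p q t} → 0ℚ < t → p + t ≡ q → p < q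
  <-cert {p} {q} {t} 0<t eq =
    subst₂ _<_ (+-identityʳ p) eq (+-monoʳ-< p 0<t)

  p+[q-p]≡q : ∀ p q → p + (q - p) ≡ q
  p+[q-p]≡q = solve 2 (λ p q → p :+ (q :- p) := q) refl

  p≤q⇒0≤q-p : ∀ {p q} → p ≤ q → 0ℚ ≤ q - p
  p≤q⇒0≤q-p {p} {q} p≤q = subst (_≤ q - p) (+-inverseʳ p) (+-monoˡ-≤ (- p) p≤q)

  p<q⇒0<q-p : ∀ {p q} → p < q → 0ℚ < q - p
  p<q⇒0<q-p {p} {q} p<q = subst (_< q - p) (+-inverseʳ p) (+-monoˡ-< (- p) p<q)

  0≤p+q : ∀ {p q} → 0ℚ ≤ p → 0ℚ ≤ q → 0ℚ ≤ p + q
  0≤p+q = +-mono-≤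

  0<p+q : ∀ {p q} → 0ℚ < p → 0ℚ ≤ q → 0ℚ < p + q
  0<p+q = +-mono-<-≤

  0≤p*q : ∀ {p q} → 0ℚ ≤ p → 0ℚ ≤ q → 0ℚ ≤ p * q
  0≤p*q {p} {q} 0≤p 0≤q =
    subst (_≤ p * q) (*-zeroʳ p) (*-monoˡ-≤-nonNeg p {{nonNegative 0≤p}} 0≤q)

  0<p*q : ∀ {p q} → 0ℚ < p → 0ℚ < q → 0ℚ < p * q
  0<p*q {p} {q} 0<p 0<q =
    subst (_< p * q) (*-zeroʳ p) (*-monoʳ-<-pos p {{positive 0<p}} 0<q)

  *-mono-≤ : ∀ {p q r s} → 0ℚ ≤ q → 0ℚ ≤ r → p ≤ q → r ≤ s → p * r ≤ q * s
  *-mono-≤ {p} {q} {r} {s} 0≤q 0≤r p≤q r≤s = ≤-trans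
    (*-monoʳ-≤-nonNeg r {{nonNegative 0≤r}} p≤q)
    (*-monoˡ-≤-nonNeg q {{nonNegative 0≤q}} r≤s)

  *-monoˡ-≤′ : ∀ {r p q} → 0ℚ ≤ r → p ≤ q → r * p ≤ r * q
  *-monoˡ-≤′ {r} 0≤r = *-monoˡ-≤-nonNeg r {{nonNegative 0≤r}}

  0<½ : 0ℚ < ½
  0<½ = positive⁻¹ ½

  0<1 : 0ℚ < 1ℚ
  0<1 = positive⁻¹ 1ℚ

  0≤1 : 0ℚ ≤ 1ℚ
  0≤1 = <⇒≤ 0<1

  inverse>0 : ∀ {p} → 0ℚ < p → ∃ λ q → 0ℚ < q × p * q ≡ 1ℚ
  inverse>0 {p} 0<p = 1/ p , positive⁻¹ (1/ p) , *-inverseʳ p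
    where
    instance
      posp : Positive p
      posp = positive 0<p
      nzp : NonZero p
      nzp = pos⇒nonZero p
      pos1/p : Positive (1/ p)
      pos1/p = 1/pos⇒pos p

  -p≤∣p∣ : ∀ p → - p ≤ ∣ p ∣
  -p≤∣p∣ p with ∣p∣≡p∨∣p∣≡-p p
  ... | inj₂ eq = ≤-reflexive (sym eq)
  ... | inj₁ eq = ≤-trans (neg-antimono-≤ (∣p∣≡p⇒0≤p {p} eq)) (0≤∣p∣ p)

  p≤∣p∣ : ∀ p → p ≤ ∣ p ∣
  p≤∣p∣ p = subst₂ _≤_ (neg-involutive p) (∣-p∣≡∣p∣ p) (-p≤∣p∣ (- p))
    where
    neg-involutive : ∀ p → - (- p) ≡ p
    neg-involutive = solve 1 (λ p → :- (:- p) := p) refl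

  ∣p∣≤ : ∀ {p r} → p ≤ r → - p ≤ r → ∣ p ∣ ≤ r
  ∣p∣≤ {p} {r} p≤r -p≤r with ∣p∣≡p∨∣p∣≡-p p
  ... | inj₁ eq = subst (_≤ r) (sym eq) p≤r
  ... | inj₂ eq = subst (_≤ r) (sym eq) -p≤r

  ∣p-q∣≡∣q-p∣ : ∀ p q → ∣ p - q ∣ ≡ ∣ q - p ∣
  ∣p-q∣≡∣q-p∣ p q = trans (cong ∣_∣ (identity p q)) (∣-p∣≡∣p∣ (q - p))
    where
    identity : ∀ p q → p - q ≡ - (q - p)
    identity = solve 2 (λ p q → p :- q := :- (q :- p)) refl

  ∣p∣≤∣q∣+∣p-q∣ : ∀ p q → ∣ p ∣ ≤ ∣ q ∣ + ∣ p - q ∣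
  ∣p∣≤∣q∣+∣p-q∣ p q = subst (λ u → ∣ u ∣ ≤ ∣ q ∣ + ∣ p - q ∣) (p+[q-p]≡q q p)
    (∣p+q∣≤∣p∣+∣q∣ q (p - q))

  0≤p*p : ∀ p → 0ℚ ≤ p * p
  0≤p*p p = subst (0ℚ ≤_) (trans (sym (∣p*q∣≡∣p∣*∣q∣ p p)) (0≤p⇒∣p∣≡p lemma))
    (0≤p*q (0≤∣p∣ p) (0≤∣p∣ p))
    where
    lemma : 0ℚ ≤ p * p
    lemma with ≤-total 0ℚ p
    ... | inj₁ 0≤p = 0≤p*q 0≤p 0≤p
    ... | inj₂ p≤0 = subst (0ℚ ≤_) (solve 1 (λ p → (:- p) :* (:- p) := p :* p) refl p)
      (0≤p*q (neg-antimono-≤ p≤0) (neg-antimono-≤ p≤0))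

  p*p≤ : ∀ {p r} → ∣ p ∣ ≤ r → p * p ≤ r * r
  p*p≤ {p} {r} h = ≤-trans (p≤∣p∣ (p * p)) (subst (_≤ r * r) (sym (∣p*q∣≡∣p∣*∣q∣ p p))
    (*-mono-≤ (≤-trans (0≤∣p∣ p) h) (0≤∣p∣ p) h h))

  toℚᵘ-fromℤ : ∀ k → toℚᵘ (fromℤ k) ℚᵘ.≃ ℚᵘ.mkℚᵘ k 0
  toℚᵘ-fromℤ k = toℚᵘ-fromℚᵘ (ℚᵘ.mkℚᵘ k 0)

  fromℤ-+ : ∀ a b → fromℤ (a ℤ.+ b) ≡ fromℤ a + fromℤ b
  fromℤ-+ a b = toℚᵘ-injective (begin
    toℚᵘ (fromℤ (a ℤ.+ b))                  ≈⟨ toℚᵘ-fromℤ (a ℤ.+ b) ⟩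
    ℚᵘ.mkℚᵘ (a ℤ.+ b) 0
      ≈⟨ ℚᵘ.*≡* (cong (ℤ._* + 1) (sym (cong₂ ℤ._+_ (ℤₚ.*-identityʳ a) (ℤₚ.*-identityʳ b)))) ⟩
    ℚᵘ.mkℚᵘ a 0 ℚᵘ.+ ℚᵘ.mkℚᵘ b 0
      ≈⟨ ℚᵘₚ.+-cong (toℚᵘ-fromℤ a) (toℚᵘ-fromℤ b) ⟨
    toℚᵘ (fromℤ a) ℚᵘ.+ toℚᵘ (fromℤ b)      ≈⟨ toℚᵘ-homo-+ (fromℤ a) (fromℤ b) ⟨
    toℚᵘ (fromℤ a + fromℤ b)                ∎)
    where open ℚᵘₚ.≃-Reasoning

  fromℤ-* : ∀ a b → fromℤ (a ℤ.* b) ≡ fromℤ a * fromℤ b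
  fromℤ-* a b = toℚᵘ-injective (begin
    toℚᵘ (fromℤ (a ℤ.* b))                  ≈⟨ toℚᵘ-fromℤ (a ℤ.* b) ⟩
    ℚᵘ.mkℚᵘ a 0 ℚᵘ.* ℚᵘ.mkℚᵘ b 0
      ≈⟨ ℚᵘₚ.*-cong (toℚᵘ-fromℤ a) (toℚᵘ-fromℤ b) ⟨
    toℚᵘ (fromℤ a) ℚᵘ.* toℚᵘ (fromℤ b)      ≈⟨ toℚᵘ-homo-* (fromℤ a) (fromℤ b) ⟨
    toℚᵘ (fromℤ a * fromℤ b)                ∎)
    where open ℚᵘₚ.≃-Reasoning

  fromℤ-neg : ∀ a → fromℤ (ℤ.- a) ≡ - fromℤ a
  fromℤ-neg a = toℚᵘ-injective (begin
    toℚᵘ (fromℤ (ℤ.- a))  ≈⟨ toℚᵘ-fromℤ (ℤ.- a) ⟩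
    ℚᵘ.- ℚᵘ.mkℚᵘ a 0      ≈⟨ ℚᵘₚ.-‿cong (toℚᵘ-fromℤ a) ⟨
    ℚᵘ.- toℚᵘ (fromℤ a)   ≈⟨ toℚᵘ-homo‿- (fromℤ a) ⟨
    toℚᵘ (- fromℤ a)      ∎)
    where open ℚᵘₚ.≃-Reasoning

  fromℤ-mono-≤ : ∀ {a b} → a ℤ.≤ b → fromℤ a ≤ fromℤ b
  fromℤ-mono-≤ {a} {b} a≤b = toℚᵘ-cancel-≤ (begin
    toℚᵘ (fromℤ a)  ≃⟨ toℚᵘ-fromℤ a ⟩
    ℚᵘ.mkℚᵘ a 0
      ≤⟨ ℚᵘ.*≤* (subst₂ ℤ._≤_ (sym (ℤₚ.*-identityʳ a)) (sym (ℤₚ.*-identityʳ b)) a≤b) ⟩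
    ℚᵘ.mkℚᵘ b 0     ≃⟨ ℚᵘₚ.≃-sym (toℚᵘ-fromℤ b) ⟩
    toℚᵘ (fromℤ b)  ∎)
    where open ℚᵘₚ.≤-Reasoning

  fromℤ-injective : ∀ {a b} → fromℤ a ≡ fromℤ b → a ≡ b
  fromℤ-injective {a} {b} eq
    with ℚᵘ.*≡* e ← ℚᵘₚ.≃-trans (ℚᵘₚ.≃-sym (toℚᵘ-fromℤ a))
           (ℚᵘₚ.≃-trans (ℚᵘₚ.≃-reflexive (cong toℚᵘ eq)) (toℚᵘ-fromℤ b))
    = subst₂ _≡_ (ℤₚ.*-identityʳ a) (ℤₚ.*-identityʳ b) e

  fromℕ′ : ℕ → ℚ
  fromℕ′ n = fromℤ (+ n)

  fromℕ-suc : ∀ n → fromℕ′ (suc n) ≡ fromℕ′ n + 1ℚ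
  fromℕ-suc n = trans (cong fromℤ (cong +_ (ℕₚ.+-comm 1 n))) (fromℤ-+ (+ n) (+ 1))

  0≤fromℕ : ∀ n → 0ℚ ≤ fromℕ′ n
  0≤fromℕ n = fromℤ-mono-≤ {+ 0} {+ n} (ℤ.+≤+ ℕ.z≤n)

  0<fromℕ-suc : ∀ n → 0ℚ < fromℕ′ (suc n)
  0<fromℕ-suc n = subst (0ℚ <_) (trans (+-comm 1ℚ (fromℕ′ n)) (sym (fromℕ-suc n)))
    (0<p+q 0<1 (0≤fromℕ n))

  0<fromℕ : ∀ n → .{{ℕ.NonZero n}} → 0ℚ < fromℕ′ n
  0<fromℕ (suc n) = 0<fromℕ-suc n

  denominator-clears : ∀ q → fromℤ (↧ q) * q ≡ fromℤ (↥ q)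
  denominator-clears q@(mkℚ n d-1 _) = toℚᵘ-injective (begin
    toℚᵘ (fromℤ (↧ q) * q)            ≈⟨ toℚᵘ-homo-* (fromℤ (↧ q)) q ⟩
    toℚᵘ (fromℤ (↧ q)) ℚᵘ.* toℚᵘ q    ≈⟨ ℚᵘₚ.*-congʳ {toℚᵘ q} (toℚᵘ-fromℤ (↧ q)) ⟩
    ℚᵘ.mkℚᵘ (↧ q) 0 ℚᵘ.* toℚᵘ q       ≈⟨ ℚᵘ.*≡* identity ⟩
    ℚᵘ.mkℚᵘ (↥ q) 0                   ≈⟨ toℚᵘ-fromℤ (↥ q) ⟨
    toℚᵘ (fromℤ (↥ q))                ∎)
    where
    open ℚᵘₚ.≃-Reasoning
    identity : ((+ suc d-1) ℤ.* n) ℤ.* + 1 ≡ n ℤ.* (+ suc (d-1 ℕ.+ 0))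
    identity = trans (ℤₚ.*-identityʳ _) (trans (ℤₚ.*-comm (+ suc d-1) n)
      (cong (λ k → n ℤ.* + suc k) (sym (ℕₚ.+-identityʳ d-1))))

  i≤∣i∣ : ∀ i → i ℤ.≤ + ℤ.∣ i ∣
  i≤∣i∣ (+ n) = ℤₚ.≤-refl
  i≤∣i∣ -[1+ n ] = ℤ.-≤+

  archimedean : ∀ q → ∃ λ n → q ≤ fromℕ′ n
  archimedean q with ≤-total q 0ℚ
  ... | inj₁ q≤0 = 0 , q≤0
  ... | inj₂ 0≤q = ℤ.∣ ↥ q ∣ , ≤-trans q≤d*q
    (subst (_≤ fromℕ′ ℤ.∣ ↥ q ∣) (sym (denominator-clears q)) (fromℤ-mono-≤ {↥ q} {+ ℤ.∣ ↥ q ∣} (i≤∣i∣ (↥ q))))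
    where
    q≤d*q : q ≤ fromℤ (↧ q) * q
    q≤d*q = subst (_≤ fromℤ (↧ q) * q) (*-identityˡ q)
      (*-monoʳ-≤-nonNeg q {{nonNegative 0≤q}} (fromℤ-mono-≤ {+ 1} {↧ q} (ℤ.+≤+ (ℕ.s≤s ℕ.z≤n))))

  -- The floor of `q`, delivered as an element of `Fin n` so that it can serve as a pigeonhole cell.
  locate : ∀ n q → 0ℚ ≤ q → q < fromℕ′ n →
    ∃ λ (k : Fin n) → fromℕ′ (toℕ k) ≤ q × q < fromℕ′ (toℕ k) + 1ℚ
  locate zero q 0≤q q<0 = ⊥-elim (<-irrefl refl (≤-<-trans 0≤q q<0))
  locate (suc n) q 0≤q q<n with q <? fromℕ′ n
  ... | yes q<n′ = let k , lo , hi = locate n q 0≤q q<n′ in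
    inject₁ k , subst (λ i → fromℕ′ i ≤ q × q < fromℕ′ i + 1ℚ) (sym (Finₚ.toℕ-inject₁ k)) (lo , hi)
  ... | no q≮n = fromℕ n , subst (λ i → fromℕ′ i ≤ q × q < fromℕ′ i + 1ℚ)
    (sym (Finₚ.toℕ-fromℕ n)) (≮⇒≥ q≮n , subst (q <_) (fromℕ-suc n) q<n)

  nearby-integer : ∀ q → ∃ λ k → ∣ fromℤ k - q ∣ ≤ 1ℚ
  nearby-integer q =
    -- Adding `A` makes `q` nonnegative, as `locate` requires; it is subtracted again in `c`.
    let A , -q≤A = archimedean (- q)
        B , h = archimedean (q + fromℕ′ A)
        k , lo , hi = locate (suc B) (q + fromℕ′ A)
          (subst (_≤ q + fromℕ′ A) (+-inverseʳ q) (+-monoʳ-≤ q -q≤A))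
          (≤-<-trans h (subst (fromℕ′ B <_) (sym (fromℕ-suc B)) (<-cert 0<1 refl)))
        c = + toℕ k ℤ.- + A
        eq : fromℕ′ (toℕ k) - fromℕ′ A ≡ fromℤ c
        eq = sym (trans (fromℤ-+ (+ toℕ k) (ℤ.- + A)) (cong (λ z → fromℕ′ (toℕ k) + z) (fromℤ-neg (+ A))))
    in c , subst (λ z → ∣ z - q ∣ ≤ 1ℚ) eq (∣p∣≤
      (≤-cert (0≤p+q (p≤q⇒0≤q-p lo) 0≤1) (id₁ (fromℕ′ (toℕ k)) (fromℕ′ A) q))
      (≤-cert (p≤q⇒0≤q-p (<⇒≤ hi)) (id₂ (fromℕ′ (toℕ k)) (fromℕ′ A) q)))
    where
    id₁ : ∀ k A q → (k - A - q) + ((q + A - k) + 1ℚ) ≡ 1ℚ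
    id₁ = solve 3 (λ k A q → (k :- A :- q) :+ ((q :+ A :- k) :+ con 1ℚ) := con 1ℚ) refl
    id₂ : ∀ k A q → - (k - A - q) + ((k + 1ℚ) - (q + A)) ≡ 1ℚ
    id₂ = solve 3 (λ k A q → :- (k :- A :- q) :+ ((k :+ con 1ℚ) :- (q :+ A)) := con 1ℚ) refl

-- Constructive real numbers: ring structure, apartness, inverses

module Reals where

  open import Defs
  open Rationals
  open import Algebra.Structures using (IsCommutativeRing)
  import Algebra.Solver.Ring as RingSolver
  import Algebra.Solver.Ring.AlmostCommutativeRing as ACR
  open import Data.Rational.Base
  open import Data.Rational.Solver using (module +-*-Solver)
  open ≡ using (refl; sym; trans; cong; cong₂; subst; subst₂)

  Ev : (ℕ → Set) → Set
  Ev P = ∃ λ N → ∀ n → N ℕ.≤ n → P n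

  ev-map : ∀ {P Q : ℕ → Set} → (∀ n → P n → Q n) → Ev P → Ev Q
  ev-map f (N , h) = N , λ n N≤n → f n (h n N≤n)

  ev-zip : ∀ {P Q R : ℕ → Set} → (∀ n → P n → Q n → R n) → Ev P → Ev Q → Ev R
  ev-zip f (M , g) (N , h) = M ℕ.+ N , λ n M+N≤n →
    f n (g n (ℕₚ.m+n≤o⇒m≤o M M+N≤n)) (h n (ℕₚ.m+n≤o⇒n≤o M M+N≤n))

  ev-witness : ∀ {P : ℕ → Set} → Ev P → ∃ P
  ev-witness (N , h) = N , h N ℕₚ.≤-refl

  -- ∣ x ∣ < r
  record _≺_ (x : ℝ) (r : ℚ) : Set where
    constructor mk≺
    field
      bound   : ℚ
      bound<  : bound < r
      bounded : Ev λ n → ∣ seq x n ∣ ≤ bound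

  infix 4 _≺_

  pointwise : ∀ {x y} → (∀ n → seq x n ≡ seq y n) → x ≈ʳ y
  pointwise {x} {y} eq = mk≈ λ ε 0<ε → 0 , λ n _ →
    subst (_< ε) (sym (cong ∣_∣ (trans (cong (_- seq y n) (eq n)) (ℚₚ.+-inverseʳ (seq y n))))) 0<ε

  half : ∀ {ε} → 0ℚ < ε → ∃ λ δ → 0ℚ < δ × δ + δ ≡ ε
  half {ε} 0<ε = ½ * ε , 0<p*q 0<½ 0<ε , solve 1 (λ e → con ½ :* e :+ con ½ :* e := e) refl ε
    where open +-*-Solver

  ≈⇒≺ : ∀ {x y} → x ≈ʳ y → ∀ ε → 0ℚ < ε → x -ʳ y ≺ ε
  ≈⇒≺ (mk≈ close) ε 0<ε = let δ , 0<δ , eq = half 0<ε in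
    mk≺ δ (<-cert 0<δ eq) (ev-map (λ _ → ℚₚ.<⇒≤) (close δ 0<δ))

  ≺⇒≈ : ∀ {x y} → (∀ ε → 0ℚ < ε → x -ʳ y ≺ ε) → x ≈ʳ y
  ≺⇒≈ h = mk≈ λ ε 0<ε → let open _≺_ (h ε 0<ε) in
    ev-map (λ _ b → ℚₚ.≤-<-trans b bound<) bounded

  ≺-weaken : ∀ {x r s} → r ≤ s → x ≺ r → x ≺ s
  ≺-weaken r≤s (mk≺ b b<r h) = mk≺ b (ℚₚ.<-≤-trans b<r r≤s) h

  ≺-pointwise : ∀ {x y r} → (∀ n → seq x n ≡ seq y n) → x ≺ r → y ≺ r
  ≺-pointwise eq (mk≺ b b<r h) = mk≺ b b<r (ev-map (λ n → subst (λ q → ∣ q ∣ ≤ b) (eq n)) h)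

  ≺-+ : ∀ {x y r s} → x ≺ r → y ≺ s → x +ʳ y ≺ r + s
  ≺-+ {x} {y} (mk≺ b b<r h) (mk≺ c c<s k) = mk≺ (b + c) (ℚₚ.+-mono-< b<r c<s)
    (ev-zip (λ n p q → ℚₚ.≤-trans (ℚₚ.∣p+q∣≤∣p∣+∣q∣ (seq x n) (seq y n)) (ℚₚ.+-mono-≤ p q)) h k)

  ≺-neg : ∀ {x r} → x ≺ r → -ʳ x ≺ r
  ≺-neg {x} (mk≺ b b<r h) = mk≺ b b<r
    (ev-map (λ n → subst (_≤ b) (sym (ℚₚ.∣-p∣≡∣p∣ (seq x n)))) h)

  ≺-0< : ∀ {x r} → x ≺ r → 0ℚ < r
  ≺-0< {x} (mk≺ b b<r h) with ev-witness h
  ... | n , ∣x∣≤b = ℚₚ.≤-<-trans (ℚₚ.≤-trans (ℚₚ.0≤∣p∣ (seq x n)) ∣x∣≤b) b<r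

  ≺-* : ∀ {x y r s} → x ≺ r → y ≺ s → x *ʳ y ≺ r * s
  ≺-* {x} {y} {r} {s} p@(mk≺ b b<r h) (mk≺ c c<s k) = mk≺ (r * c)
    (ℚₚ.*-monoʳ-<-pos r {{positive 0<r}} c<s)
    (ev-zip (λ n ∣x∣≤b ∣y∣≤c → subst (_≤ r * c) (sym (ℚₚ.∣p*q∣≡∣p∣*∣q∣ (seq x n) (seq y n)))
      (*-mono-≤ (ℚₚ.<⇒≤ 0<r) (ℚₚ.0≤∣p∣ (seq y n)) (ℚₚ.≤-trans ∣x∣≤b (ℚₚ.<⇒≤ b<r)) ∣y∣≤c)) h k)
    where
    0<r : 0ℚ < r
    0<r = ≺-0< {x} p

  ≺-fromℚ : ∀ {q r} → ∣ q ∣ < r → fromℚ q ≺ r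
  ≺-fromℚ {q} h = mk≺ ∣ q ∣ h (0 , λ _ _ → ℚₚ.≤-refl)

  ≺-bounded : ∀ x → ∃ λ r → x ≺ r
  ≺-bounded x with cauchy x 1ℚ 0<1
  ... | N , h = ∣ seq x N ∣ + 1ℚ + 1ℚ , mk≺ (∣ seq x N ∣ + 1ℚ) (<-cert 0<1 refl)
    (N , λ n N≤n → ℚₚ.≤-trans (∣p∣≤∣q∣+∣p-q∣ (seq x n) (seq x N))
      (ℚₚ.+-monoʳ-≤ ∣ seq x N ∣ (ℚₚ.<⇒≤ (h n N N≤n ℕₚ.≤-refl))))

  ≈-reflʳ : ∀ {x} → x ≈ʳ x
  ≈-reflʳ = pointwise λ _ → refl

  ≈-symʳ : ∀ {x y} → x ≈ʳ y → y ≈ʳ x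
  ≈-symʳ {x} {y} (mk≈ c) = mk≈ λ ε 0<ε → ev-map (λ n → subst (_< ε) (∣p-q∣≡∣q-p∣ (seq x n) (seq y n))) (c ε 0<ε)

  ≈-transʳ : ∀ {x y z} → x ≈ʳ y → y ≈ʳ z → x ≈ʳ z
  ≈-transʳ {x} {y} {z} x≈y y≈z = ≺⇒≈ λ ε 0<ε → let δ , 0<δ , eq = half 0<ε in
    subst (x -ʳ z ≺_) eq (≺-pointwise (λ n → identity (seq x n) (seq y n) (seq z n))
      (≺-+ (≈⇒≺ x≈y δ 0<δ) (≈⇒≺ y≈z δ 0<δ)))
    where
    open +-*-Solver
    identity : ∀ a b c → (a - b) + (b - c) ≡ a - c
    identity = solve 3 (λ a b c → (a :- b) :+ (b :- c) := a :- c) refl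

  +-congʳ : ∀ {x y u v} → x ≈ʳ y → u ≈ʳ v → x +ʳ u ≈ʳ y +ʳ v
  +-congʳ {x} {y} {u} {v} x≈y u≈v = ≺⇒≈ λ ε 0<ε → let δ , 0<δ , eq = half 0<ε in
    subst (x +ʳ u -ʳ (y +ʳ v) ≺_) eq
      (≺-pointwise (λ n → identity (seq x n) (seq y n) (seq u n) (seq v n))
        (≺-+ (≈⇒≺ x≈y δ 0<δ) (≈⇒≺ u≈v δ 0<δ)))
    where
    open +-*-Solver
    identity : ∀ a b c d → (a - b) + (c - d) ≡ a + c - (b + d)
    identity = solve 4 (λ a b c d → (a :- b) :+ (c :- d) := a :+ c :- (b :+ d)) refl

  -‿congʳ : ∀ {x y} → x ≈ʳ y → -ʳ x ≈ʳ -ʳ y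
  -‿congʳ {x} {y} x≈y = ≺⇒≈ λ ε 0<ε →
    ≺-pointwise (λ n → identity (seq x n) (seq y n)) (≺-neg (≈⇒≺ x≈y ε 0<ε))
    where
    open +-*-Solver
    identity : ∀ a b → - (a - b) ≡ - a - (- b)
    identity = solve 2 (λ a b → :- (a :- b) := :- a :- (:- b)) refl

  divide : ∀ {B ε} → 0ℚ < B → 0ℚ < ε → ∃ λ δ → 0ℚ < δ × B * δ ≡ ε
  divide {B} {ε} 0<B 0<ε with inverse>0 0<B
  ... | C , 0<C , BC≡1 = C * ε , 0<p*q 0<C 0<ε ,
    trans (sym (ℚₚ.*-assoc B C ε)) (trans (cong (_* ε) BC≡1) (ℚₚ.*-identityˡ ε))

  *-congˡʳ : ∀ {x u v} → u ≈ʳ v → x *ʳ u ≈ʳ x *ʳ v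
  *-congˡʳ {x} {u} {v} u≈v = ≺⇒≈ λ ε 0<ε → let
      B , x≺B = ≺-bounded x
      δ , 0<δ , eq = divide (≺-0< x≺B) 0<ε in
    subst (x *ʳ u -ʳ x *ʳ v ≺_) eq
      (≺-pointwise (λ n → identity (seq x n) (seq u n) (seq v n)) (≺-* x≺B (≈⇒≺ u≈v δ 0<δ)))
    where
    open +-*-Solver
    identity : ∀ a c d → a * (c - d) ≡ a * c - a * d
    identity = solve 3 (λ a c d → a :* (c :- d) := a :* c :- a :* d) refl

  *-commʳ : ∀ x y → x *ʳ y ≈ʳ y *ʳ x
  *-commʳ x y = pointwise λ n → ℚₚ.*-comm (seq x n) (seq y n)

  *-congʳ : ∀ {x y u v} → x ≈ʳ y → u ≈ʳ v → x *ʳ u ≈ʳ y *ʳ v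
  *-congʳ {x} {y} {u} {v} x≈y u≈v = ≈-transʳ (*-congˡʳ u≈v)
    (≈-transʳ (*-commʳ x v) (≈-transʳ (*-congˡʳ x≈y) (*-commʳ v y)))

  ℝ-isCommutativeRing : IsCommutativeRing _≈ʳ_ _+ʳ_ _*ʳ_ -ʳ_ 0ʳ 1ʳ
  ℝ-isCommutativeRing = record
    { isRing = record
      { +-isAbelianGroup = record
        { isGroup = record
          { isMonoid = record
            { isSemigroup = record
              { isMagma = record
                { isEquivalence = record { refl = ≈-reflʳ ; sym = ≈-symʳ ; trans = ≈-transʳ }
                ; ∙-cong = +-congʳ }
              ; assoc = λ x y z → pointwise λ n → ℚₚ.+-assoc (seq x n) (seq y n) (seq z n) }
            ; identity = (λ x → pointwise λ n → ℚₚ.+-identityˡ (seq x n))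
                       , (λ x → pointwise λ n → ℚₚ.+-identityʳ (seq x n)) }
          ; inverse = (λ x → pointwise λ n → ℚₚ.+-inverseˡ (seq x n))
                    , (λ x → pointwise λ n → ℚₚ.+-inverseʳ (seq x n))
          ; ⁻¹-cong = -‿congʳ }
        ; comm = λ x y → pointwise λ n → ℚₚ.+-comm (seq x n) (seq y n) }
      ; *-cong = *-congʳ
      ; *-assoc = λ x y z → pointwise λ n → ℚₚ.*-assoc (seq x n) (seq y n) (seq z n)
      ; *-identity = (λ x → pointwise λ n → ℚₚ.*-identityˡ (seq x n))
                   , (λ x → pointwise λ n → ℚₚ.*-identityʳ (seq x n))
      ; distrib = (λ x y z → pointwise λ n → ℚₚ.*-distribˡ-+ (seq x n) (seq y n) (seq z n))
                , (λ x y z → pointwise λ n → ℚₚ.*-distribʳ-+ (seq x n) (seq y n) (seq z n)) }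
    ; *-comm = *-commʳ }

  ℝ-ring : CommutativeRing 0ℓ 0ℓ
  ℝ-ring = record { isCommutativeRing = ℝ-isCommutativeRing }

  coeff≟ : ∀ p q → Maybe (fromℚ p ≈ʳ fromℚ q)
  coeff≟ p q with p ℚₚ.≟ q
  ... | yes p≡q = just (pointwise λ _ → p≡q)
  ... | no _ = nothing

  fromℚ-morphism : ℚₚ.+-*-rawRing ACR.-Raw-AlmostCommutative⟶ ACR.fromCommutativeRing ℝ-ring
  fromℚ-morphism = record
    { ⟦_⟧ = fromℚ
    ; +-homo = λ _ _ → pointwise λ _ → refl
    ; *-homo = λ _ _ → pointwise λ _ → refl
    ; -‿homo = λ _ → pointwise λ _ → refl
    ; 0-homo = ≈-reflʳ
    ; 1-homo = ≈-reflʳ }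

  module ℝ-Solver = RingSolver ℚₚ.+-*-rawRing (ACR.fromCommutativeRing ℝ-ring) fromℚ-morphism coeff≟

  Apart : ℝ → Set
  Apart x = ∃ λ r → 0ℚ < r × Ev λ n → r ≤ ∣ seq x n ∣

  -- Constructive substitute for deciding whether `x` is zero. One term, accurate to `γ = ε/4`, is
  -- compared with `δ = ε/2`: if it is at most `δ`, the tail stays below `δ + γ < ε`; otherwise the
  -- tail stays above `δ − γ = γ`. The two cases overlap.
  small-or-apart : ∀ x ε → 0ℚ < ε → x ≺ ε ⊎ Apart x
  small-or-apart x ε 0<ε =
    let δ , 0<δ , δ+δ≡ε = half 0<ε
        γ , 0<γ , γ+γ≡δ = half 0<δ
        N , h = cauchy x γ 0<γ
    in decide δ γ N 0<γ δ+δ≡ε γ+γ≡δ h (∣ seq x N ∣ ℚₚ.≤? δ)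
    where
    open +-*-Solver
    identity : ∀ γ a b c → γ + ((b + c - a) + (γ - c) + (a - (γ + γ))) ≡ b
    identity = solve 4 (λ γ a b c →
      γ :+ ((b :+ c :- a) :+ (γ :- c) :+ (a :- (γ :+ γ))) := b) refl
    decide : ∀ δ γ N → 0ℚ < γ → δ + δ ≡ ε → γ + γ ≡ δ →
      (∀ m n → N ℕ.≤ m → N ℕ.≤ n → ∣ seq x m - seq x n ∣ < γ) →
      Dec (∣ seq x N ∣ ≤ δ) → x ≺ ε ⊎ Apart x
    decide δ γ N 0<γ δ+δ≡ε γ+γ≡δ h (yes small) =
      inj₁ (mk≺ (δ + γ) (<-cert 0<γ (trans (ℚₚ.+-assoc δ γ γ) (trans (cong (λ t → δ + t) γ+γ≡δ) δ+δ≡ε)))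
        (N , λ n N≤n → ℚₚ.≤-trans (∣p∣≤∣q∣+∣p-q∣ (seq x n) (seq x N))
          (ℚₚ.+-mono-≤ small (ℚₚ.<⇒≤ (h n N N≤n ℕₚ.≤-refl)))))
    decide δ γ N 0<γ δ+δ≡ε refl h (no large) = inj₂ (γ , 0<γ , N , λ n N≤n →
      ≤-cert (0≤p+q (0≤p+q (p≤q⇒0≤q-p (∣p∣≤∣q∣+∣p-q∣ (seq x N) (seq x n)))
                      (p≤q⇒0≤q-p (ℚₚ.<⇒≤ (h N n ℕₚ.≤-refl N≤n))))
                    (p≤q⇒0≤q-p (ℚₚ.<⇒≤ (ℚₚ.≰⇒> large))))
        (identity γ (∣ seq x N ∣) (∣ seq x n ∣) (∣ seq x N - seq x n ∣)))

  -- Total, with the value 0 at 0: a sequence that is apart from zero may still vanish at early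
  -- indices.
  recip : ℚ → ℚ
  recip p with p ℚₚ.≟ 0ℚ
  ... | yes _ = 0ℚ
  ... | no p≢0 = (1/ p) {{≢-nonZero p≢0}}

  recip-inverse : ∀ {p} → p ≢ 0ℚ → p * recip p ≡ 1ℚ
  recip-inverse {p} p≢0 with p ℚₚ.≟ 0ℚ
  ... | yes p≡0 = ⊥-elim (p≢0 p≡0)
  ... | no p≢0′ = ℚₚ.*-inverseʳ p {{≢-nonZero p≢0′}}

  apart⇒≢0 : ∀ {r p} → 0ℚ < r → r ≤ ∣ p ∣ → p ≢ 0ℚ
  apart⇒≢0 0<r r≤ refl = ℚₚ.<-irrefl refl (ℚₚ.<-≤-trans 0<r r≤)

  ∣recip∣≤ : ∀ {r R p} → 0ℚ < r → 0ℚ < R → r * R ≡ 1ℚ → r ≤ ∣ p ∣ → ∣ recip p ∣ ≤ R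
  ∣recip∣≤ {r} {R} {p} 0<r 0<R rR≡1 r≤p = subst₂ _≤_
    (trans (ℚₚ.*-assoc (∣ recip p ∣) r R) (trans (cong (λ t → ∣ recip p ∣ * t) rR≡1) (ℚₚ.*-identityʳ (∣ recip p ∣))))
    (trans (cong (_* R) eq) (ℚₚ.*-identityˡ R))
    (ℚₚ.*-monoʳ-≤-nonNeg R {{nonNegative (ℚₚ.<⇒≤ 0<R)}} (*-monoˡ-≤′ (ℚₚ.0≤∣p∣ (recip p)) r≤p))
    where
    eq : ∣ recip p ∣ * ∣ p ∣ ≡ 1ℚ
    eq = trans (sym (ℚₚ.∣p*q∣≡∣p∣*∣q∣ (recip p) p))
      (cong ∣_∣ (trans (ℚₚ.*-comm (recip p) p) (recip-inverse (apart⇒≢0 {r} {p} 0<r r≤p))))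

  apart⇒invertible : ∀ x → Apart x → ∃ λ y → x *ʳ y ≈ʳ 1ʳ
  apart⇒invertible x (r , 0<r , N , away) = mkℝ (λ n → recip (seq x n)) isCauchy
    , mk≈ λ ε 0<ε → N , λ n N≤n → subst (_< ε)
        (sym (cong ∣_∣ (trans (cong (_- 1ℚ) (recip-inverse (apart⇒≢0 {r} 0<r (away n N≤n)))) (ℚₚ.+-inverseʳ 1ℚ)))) 0<ε
    where
    open +-*-Solver
    R = proj₁ (inverse>0 0<r)
    0<R = proj₁ (proj₂ (inverse>0 0<r))
    rR≡1 = proj₂ (proj₂ (inverse>0 0<r))
    difference : ∀ a b → a ≢ 0ℚ → b ≢ 0ℚ → recip a - recip b ≡ (b - a) * (recip a * recip b)
    difference a b a≢0 b≢0 = trans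
      (unit (cong₂ (λ u v → recip a * u - recip b * v) (sym (recip-inverse b≢0)) (sym (recip-inverse a≢0))))
      (solve 4 (λ a b u v → u :* (b :* v) :- v :* (a :* u) := (b :- a) :* (u :* v)) refl a b (recip a) (recip b))
      where
      unit : ∀ {u v} → recip a * 1ℚ - recip b * 1ℚ ≡ recip a * u - recip b * v →
        recip a - recip b ≡ recip a * u - recip b * v
      unit = trans (cong₂ _-_ (sym (ℚₚ.*-identityʳ (recip a))) (sym (ℚₚ.*-identityʳ (recip b))))
    isCauchy : IsCauchy (λ n → recip (seq x n))
    isCauchy ε 0<ε =
      -- Both reciprocals are at most `R = 1/r` in modulus and `1/a − 1/b = (b − a)/(ab)`, so
      -- accuracy `ε r²` for `x` yields accuracy `ε` for the reciprocals.
      let M , h = cauchy x (ε * (r * r)) (0<p*q 0<ε (0<p*q 0<r 0<r))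
      in N ℕ.+ M , λ m n N+M≤m N+M≤n →
      let am = away m (ℕₚ.m+n≤o⇒m≤o N N+M≤m)
          an = away n (ℕₚ.m+n≤o⇒m≤o N N+M≤n)
          a = seq x m
          b = seq x n
      in subst₂ _<_
        (trans (sym (ℚₚ.∣p*q∣≡∣p∣*∣q∣ (b - a) (recip a * recip b)))
          (sym (cong ∣_∣ (difference a b (apart⇒≢0 {r} 0<r am) (apart⇒≢0 {r} 0<r an)))))
        (trans (solve 3 (λ e r R → e :* (r :* r) :* (R :* R) := e :* ((r :* R) :* (r :* R))) refl ε r R)
          (trans (cong (λ t → ε * (t * t)) rR≡1) (ℚₚ.*-identityʳ ε)))
        (ℚₚ.≤-<-trans
          (*-monoˡ-≤′ (ℚₚ.0≤∣p∣ (b - a))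
            (subst (_≤ R * R) (sym (ℚₚ.∣p*q∣≡∣p∣*∣q∣ (recip a) (recip b)))
              (*-mono-≤ (ℚₚ.<⇒≤ 0<R) (ℚₚ.0≤∣p∣ (recip b)) (∣recip∣≤ {p = a} 0<r 0<R rR≡1 am) (∣recip∣≤ {p = b} 0<r 0<R rR≡1 an))))
          (ℚₚ.*-monoˡ-<-pos (R * R) {{positive (0<p*q 0<R 0<R)}}
            (h n m (ℕₚ.m+n≤o⇒n≤o N N+M≤n) (ℕₚ.m+n≤o⇒n≤o N N+M≤m))))

  ≈0⇒≺ : ∀ {x} → x ≈ʳ 0ʳ → ∀ ε → 0ℚ < ε → x ≺ ε
  ≈0⇒≺ {x} x≈0 ε 0<ε = ≺-pointwise {x -ʳ 0ʳ} (λ n → ℚₚ.+-identityʳ (seq x n)) (≈⇒≺ x≈0 ε 0<ε)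

  ≺⇒≈0 : ∀ {x} → (∀ ε → 0ℚ < ε → x ≺ ε) → x ≈ʳ 0ʳ
  ≺⇒≈0 {x} h = ≺⇒≈ λ ε 0<ε → ≺-pointwise {x} (λ n → sym (ℚₚ.+-identityʳ (seq x n))) (h ε 0<ε)

  -- No Markov principle enters: for each `ε` separately, `small-or-apart` gives either the wanted
  -- bound or an inverse, which is excluded.
  noninvertible⇒≈0 : ∀ {x} → ¬ (∃ λ y → x *ʳ y ≈ʳ 1ʳ) → x ≈ʳ 0ʳ
  noninvertible⇒≈0 {x} h = ≺⇒≈0 λ ε 0<ε → helper ε (small-or-apart x ε 0<ε)
    where
    helper : ∀ ε → x ≺ ε ⊎ Apart x → x ≺ ε
    helper ε (inj₁ small) = small
    helper ε (inj₂ apart) = ⊥-elim (h (apart⇒invertible x apart))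

  ≈0-apart : ∀ {x} → x ≈ʳ 0ʳ → ¬ Apart x
  ≈0-apart {x} x≈0 (r , 0<r , away) =
    let mk≺ b b<r h = ≈0⇒≺ x≈0 r 0<r
        _ , r≤b = ev-witness (ev-zip (λ n p q → ℚₚ.≤-trans p q) away h)
    in ℚₚ.<-irrefl refl (ℚₚ.<-≤-trans b<r r≤b)

  stable0 : ∀ {x} → ¬ ¬ (x ≈ʳ 0ʳ) → x ≈ʳ 0ʳ
  stable0 {x} h = ≺⇒≈0 λ ε 0<ε → helper ε (small-or-apart x ε 0<ε)
    where
    helper : ∀ ε → x ≺ ε ⊎ Apart x → x ≺ ε
    helper ε (inj₁ small) = small
    helper ε (inj₂ apart) = ⊥-elim (h λ x≈0 → ≈0-apart x≈0 apart)

  -- The distance between the stored `bound` and `r` absorbs the difference of `x` and `y`; this is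
  -- why `_≺_` records a bound strictly below `r`.
  ≺-resp : ∀ {x y r} → x ≈ʳ y → x ≺ r → y ≺ r
  ≺-resp {x} {y} {r} x≈y (mk≺ b b<r h) =
    let δ , 0<δ , eq = half (p<q⇒0<q-p b<r)
        mk≺ c c<δ k = ≈⇒≺ (≈-symʳ x≈y) δ 0<δ
    in mk≺ (b + δ) (<-cert 0<δ (trans (ℚₚ.+-assoc b δ δ) (trans (cong (λ t → b + t) eq) (p+[q-p]≡q b r))))
    (ev-zip (λ n p q → ℚₚ.≤-trans (∣p∣≤∣q∣+∣p-q∣ (seq y n) (seq x n)) (ℚₚ.+-mono-≤ p (ℚₚ.≤-trans q (ℚₚ.<⇒≤ c<δ)))) h k)

  approximate : ∀ x ε → 0ℚ < ε → ∃ λ q → x -ʳ fromℚ q ≺ ε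
  approximate x ε 0<ε =
    let δ , 0<δ , eq = half 0<ε
        N , h = cauchy x δ 0<δ
    in seq x N , mk≺ δ (<-cert 0<δ eq) (N , λ n N≤n → ℚₚ.<⇒≤ (h n N N≤n ℕₚ.≤-refl))

  fromℚ-injective : ∀ {p q} → fromℚ p ≈ʳ fromℚ q → p ≡ q
  fromℚ-injective {p} {q} eq = decide (p ℚₚ.≟ q)
    where
    p-q≡0⇒p≡q : p - q ≡ 0ℚ → p ≡ q
    p-q≡0⇒p≡q e = trans (sym (p+[q-p]≡q q p)) (trans (cong (λ t → q + t) e) (ℚₚ.+-identityʳ q))
    decide : Dec (p ≡ q) → p ≡ q
    decide (yes p≡q) = p≡q
    decide (no p≢q) = ⊥-elim (≈0-apart {fromℚ p -ʳ fromℚ q} (≺⇒≈0 (≈⇒≺ eq))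
      (∣ p - q ∣ , ℚₚ.≰⇒> (λ ≤0 → p≢q (p-q≡0⇒p≡q (ℚₚ.∣p∣≡0⇒p≡0 (p - q)
        (ℚₚ.≤-antisym ≤0 (ℚₚ.0≤∣p∣ (p - q)))))) , 0 , λ _ _ → ℚₚ.≤-refl))

-- Gaussian elimination over fields that are discrete up to a monad

module LinearSystems where

  open ≡ using (_≡_)

  module LinearAlgebra (R : CommutativeRing 0ℓ 0ℓ) where

    open CommutativeRing R hiding (zero)
    open import Algebra.Properties.Semiring.Sum semiring
    open import Algebra.Solver.Ring.NaturalCoefficients.Default commutativeSemiring using (solve; _:+_; _:*_; _:=_; con)
    open import Relation.Binary.Reasoning.Setoid setoid

    Invertible : Carrier → Set
    Invertible x = ∃ λ y → x * y ≈ 1#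

    -- A field that is discrete up to the monad M, which will be the identity for ℚ
    -- and double negation for ℂ.
    module DiscreteUpTo
      (M : Set → Set)
      (pure : ∀ {A} → A → M A)
      (_>>=_ : ∀ {A B} → M A → (A → M B) → M B)
      (zero-or-invertible : ∀ x → M (x ≈ 0# ⊎ Invertible x))
      (1≉0 : ¬ (1# ≈ 0#)) where

      sequence : ∀ n {P : Fin n → Set} → (∀ i → M (P i)) → M (∀ i → P i)
      sequence zero h = pure λ ()
      sequence (suc n) h = h zero >>= λ p → sequence n (h ∘ suc) >>= λ ps →
        pure λ { zero → p ; (suc i) → ps i }

      all-zero-or-pivot : ∀ n (r : Vector Carrier n) → M ((∀ k → r k ≈ 0#) ⊎ ∃ λ k → Invertible (r k))
      all-zero-or-pivot zero r = pure (inj₁ λ ())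
      all-zero-or-pivot (suc n) r = zero-or-invertible (r zero) >>= λ
        { (inj₂ inv) → pure (inj₂ (zero , inv))
        ; (inj₁ r₀≈0) → all-zero-or-pivot n (r ∘ suc) >>= λ
            { (inj₁ r≈0) → pure (inj₁ λ { zero → r₀≈0 ; (suc k) → r≈0 k })
            ; (inj₂ (k , inv)) → pure (inj₂ (suc k , inv)) } }

      ∑-zero : ∀ {n} (f : Vector Carrier n) → (∀ i → f i ≈ 0#) → sum f ≈ 0#
      ∑-zero {n} f f≈0 = trans (sum-cong-≋ f≈0) (sum-replicate-zero n)

      private
        x+m≈0 : ∀ {x y} → x * y ≈ 1# → x * (- y) + 1# ≈ 0#
        x+m≈0 {x} {y} xy≈1 = begin
          x * (- y) + 1#     ≈⟨ +-congˡ xy≈1 ⟨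
          x * (- y) + x * y  ≈⟨ distribˡ x (- y) y ⟨
          x * (- y + y)      ≈⟨ *-congˡ (-‿inverseˡ y) ⟩
          x * 0#             ≈⟨ zeroʳ x ⟩
          0#                 ∎

        ∑-insert : ∀ {n} (B : Vector Carrier (suc n)) k c v →
          sum (λ j → B j * insertAt c k v j) ≈ B k * v + sum (λ l → B (punchIn k l) * c l)
        ∑-insert B k c v = trans (sum-remove {i = k} (λ j → B j * insertAt c k v j))
          (+-cong (*-congˡ (reflexive (Vecₚ.insertAt-lookup c k v)))
            (sum-cong-≋ λ l → *-congˡ (reflexive (Vecₚ.insertAt-punchIn c k v l))))

        ∑-eliminate : ∀ {n} (p r c : Vector Carrier n) q m →
          sum (λ l → (p l + q * (m * r l)) * c l) ≈ q * (m * sum (λ l → r l * c l)) + sum (λ l → p l * c l)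
        ∑-eliminate p r c q m = begin
          sum (λ l → (p l + q * (m * r l)) * c l)
            ≈⟨ sum-cong-≋ (λ l → solve 5 (λ p q m r c → (p :+ q :* (m :* r)) :* c := (q :* m) :* (r :* c) :+ p :* c)
                 refl (p l) q m (r l) (c l)) ⟩
          sum (λ l → (q * m) * (r l * c l) + p l * c l)
            ≈⟨ ∑-distrib-+ (λ l → (q * m) * (r l * c l)) (λ l → p l * c l) ⟩
          sum (λ l → (q * m) * (r l * c l)) + sum (λ l → p l * c l)
            ≈⟨ +-congʳ (*-distribˡ-sum (q * m) (λ l → r l * c l)) ⟨
          (q * m) * sum (λ l → r l * c l) + sum (λ l → p l * c l)
            ≈⟨ +-congʳ (*-assoc q m _) ⟩
          q * (m * sum (λ l → r l * c l)) + sum (λ l → p l * c l) ∎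

      NontrivialKernel : ∀ {m n} → (Fin m → Fin n → Carrier) → Set
      NontrivialKernel {m} {n} A = ∃ λ (c : Vector Carrier n) →
        (∀ i → sum (λ k → A i k * c k) ≈ 0#) × ∃ λ k → Invertible (c k)

      -- Induction on the number of equations. If the top row vanishes, it is dropped and the first
      -- unknown is set to zero. Otherwise a pivot with inverse `y` clears its column from the other
      -- rows, and the pivot unknown is recovered from the top row by back substitution.
      -- Nontriviality is carried as an invertible entry, which survives both cases.
      underdetermined : ∀ n (A : Fin n → Fin (suc n) → Carrier) → M (NontrivialKernel A)
      underdetermined zero A = pure ((λ _ → 1#) , (λ ()) , zero , 1# , *-identityˡ 1#)
      underdetermined (suc n) A = all-zero-or-pivot _ (A zero) >>= λ
        { (inj₁ r≈0) → underdetermined n (λ i k → A (suc i) (suc k)) >>= λ (c , eqs , k , inv) →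
            pure ((0# ∷ c)
              , (λ { zero → ∑-zero (λ k → A zero k * (0# ∷ c) k) (λ k → trans (*-congʳ (r≈0 k)) (zeroˡ _))
                   ; (suc i) → trans (+-cong (zeroʳ (A (suc i) zero)) (eqs i)) (+-identityʳ 0#) })
              , suc k , inv)
        ; (inj₂ (k , y , rk*y≈1)) →
            underdetermined n (λ i l → A (suc i) (punchIn k l) + A (suc i) k * ((- y) * A zero (punchIn k l)))
              >>= λ (c , eqs , l , z , cl*z≈1) →
            let s = sum (λ l → A zero (punchIn k l) * c l) in
            pure (insertAt c k ((- y) * s)
              , (λ { zero → trans (∑-insert (A zero) k c ((- y) * s)) (begin
                       A zero k * ((- y) * s) + s
                         ≈⟨ solve 3 (λ r m s → r :* (m :* s) :+ s := (r :* m :+ con 1) :* s) refl (A zero k) (- y) s ⟩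
                       (A zero k * (- y) + 1#) * s
                         ≈⟨ *-congʳ (x+m≈0 rk*y≈1) ⟩
                       0# * s ≈⟨ zeroˡ s ⟩
                       0# ∎)
                   ; (suc i) → trans (∑-insert (A (suc i)) k c ((- y) * s))
                       (trans (sym (∑-eliminate (λ l → A (suc i) (punchIn k l)) (λ l → A zero (punchIn k l)) c (A (suc i) k) (- y)))
                         (eqs i)) })
              , punchIn k l , z , trans (*-congʳ (reflexive (Vecₚ.insertAt-punchIn c k _ l))) cl*z≈1) }

      -- Zero rows pad the system until exactly one equation is missing.
      underdetermined-< : ∀ {m n} → m ℕ.< n → (A : Fin m → Fin n → Carrier) → M (NontrivialKernel A)
      underdetermined-< {m} (ℕ.s≤s m≤n) A with ℕₚ.m≤n⇒∃[o]m+o≡n m≤n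
      ... | o , ≡.refl = underdetermined (m ℕ.+ o) (A ++ λ (_ : Fin o) _ → 0#) >>= λ (c , eqs , inv) →
        pure (c , (λ i → trans (sum-cong-≋ λ k → *-congʳ {c k} (reflexive (≡.cong (λ row → row k)
          (≡.sym (Vecₚ.lookup-++ˡ A (λ (_ : Fin o) _ → 0#) i))))) (eqs (i ↑ˡ o))) , inv)

      Independent : ∀ {m n} → (Fin m → Fin n → Carrier) → Set
      Independent {m} {n} A = ∀ (c : Vector Carrier n) →
        (∀ i → sum (λ k → A i k * c k) ≈ 0#) → ∀ k → c k ≈ 0#

      -- A kernel vector of the augmented matrix `w ∷ A` has a nonzero entry at `w`, since otherwise
      -- the rest would be a nontrivial relation between the columns of `A`; dividing by minus that
      -- entry solves the system. No determinant is involved.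
      independent⇒solvable : ∀ n (A : Fin n → Fin n → Carrier) → Independent A →
        ∀ (w : Vector Carrier n) → M (∃ λ (x : Vector Carrier n) → ∀ i → sum (λ k → A i k * x k) ≈ w i)
      independent⇒solvable n A indep w =
        underdetermined n (λ i → w i ∷ A i) >>= λ (c , eqs , k , inv) →
        zero-or-invertible (c zero) >>= λ
        { (inj₁ c₀≈0) → ⊥-elim (1≉0 (trans (sym (proj₂ inv)) (trans (*-congʳ (all-zero c eqs c₀≈0 k)) (zeroˡ _))))
        ; (inj₂ (y , c₀y≈1)) → pure ((λ k → (- y) * c (suc k)) , λ i →
            let S = sum (λ k → A i k * c (suc k)) in begin
            sum (λ k → A i k * ((- y) * c (suc k)))
              ≈⟨ sum-cong-≋ (λ k → solve 3 (λ a m c → a :* (m :* c) := m :* (a :* c)) refl (A i k) (- y) (c (suc k))) ⟩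
            sum (λ k → (- y) * (A i k * c (suc k)))
              ≈⟨ *-distribˡ-sum (- y) (λ k → A i k * c (suc k)) ⟨
            (- y) * S
              ≈⟨ +-identityˡ _ ⟨
            0# + (- y) * S
              ≈⟨ +-congʳ (trans (*-congʳ (x+m≈0 c₀y≈1)) (zeroˡ (w i))) ⟨
            (c zero * (- y) + 1#) * w i + (- y) * S
              ≈⟨ solve 4 (λ c m w S → (c :* m :+ con 1) :* w :+ m :* S := w :+ m :* (w :* c :+ S))
                   refl (c zero) (- y) (w i) S ⟩
            w i + (- y) * (w i * c zero + S)
              ≈⟨ +-congˡ (trans (*-congˡ (eqs i)) (zeroʳ (- y))) ⟩
            w i + 0#
              ≈⟨ +-identityʳ (w i) ⟩
            w i ∎) }
        where
        all-zero : ∀ c → (∀ i → sum (λ k → (w i ∷ A i) k * c k) ≈ 0#) → c zero ≈ 0# → ∀ k → c k ≈ 0#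
        all-zero c eqs c₀≈0 zero = c₀≈0
        all-zero c eqs c₀≈0 (suc k) = indep (c ∘ suc) (λ i → begin
          sum (λ k → A i k * c (suc k))                   ≈⟨ +-identityˡ _ ⟨
          0# + sum (λ k → A i k * c (suc k))              ≈⟨ +-congʳ (trans (*-congˡ c₀≈0) (zeroʳ (w i))) ⟨
          w i * c zero + sum (λ k → A i k * c (suc k))    ≈⟨ eqs i ⟩
          0#                                              ∎) k

-- Fields of characteristic zero with stable equality: characters and polynomial roots

module Fields where

  import Algebra.Solver.Ring as RingSolver
  import Algebra.Solver.Ring.AlmostCommutativeRing as ACR
  import Algebra.Properties.Semiring.Sum as SemiringSum
  open LinearSystems
  open Reals using (recip; recip-inverse)

  -- ℂ enters the algebra only through these properties, so that its arithmetic is never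
  -- unfolded into Cauchy sequences.
  record ClassicalField : Set₁ where
    field
      ring : CommutativeRing 0ℓ 0ℓ
    open CommutativeRing ring public hiding (zero; ring)
    field
      ι : ℚ → Carrier
      ι-+ : ∀ p q → ι (p ℚ.+ q) ≈ ι p + ι q
      ι-* : ∀ p q → ι (p ℚ.* q) ≈ ι p * ι q
      ι-neg : ∀ p → ι (ℚ.- p) ≈ - ι p
      ι-0 : ι 0ℚ ≈ 0#
      ι-1 : ι 1ℚ ≈ 1#
      ι-injective : ∀ {p q} → ι p ≈ ι q → p ≡ q
      noninvertible⇒≈0 : ∀ {x} → ¬ (∃ λ y → x * y ≈ 1#) → x ≈ 0#
      stable₀ : ∀ {x} → ¬ ¬ (x ≈ 0#) → x ≈ 0#

  ℚ-zero-or-invertible : ∀ x → x ≡ 0ℚ ⊎ ∃ λ y → x ℚ.* y ≡ 1ℚ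
  ℚ-zero-or-invertible x with x ℚₚ.≟ 0ℚ
  ... | yes x≡0 = inj₁ x≡0
  ... | no x≢0 = inj₂ (recip x , recip-inverse x≢0)

  module ℚ-LA = LinearAlgebra.DiscreteUpTo ℚₚ.+-*-commutativeRing id id (λ x f → f x)
    ℚ-zero-or-invertible ℚₚ.1≢0

  module ∑ℚ = SemiringSum (CommutativeRing.semiring ℚₚ.+-*-commutativeRing)

  δ : ∀ {n} → Fin n → Fin n → ℚ
  δ zero zero = 1ℚ
  δ zero (suc j) = 0ℚ
  δ (suc i) zero = 0ℚ
  δ (suc i) (suc j) = δ i j

  δ-sym : ∀ {n} (i j : Fin n) → δ i j ≡ δ j i
  δ-sym zero zero = ≡.refl
  δ-sym zero (suc j) = ≡.refl
  δ-sym (suc i) zero = ≡.refl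
  δ-sym (suc i) (suc j) = δ-sym i j

  δ-refl : ∀ {n} (i : Fin n) → δ i i ≡ 1ℚ
  δ-refl zero = ≡.refl
  δ-refl (suc i) = δ-refl i

  module FieldProperties (C : ClassicalField) where
    open ClassicalField C public
    open SemiringSum semiring public
    open import Algebra.Properties.Semiring.Exp semiring public using (_^_; ^-homo-*; ^-congˡ)
    open import Relation.Binary.Reasoning.Setoid setoid

    ι-cong : ∀ {p q} → p ≡ q → ι p ≈ ι q
    ι-cong ≡.refl = refl

    ι-coeff≟ : ∀ p q → Maybe (ι p ≈ ι q)
    ι-coeff≟ p q with p ℚₚ.≟ q
    ... | yes p≡q = just (ι-cong p≡q)
    ... | no _ = nothing

    ι-morphism : ℚₚ.+-*-rawRing ACR.-Raw-AlmostCommutative⟶ ACR.fromCommutativeRing ring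
    ι-morphism = record
      { ⟦_⟧ = ι ; +-homo = ι-+ ; *-homo = ι-* ; -‿homo = ι-neg ; 0-homo = ι-0 ; 1-homo = ι-1 }

    module Solver = RingSolver ℚₚ.+-*-rawRing (ACR.fromCommutativeRing ring) ι-morphism ι-coeff≟
    open Solver using (solve; _:+_; _:*_; _:-_; :-_; _:=_)

    zero-or-invertible : ∀ z → ¬ ¬ (z ≈ 0# ⊎ ∃ λ w → z * w ≈ 1#)
    zero-or-invertible z k = k (inj₁ (noninvertible⇒≈0 λ inv → k (inj₂ inv)))

    1≉0 : ¬ (1# ≈ 0#)
    1≉0 e = ℚₚ.1≢0 (ι-injective (trans ι-1 (trans e (sym ι-0))))

    domain : ∀ {z w} → ¬ (z ≈ 0#) → z * w ≈ 0# → w ≈ 0#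
    domain {z} {w} z≉0 zw≈0 = stable₀ λ w≉0 → zero-or-invertible z λ
      { (inj₁ z≈0) → z≉0 z≈0
      ; (inj₂ (u , zu≈1)) → w≉0 (begin
          w             ≈⟨ *-identityˡ w ⟨
          1# * w        ≈⟨ *-congʳ zu≈1 ⟨
          z * u * w     ≈⟨ solve 3 (λ z u w → z :* u :* w := u :* (z :* w)) refl z u w ⟩
          u * (z * w)   ≈⟨ *-congˡ zw≈0 ⟩
          u * 0#        ≈⟨ zeroʳ u ⟩
          0#            ∎) }

    x-y≈0⇒x≈y : ∀ {x y} → x - y ≈ 0# → x ≈ y
    x-y≈0⇒x≈y {x} {y} e = trans (solve 2 (λ x y → x := y :+ (x :- y)) refl x y)
      (trans (+-congˡ e) (+-identityʳ y))

    x≈y⇒x-y≈0 : ∀ {x y} → x ≈ y → x - y ≈ 0#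
    x≈y⇒x-y≈0 {x} {y} e = trans (+-congʳ e) (-‿inverseʳ y)

    stable≈ : ∀ {x y} → ¬ ¬ (x ≈ y) → x ≈ y
    stable≈ h = x-y≈0⇒x≈y (stable₀ λ k → h λ e → k (x≈y⇒x-y≈0 e))

    ι-sum : ∀ {n} (f : Vector ℚ n) → ι (∑ℚ.sum f) ≈ sum (ι ∘ f)
    ι-sum {zero} f = ι-0
    ι-sum {suc n} f = trans (ι-+ (f zero) _) (+-congˡ (ι-sum (f ∘ suc)))

    sum-0 : ∀ {n} (f : Vector Carrier n) → (∀ i → f i ≈ 0#) → sum f ≈ 0#
    sum-0 {n} f f≈0 = trans (sum-cong-≋ f≈0) (sum-replicate-zero n)

    sum-* : ∀ {m n} (u : Vector Carrier m) (A : Fin m → Fin n → Carrier) (w : Vector Carrier n) →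
      sum (λ i → u i * sum (λ j → A i j * w j)) ≈ sum (λ j → sum (λ i → u i * A i j) * w j)
    sum-* u A w = begin
      sum (λ i → u i * sum (λ j → A i j * w j))
        ≈⟨ sum-cong-≋ (λ i → *-distribˡ-sum (u i) (λ j → A i j * w j)) ⟩
      sum (λ i → sum (λ j → u i * (A i j * w j)))
        ≈⟨ ∑-comm (λ i j → u i * (A i j * w j)) ⟩
      sum (λ j → sum (λ i → u i * (A i j * w j)))
        ≈⟨ sum-cong-≋ (λ j → trans (sum-cong-≋ (λ i → sym (*-assoc (u i) (A i j) (w j))))
             (sym (*-distribʳ-sum (w j) (λ i → u i * A i j)))) ⟩
      sum (λ j → sum (λ i → u i * A i j) * w j) ∎

    sum-δʳ : ∀ {n} (f : Vector Carrier n) i → sum (λ k → f k * ι (δ k i)) ≈ f i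
    sum-δʳ {suc n} f zero = trans (+-cong (trans (*-congˡ ι-1) (*-identityʳ (f zero)))
      (sum-0 _ (λ k → trans (*-congˡ ι-0) (zeroʳ (f (suc k)))))) (+-identityʳ (f zero))
    sum-δʳ {suc n} f (suc i) = trans (+-cong (trans (*-congˡ ι-0) (zeroʳ (f zero))) (sum-δʳ (f ∘ suc) i))
      (+-identityˡ (f (suc i)))

    sum-δˡ : ∀ {n} (f : Vector Carrier n) i → sum (λ k → ι (δ i k) * f k) ≈ f i
    sum-δˡ f i = trans (sum-cong-≋ (λ k → trans (*-comm (ι (δ i k)) (f k))
      (*-congˡ (ι-cong (δ-sym i k))))) (sum-δʳ f i)

    -- Dedekind's independence of characters.  Only χ₀ has to differ from the others, which
    -- may coincide among themselves; this matters for the characters n ↦ σ_j(θ)ⁿ.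
    module Characters {a} {X : Set a} (_∙_ : X → X → X) where

      Multiplicative : (X → Carrier) → Set a
      Multiplicative χ = ∀ x y → χ (x ∙ y) ≈ χ x * χ y

      characters-independent : ∀ n (c₀ : Carrier) (χ₀ : X → Carrier) (c : Vector Carrier n) (χ : Fin n → X → Carrier) →
        Multiplicative χ₀ → (∀ j → Multiplicative (χ j)) →
        (∀ j → ¬ (∀ x → χ j x ≈ χ₀ x)) →
        (∀ x → c₀ * χ₀ x + sum (λ j → c j * χ j x) ≈ 0#) →
        ∀ x → c₀ * χ₀ x ≈ 0#
      characters-independent zero c₀ χ₀ c χ _ _ _ relation x =
        trans (sym (+-identityʳ _)) (relation x)
      characters-independent (suc n) c₀ χ₀ c χ mult₀ mult distinct relation x =
        -- Subtracting `χ zero y` times the relation at `x` from the relation at `y ∙ x` removes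
        -- `χ zero` and multiplies `c₀` by `χ₀ y − χ zero y`. By induction this product kills
        -- `χ₀ x`, so a nonzero `c₀ * χ₀ x` would make `χ zero` and `χ₀` agree at every `y`.
        stable₀ λ c₀χ₀x≉0 → distinct zero λ y → sym (x-y≈0⇒x≈y (domain c₀χ₀x≉0 (begin
          (c₀ * χ₀ x) * (χ₀ y - χ zero y)
            ≈⟨ solve 3 (λ c u v → (c :* u) :* v := (c :* v) :* u) refl c₀ (χ₀ x) (χ₀ y - χ zero y) ⟩
          (c₀ * (χ₀ y - χ zero y)) * χ₀ x
            ≈⟨ characters-independent n (c₀ * (χ₀ y - χ zero y)) χ₀
                 (λ j → c (suc j) * (χ (suc j) y - χ zero y)) (χ ∘ suc)
                 mult₀ (mult ∘ suc) (distinct ∘ suc) (eliminated y) x ⟩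
          0# ∎)))
        where
        eliminated : ∀ y x → (c₀ * (χ₀ y - χ zero y)) * χ₀ x
          + sum (λ j → (c (suc j) * (χ (suc j) y - χ zero y)) * χ (suc j) x) ≈ 0#
        eliminated y x = begin
          (c₀ * (χ₀ y - z)) * χ₀ x + sum (λ j → (c (suc j) * (χ (suc j) y - z)) * χ (suc j) x)
            ≈⟨ +-congˡ (trans (sum-cong-≋ (λ j → solve 4
                 (λ c u z v → (c :* (u :- z)) :* v := c :* (u :* v) :+ (:- z) :* (c :* v)) refl
                 (c (suc j)) (χ (suc j) y) z (χ (suc j) x)))
                 (trans (∑-distrib-+ (λ j → c (suc j) * (χ (suc j) y * χ (suc j) x)) _)
                   (+-cong (sum-cong-≋ (λ j → *-congˡ (sym (mult (suc j) y x))))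
                     (sym (*-distribˡ-sum (- z) (λ j → c (suc j) * χ (suc j) x)))))) ⟩
          (c₀ * (χ₀ y - z)) * χ₀ x + (S₂ + (- z) * S₁)
            ≈⟨ solve 8 (λ c₀ u z v S₂ S₁ c w → (c₀ :* (u :- z)) :* v :+ (S₂ :+ (:- z) :* S₁)
                 := (c₀ :* (u :* v) :+ (c :* (z :* w) :+ S₂)) :+ (:- z) :* (c₀ :* v :+ (c :* w :+ S₁)))
                 refl c₀ (χ₀ y) z (χ₀ x) S₂ S₁ (c zero) (χ zero x) ⟩
          (c₀ * (χ₀ y * χ₀ x) + (c zero * (z * χ zero x) + S₂))
            + (- z) * (c₀ * χ₀ x + (c zero * χ zero x + S₁))
            ≈⟨ +-cong (+-cong (*-congˡ (sym (mult₀ y x)))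
                 (+-congʳ (*-congˡ (sym (mult zero y x))))) (*-congˡ (relation x)) ⟩
          (c₀ * χ₀ (y ∙ x) + (c zero * χ zero (y ∙ x) + S₂)) + (- z) * 0#
            ≈⟨ +-cong (relation (y ∙ x)) (zeroʳ (- z)) ⟩
          0# + 0# ≈⟨ +-identityʳ 0# ⟩
          0# ∎
          where
          z = χ zero y
          S₁ = sum (λ j → c (suc j) * χ (suc j) x)
          S₂ = sum (λ j → c (suc j) * χ (suc j) (y ∙ x))

      coefficient≈0 : ∀ {n} (c : Vector Carrier n) (χ : Fin n → X → Carrier) → (∀ j → Multiplicative (χ j)) →
        ∀ i → (∀ j → j ≢ i → ¬ (∀ x → χ j x ≈ χ i x)) →
        (∀ x → sum (λ j → c j * χ j x) ≈ 0#) →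
        ∀ x → c i * χ i x ≈ 0#
      coefficient≈0 {suc n} c χ mult i distinct relation =
        characters-independent n (c i) (χ i) (c ∘ punchIn i) (λ j → χ (punchIn i j)) (mult i) (λ j → mult (punchIn i j))
          (λ j → distinct (punchIn i j) (Finₚ.punchInᵢ≢i i j))
          (λ x → trans (sym (sum-remove {i = i} (λ j → c j * χ j x))) (relation x))

    evalMonic : ∀ {k} → Vector ℚ k → Carrier → Carrier
    evalMonic {k} a z = z ^ k + sum (λ i → ι (a i) * z ^ toℕ i)

    evalMonic-cong : ∀ {k} (a : Vector ℚ k) {z w} → z ≈ w → evalMonic a z ≈ evalMonic a w
    evalMonic-cong {k} a z≈w = +-cong (^-congˡ k z≈w) (sum-cong-≋ λ i → *-congˡ {ι (a i)} (^-congˡ (toℕ i) z≈w))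

    sum-split : ∀ m {n} (f : Vector Carrier (m ℕ.+ n)) →
      sum f ≈ sum (λ i → f (i ↑ˡ n)) + sum (λ j → f (m ↑ʳ j))
    sum-split zero f = sym (+-identityˡ _)
    sum-split (suc m) f = trans (+-congˡ (sum-split m (f ∘ suc))) (sym (+-assoc _ _ _))

    -- Nested form of a monic polynomial: `a` lists the lower coefficients, and the base case `1#`
    -- is the leading one. Synthetic division is structural recursion in this form.
    horner : ∀ {n} → Vector Carrier n → Carrier → Carrier
    horner {zero} a z = 1#
    horner {suc n} a z = a zero + z * horner (a ∘ suc) z

    evalMonic≈horner : ∀ {n} (a : Vector ℚ n) z → evalMonic a z ≈ horner (ι ∘ a) z
    evalMonic≈horner {zero} a z = +-identityʳ 1#
    evalMonic≈horner {suc n} a z = begin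
      z * (z ^ n) + (ι (a zero) * 1# + sum (λ i → ι (a (suc i)) * (z * (z ^ toℕ i))))
        ≈⟨ +-congˡ (+-congˡ (trans (sum-cong-≋ (λ i → solve 3 (λ a z w → a :* (z :* w) := z :* (a :* w))
             refl (ι (a (suc i))) z (z ^ toℕ i))) (sym (*-distribˡ-sum z (λ i → ι (a (suc i)) * (z ^ toℕ i)))))) ⟩
      z * (z ^ n) + (ι (a zero) * 1# + z * sum (λ i → ι (a (suc i)) * (z ^ toℕ i)))
        ≈⟨ +-congˡ (+-congʳ (*-identityʳ (ι (a zero)))) ⟩
      z * (z ^ n) + (ι (a zero) + z * sum (λ i → ι (a (suc i)) * (z ^ toℕ i)))
        ≈⟨ solve 4 (λ z p a s → z :* p :+ (a :+ z :* s) := a :+ z :* (p :+ s)) refl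
             z (z ^ n) (ι (a zero)) (sum (λ i → ι (a (suc i)) * (z ^ toℕ i))) ⟩
      ι (a zero) + z * (z ^ n + sum (λ i → ι (a (suc i)) * z ^ toℕ i))
        ≈⟨ +-congˡ (*-congˡ (evalMonic≈horner (a ∘ suc) z)) ⟩
      ι (a zero) + z * horner (ι ∘ a ∘ suc) z ∎

    -- Synthetic division by X − w.
    quotient : ∀ {n} → Vector Carrier (suc n) → Carrier → Vector Carrier n
    quotient {zero} a w ()
    quotient {suc n} a w zero = horner (a ∘ suc) w
    quotient {suc n} a w (suc i) = quotient (a ∘ suc) w i

    factor : ∀ {n} (a : Vector Carrier (suc n)) w z →
      horner a z - horner a w ≈ (z - w) * horner (quotient a w) z
    factor {zero} a w z = solve 4 (λ a z w o → (a :+ z :* o) :- (a :+ w :* o) := (z :- w) :* o)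
      refl (a zero) z w 1#
    factor {suc n} a w z = begin
      (a zero + z * g z) - (a zero + w * g w)
        ≈⟨ solve 5 (λ a z w u v → (a :+ z :* u) :- (a :+ w :* v) := z :* (u :- v) :+ (z :- w) :* v) refl
             (a zero) z w (g z) (g w) ⟩
      z * (g z - g w) + (z - w) * g w
        ≈⟨ +-congʳ (*-congˡ (factor (a ∘ suc) w z)) ⟩
      z * ((z - w) * q) + (z - w) * g w
        ≈⟨ solve 4 (λ z w q v → z :* ((z :- w) :* q) :+ (z :- w) :* v := (z :- w) :* (v :+ z :* q)) refl
             z w q (g w) ⟩
      (z - w) * (g w + z * q) ∎
      where
      g = horner (a ∘ suc)
      q = horner (quotient (a ∘ suc) w) z

    -- Dividing out the first point leaves a monic quotient of lower degree, which still vanishes at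
    -- the other points because their differences from the first can be cancelled. In degree zero
    -- the polynomial is 1.
    monic-roots : ∀ n (a : Vector Carrier n) (r : Vector Carrier (suc n)) →
      (∀ i j → i ≢ j → ¬ (r i ≈ r j)) → ¬ (∀ i → horner a (r i) ≈ 0#)
    monic-roots zero a r distinct roots = 1≉0 (roots zero)
    monic-roots (suc n) a r distinct roots = monic-roots n (quotient a (r zero)) (r ∘ suc)
      (λ i j i≢j → distinct (suc i) (suc j) (i≢j ∘ Finₚ.suc-injective))
      (λ i → domain (λ e → distinct (suc i) zero (λ ()) (x-y≈0⇒x≈y e))
        (trans (sym (factor a (r zero) (r (suc i)))) (x≈y⇒x-y≈0 (trans (roots (suc i)) (sym (roots zero))))))

-- Common denominators, integer spans, integrality by pigeonhole

module IntegerSpans where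

  open import Defs using (fromℤ)
  open Rationals
  open LinearSystems
  open Fields
  open import Data.Integer.DivMod using (_%ℕ_; _/ℕ_; n%ℕd<d; a≡a%ℕn+[a/ℕn]*n)

  -- Stated for any property stable under multiples, so that it can be iterated over matrices and
  -- over the three-index family of structure constants.
  common-multiple : ∀ n (P : Fin n → ℕ → Set) → (∀ i D E → P i D → P i (D ℕ.* E)) →
    (∀ i → ∃ λ D → ℕ.NonZero D × P i D) → ∃ λ D → ℕ.NonZero D × ∀ i → P i D
  common-multiple zero P scale exists = 1 , _ , λ ()
  common-multiple (suc n) P scale exists =
    let D , D≢0 , p = exists zero
        E , E≢0 , ps = common-multiple n (P ∘ suc) (scale ∘ suc) (exists ∘ suc)
    in D ℕ.* E , ℕₚ.m*n≢0 D E {{D≢0}} {{E≢0}} , λ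
      { zero → scale zero D E p
      ; (suc i) → ≡.subst (P (suc i)) (ℕₚ.*-comm E D) (scale (suc i) E D (ps i)) }

  Clears : ℚ → ℕ → Set
  Clears q D = ∃ λ k → q ℚ.* fromℕ′ D ≡ fromℤ k

  clears-* : ∀ q D E → Clears q D → Clears q (D ℕ.* E)
  clears-* q D E (k , qD≡k) = k ℤ.* + E , ≡.trans
    (≡.cong (λ t → q ℚ.* t) (≡.trans (≡.cong fromℤ (ℤₚ.pos-* D E)) (fromℤ-* (+ D) (+ E))))
    (≡.trans (≡.sym (ℚₚ.*-assoc q (fromℕ′ D) (fromℕ′ E)))
      (≡.trans (≡.cong (λ t → t ℚ.* fromℕ′ E) qD≡k) (≡.sym (fromℤ-* k (+ E)))))

  clears-exists : ∀ q → ∃ λ D → ℕ.NonZero D × Clears q D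
  clears-exists q = ℚ.↧ₙ q , _ , ℚ.↥ q , ≡.trans (ℚₚ.*-comm q (fromℤ (ℚ.↧ q))) (denominator-clears q)

  common-denominator : ∀ {n} (q : Vector ℚ n) → ∃ λ D → ℕ.NonZero D × ∀ i → Clears (q i) D
  common-denominator {n} q = common-multiple n (λ i D → Clears (q i) D) (λ i → clears-* (q i)) (λ i → clears-exists (q i))

  common-denominator₂ : ∀ {m n} (q : Fin m → Vector ℚ n) → ∃ λ D → ℕ.NonZero D × ∀ i k → Clears (q i k) D
  common-denominator₂ {m} q = common-multiple m (λ i D → ∀ k → Clears (q i k) D)
    (λ i D E h k → clears-* (q i k) D E (h k)) (λ i → common-denominator (q i))

  common-denominator₃ : ∀ {l m n} (q : Fin l → Fin m → Vector ℚ n) →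
    ∃ λ D → ℕ.NonZero D × ∀ h i k → Clears (q h i k) D
  common-denominator₃ {l} q = common-multiple l (λ h D → ∀ i k → Clears (q h i k) D)
    (λ h D E f i k → clears-* (q h i k) D E (f i k)) (λ h → common-denominator₂ (q h))

  congruent : ∀ D .{{_ : ℕ.NonZero D}} a b → a %ℕ D ≡ b %ℕ D → ∃ λ q → a ≡ b ℤ.+ q ℤ.* + D
  congruent D a b a≡b = (a /ℕ D) ℤ.- (b /ℕ D) , (begin
    a                                                 ≡⟨ a≡a%ℕn+[a/ℕn]*n a D ⟩
    + (a %ℕ D) ℤ.+ (a /ℕ D) ℤ.* + D                   ≡⟨ ≡.cong (λ r → + r ℤ.+ (a /ℕ D) ℤ.* + D) a≡b ⟩
    + (b %ℕ D) ℤ.+ (a /ℕ D) ℤ.* + D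
      ≡⟨ solve 4 (λ r p q d → r :+ p :* d := (r :+ q :* d) :+ (p :- q) :* d) ≡.refl (+ (b %ℕ D)) (a /ℕ D) (b /ℕ D) (+ D) ⟩
    (+ (b %ℕ D) ℤ.+ (b /ℕ D) ℤ.* + D) ℤ.+ ((a /ℕ D) ℤ.- (b /ℕ D)) ℤ.* + D
      ≡⟨ ≡.cong (λ t → t ℤ.+ ((a /ℕ D) ℤ.- (b /ℕ D)) ℤ.* + D) (a≡a%ℕn+[a/ℕn]*n b D) ⟨
    b ℤ.+ ((a /ℕ D) ℤ.- (b /ℕ D)) ℤ.* + D             ∎)
    where
    open ≡.≡-Reasoning
    open import Data.Integer.Solver using (module +-*-Solver)
    open +-*-Solver

  funToFin-injective : ∀ {m n} (f g : Fin m → Fin n) → funToFin f ≡ funToFin g → ∀ i → f i ≡ g i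
  funToFin-injective f g eq i = ≡.trans (≡.sym (Finₚ.finToFun-funToFin f i))
    (≡.trans (≡.cong (λ k → finToFun k i) eq) (Finₚ.finToFun-funToFin g i))

  -- There are `D ^ N` residue vectors modulo `D`, so two of the first `D ^ N + 1` vectors have the
  -- same one.
  pigeonhole-congruent : ∀ {N} D .{{_ : ℕ.NonZero D}} (u : ℕ → Vector ℤ N) →
    ∃ λ i → ∃ λ j → i ℕ.< j × ∃ λ (q : Vector ℤ N) → ∀ k → u j k ≡ u i k ℤ.+ q k ℤ.* + D
  pigeonhole-congruent {N} D u =
    let i , j , i<j , eq = Finₚ.pigeonhole (ℕₚ.n<1+n (D ℕ.^ N)) (λ i → funToFin (residue (u (toℕ i))))
        h = λ k → congruent D (u (toℕ j) k) (u (toℕ i) k) (≡.sym (≡.trans (≡.sym (Finₚ.toℕ-fromℕ< _))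
              (≡.trans (≡.cong toℕ (funToFin-injective (residue (u (toℕ i))) (residue (u (toℕ j))) eq k)) (Finₚ.toℕ-fromℕ< _))))
    in toℕ i , toℕ j , i<j , (λ k → proj₁ (h k)) , (λ k → proj₂ (h k))
    where
    residue : Vector ℤ N → Fin N → Fin D
    residue v k = fromℕ< (n%ℕd<d (v k) D)

  module IntegerSpan (C : ClassicalField) where

    open FieldProperties C
    open Solver using (solve; _:+_; _:*_; _:-_; :-_; _:=_; con)
    open import Relation.Binary.Reasoning.Setoid setoid

    ιℤ : ℤ → Carrier
    ιℤ k = ι (fromℤ k)

    infix 4 _∈⟨_⟩
    record _∈⟨_⟩ {m} (x : Carrier) (v : Vector Carrier m) : Set where
      constructor span
      field
        coefficients : Vector ℤ m
        equation     : x ≈ sum (λ i → v i * ιℤ (coefficients i))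
    open _∈⟨_⟩ public

    ∈-cong : ∀ {m x y} {v : Vector Carrier m} → x ≈ y → x ∈⟨ v ⟩ → y ∈⟨ v ⟩
    ∈-cong x≈y (span c eq) = span c (trans (sym x≈y) eq)

    ∈-0 : ∀ {m} {v : Vector Carrier m} → 0# ∈⟨ v ⟩
    ∈-0 {v = v} = span (λ _ → 0ℤ) (sym (sum-0 _ λ i → trans (*-congˡ ι-0) (zeroʳ (v i))))

    ∈-+ : ∀ {m x y} {v : Vector Carrier m} → x ∈⟨ v ⟩ → y ∈⟨ v ⟩ → x + y ∈⟨ v ⟩
    ∈-+ {v = v} (span c p) (span d q) = span (λ i → c i ℤ.+ d i) (trans (+-cong p q)
      (trans (sym (∑-distrib-+ (λ i → v i * ιℤ (c i)) _))
        (sum-cong-≋ λ i → trans (sym (distribˡ (v i) _ _))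
          (*-congˡ (trans (sym (ι-+ _ _)) (ι-cong (≡.sym (fromℤ-+ (c i) (d i)))))))))

    ∈-scale : ∀ {m x} {v : Vector Carrier m} k → x ∈⟨ v ⟩ → x * ιℤ k ∈⟨ v ⟩
    ∈-scale {v = v} k (span c p) = span (λ i → c i ℤ.* k) (trans (*-congʳ p)
      (trans (*-distribʳ-sum (ιℤ k) (λ i → v i * ιℤ (c i)))
        (sum-cong-≋ λ i → trans (*-assoc (v i) _ _)
          (*-congˡ (trans (sym (ι-* _ _)) (ι-cong (≡.sym (fromℤ-* (c i) k))))))))

    ∈-gen : ∀ {m} (v : Vector Carrier m) i → v i ∈⟨ v ⟩
    ∈-gen v i = span (λ k → δℤ k i) (trans (sym (sum-δʳ v i))
      (sum-cong-≋ λ k → *-congˡ (ι-cong (δ≡ k i))))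
      where
      δℤ : ∀ {n} → Fin n → Fin n → ℤ
      δℤ zero zero = 1ℤ
      δℤ zero (suc j) = 0ℤ
      δℤ (suc i) zero = 0ℤ
      δℤ (suc i) (suc j) = δℤ i j
      δ≡ : ∀ {n} (i j : Fin n) → δ i j ≡ fromℤ (δℤ i j)
      δ≡ zero zero = ≡.refl
      δ≡ zero (suc j) = ≡.refl
      δ≡ (suc i) zero = ≡.refl
      δ≡ (suc i) (suc j) = δ≡ i j

    ∈-sum : ∀ {m n} {v : Vector Carrier m} (f : Vector Carrier n) → (∀ i → f i ∈⟨ v ⟩) → sum f ∈⟨ v ⟩
    ∈-sum {n = zero} f h = ∈-0
    ∈-sum {n = suc n} f h = ∈-+ (h zero) (∈-sum (f ∘ suc) (h ∘ suc))

    ∈-* : ∀ {m n x y} {v : Vector Carrier m} {w : Vector Carrier n} → x ∈⟨ v ⟩ →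
      (∀ i → v i * y ∈⟨ w ⟩) → x * y ∈⟨ w ⟩
    ∈-* {y = y} {v} {w} (span c p) h = ∈-cong (begin
        sum (λ i → (v i * y) * ιℤ (c i))
          ≈⟨ sum-cong-≋ (λ i → solve 3 (λ v y c → (v :* y) :* c := (v :* c) :* y) refl (v i) y (ιℤ (c i))) ⟩
        sum (λ i → (v i * ιℤ (c i)) * y)
          ≈⟨ *-distribʳ-sum y (λ i → v i * ιℤ (c i)) ⟨
        sum (λ i → v i * ιℤ (c i)) * y
          ≈⟨ *-congʳ p ⟨
        _ * y ∎)
      (∈-sum (λ i → (v i * y) * ιℤ (c i)) (λ i → ∈-scale (c i) (h i)))

    powers : ∀ m → Carrier → Vector Carrier m
    powers m z i = z ^ toℕ i

    power∈ : ∀ {m} z i → i ℕ.< m → z ^ i ∈⟨ powers m z ⟩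
    power∈ {m} z i i<m = ≡.subst (λ k → z ^ k ∈⟨ powers m z ⟩) (Finₚ.toℕ-fromℕ< i<m) (∈-gen (powers m z) (fromℕ< i<m))

    -- Two of the vectors of numerators of zⁿ, n > N, agree modulo the common denominator D.
    integral : ∀ {N} D .{{_ : ℕ.NonZero D}} z → (∀ n → z ^ suc n * ιℤ (+ D) ∈⟨ powers N z ⟩) →
      ∃ λ m → ∃ λ (a : Vector ℤ m) → z ^ m + sum (λ i → ιℤ (a i) * z ^ toℕ i) ≈ 0#
    integral {N} D z h = m , (λ i → ℤ.- coefficients top i) , (begin
        z ^ m + sum (λ i → ιℤ (ℤ.- c i) * z ^ toℕ i)
          ≈⟨ +-congˡ (trans (sum-cong-≋ λ i → trans (*-congʳ (trans (ι-cong (fromℤ-neg (c i))) (ι-neg _)))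
               (solve 2 (λ c p → (:- c) :* p := (:- con 1ℚ) :* (p :* c)) refl (ιℤ (c i)) (z ^ toℕ i)))
               (sym (*-distribˡ-sum (- ι 1ℚ) (λ i → z ^ toℕ i * ιℤ (c i))))) ⟩
        z ^ m + (- ι 1ℚ) * sum (λ i → z ^ toℕ i * ιℤ (c i))
          ≈⟨ +-congʳ (equation top) ⟩
        sum (λ i → z ^ toℕ i * ιℤ (c i)) + (- ι 1ℚ) * sum (λ i → z ^ toℕ i * ιℤ (c i))
          ≈⟨ trans (solve 1 (λ d → d :+ (:- con 1ℚ) :* d := con 0ℚ) refl _) ι-0 ⟩
        0# ∎)
      where
      -- Only exponents beyond `N` are used, so that the spanning powers of `z` all lie below the
      -- exponent `m` of the final equation.
      u : ℕ → Vector ℤ N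
      u n = coefficients (h (N ℕ.+ n))
      collision = pigeonhole-congruent D u
      i = proj₁ collision
      j = proj₁ (proj₂ collision)
      i<j = proj₁ (proj₂ (proj₂ collision))
      q = proj₁ (proj₂ (proj₂ (proj₂ collision)))
      uj≡ = proj₂ (proj₂ (proj₂ (proj₂ collision)))
      m = suc (N ℕ.+ j)
      l = suc (N ℕ.+ i)
      D≉0 : ¬ (ιℤ (+ D) ≈ 0#)
      D≉0 e = ℚₚ.<-irrefl (≡.sym (ι-injective (trans e (sym ι-0)))) (0<fromℕ D)
      Q : Carrier
      Q = sum (λ k → z ^ toℕ k * ιℤ (q k))
      -- The numerators of `zᵐ` and `zˡ` differ by multiples of `D`; once `D` is cancelled, the
      -- difference `Q` is an integral combination of powers below `N`. As `l < m`, this is a monic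
      -- integral equation.
      zᵐ≈ : z ^ m ≈ z ^ l + Q
      zᵐ≈ = x-y≈0⇒x≈y (domain D≉0 (begin
        ιℤ (+ D) * (z ^ m - (z ^ l + Q))
          ≈⟨ solve 4 (λ d x y s → d :* (x :- (y :+ s)) := x :* d :- (y :* d :+ s :* d)) refl (ιℤ (+ D)) (z ^ m) (z ^ l) Q ⟩
        z ^ m * ιℤ (+ D) - (z ^ l * ιℤ (+ D) + Q * ιℤ (+ D))
          ≈⟨ x≈y⇒x-y≈0 (begin
               z ^ m * ιℤ (+ D)
                 ≈⟨ equation (h (N ℕ.+ j)) ⟩
               sum (λ k → z ^ toℕ k * ιℤ (u j k))
                 ≈⟨ sum-cong-≋ (λ k → trans (*-congˡ (trans (ι-cong (≡.trans (≡.cong fromℤ (uj≡ k))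
                      (≡.trans (fromℤ-+ (u i k) (q k ℤ.* + D)) (≡.cong (λ t → fromℤ (u i k) ℚ.+ t) (fromℤ-* (q k) (+ D))))))
                      (trans (ι-+ _ _) (+-congˡ (ι-* _ _)))))
                      (solve 4 (λ p a b d → p :* (a :+ b :* d) := p :* a :+ (p :* b) :* d) refl
                        (z ^ toℕ k) (ιℤ (u i k)) (ιℤ (q k)) (ιℤ (+ D)))) ⟩
               sum (λ k → z ^ toℕ k * ιℤ (u i k) + (z ^ toℕ k * ιℤ (q k)) * ιℤ (+ D))
                 ≈⟨ ∑-distrib-+ (λ k → z ^ toℕ k * ιℤ (u i k)) _ ⟩
               sum (λ k → z ^ toℕ k * ιℤ (u i k)) + sum (λ k → (z ^ toℕ k * ιℤ (q k)) * ιℤ (+ D))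
                 ≈⟨ +-cong (sym (equation (h (N ℕ.+ i)))) (sym (*-distribʳ-sum (ιℤ (+ D)) (λ k → z ^ toℕ k * ιℤ (q k)))) ⟩
               z ^ l * ιℤ (+ D) + Q * ιℤ (+ D) ∎) ⟩
        0# ∎))
      top : z ^ m ∈⟨ powers m z ⟩
      top = ∈-cong (sym zᵐ≈) (∈-+ (power∈ z l (ℕ.s≤s (ℕₚ.+-monoʳ-< N i<j)))
        (∈-sum _ λ k → ∈-scale (q k) (power∈ z (toℕ k)
          (ℕₚ.<-≤-trans (Finₚ.toℕ<n k) (ℕₚ.≤-trans (ℕₚ.m≤m+n N j) (ℕₚ.n≤1+n _))))))
      c = coefficients top

-- Embedding matrix, trace form, orders and primitive elements

module TraceForms where

  open LinearSystems
  open Fields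
  open Rationals using (fromℤ-injective; 0<fromℕ)
  open Reals using (recip; recip-inverse)
  open import Defs using (fromℤ)
  open IntegerSpans
  open import Data.Fin.Relation.Unary.Top using (view; ‵fromℕ; ‵inject₁)
  open import Data.Nat.Induction using (<-rec)

  module OverField (C : ClassicalField) where

    open FieldProperties C
    open IntegerSpan C
    open Solver using (solve; _:+_; _:*_; _:-_; :-_; _:=_; con)
    open import Relation.Binary.Reasoning.Setoid setoid

    -- The number field enters only through the values of its embeddings and through rational
    -- coordinates; neither an equality nor a division on `E` is assumed. The index `o` stands for
    -- the inclusion, at which rational independence of the basis is known.
    module TraceForm {ℓ} {E : Set ℓ}
      (_*ᴱ_ : E → E → E) (1ᴱ : E) {N : ℕ} (o : Fin N) (σ : Fin N → E → Carrier)
      (σ-* : ∀ j x y → σ j (x *ᴱ y) ≈ σ j x * σ j y) (σ-1 : ∀ j → σ j 1ᴱ ≈ 1#)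
      (σ-distinct : ∀ i j → i ≢ j → ¬ (∀ x → σ i x ≈ σ j x))
      (b : Fin N → E) (coord : E → Vector ℚ N)
      (expand : ∀ j x → σ j x ≈ sum (λ i → σ j (b i) * ι (coord x i)))
      (combo : Vector ℚ N → E) (σ-combo : ∀ j c → σ j (combo c) ≈ sum (λ i → σ j (b i) * ι (c i)))
      (basis-independent : ∀ (c : Vector ℚ N) → sum (λ i → σ o (b i) * ι (c i)) ≈ 0# → ∀ i → c i ≡ 0ℚ)
      where

      open Characters _*ᴱ_

      module F-LA = LinearAlgebra.DiscreteUpTo ring (λ A → ¬ ¬ A) (λ x k → k x) (λ x f k → x λ a → f a k)
        zero-or-invertible 1≉0

      S : Fin N → Fin N → Carrier
      S j i = σ j (b i)

      combine-coords : ∀ {m} (v : Fin m → E) (e : Vector ℚ m) (w : Vector ℚ N) →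
        (∀ i → ∑ℚ.sum (λ k → coord (v k) i ℚ.* e k) ≡ w i) →
        ∀ j → sum (λ k → σ j (v k) * ι (e k)) ≈ sum (λ i → S j i * ι (w i))
      combine-coords v e w eqs j = begin
        sum (λ k → σ j (v k) * ι (e k))
          ≈⟨ sum-cong-≋ (λ k → *-congʳ (expand j (v k))) ⟩
        sum (λ k → sum (λ i → S j i * ι (coord (v k) i)) * ι (e k))
          ≈⟨ sum-* (S j) (λ i k → ι (coord (v k) i)) (λ k → ι (e k)) ⟨
        sum (λ i → S j i * sum (λ k → ι (coord (v k) i) * ι (e k)))
          ≈⟨ sum-cong-≋ (λ i → *-congˡ (trans (sum-cong-≋ (λ k → sym (ι-* (coord (v k) i) (e k))))
               (trans (sym (ι-sum (λ k → coord (v k) i ℚ.* e k))) (ι-cong (eqs i))))) ⟩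
        sum (λ i → S j i * ι (w i)) ∎

      -- The coordinates of `v` form a rational matrix, independent because a rational relation
      -- among its columns would show up at `o`. Solving over ℚ yields coefficients that serve all
      -- embeddings at once.
      independent⇒spanning : (v : Fin N → E) →
        (∀ e → sum (λ k → σ o (v k) * ι (e k)) ≈ 0# → ∀ k → e k ≡ 0ℚ) →
        ∀ x → ∃ λ (e : Vector ℚ N) → ∀ j → σ j x ≈ sum (λ k → σ j (v k) * ι (e k))
      independent⇒spanning v indep x =
        let e , eqs = ℚ-LA.independent⇒solvable N (λ i k → coord (v k) i)
              (λ e eqs → indep e (trans (combine-coords v e (λ _ → 0ℚ) eqs o)
                (sum-0 _ λ i → trans (*-congˡ ι-0) (zeroʳ (S o i))))) (coord x)
        in e , λ j → trans (expand j x) (sym (combine-coords v e (coord x) eqs j))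

      embeddings-independent : ∀ (c : Vector Carrier N) → (∀ x → sum (λ j → c j * σ j x) ≈ 0#) → ∀ j → c j ≈ 0#
      embeddings-independent c relation i = begin
        c i                       ≈⟨ *-identityʳ (c i) ⟨
        c i * 1#                 ≈⟨ *-congˡ (σ-1 i) ⟨
        c i * σ i 1ᴱ
          ≈⟨ coefficient≈0 c σ σ-* i (λ j j≢i → σ-distinct j i j≢i) relation 1ᴱ ⟩
        0#                        ∎

      -- A combination of embeddings that vanishes on the basis vanishes on every element, so
      -- Dedekind's independence applies.
      left-kernel : ∀ (c : Vector Carrier N) → (∀ k → sum (λ j → c j * S j k) ≈ 0#) → ∀ j → c j ≈ 0#
      left-kernel c cS≈0 = embeddings-independent c λ x → begin
        sum (λ j → c j * σ j x)
          ≈⟨ sum-cong-≋ (λ j → *-congˡ (expand j x)) ⟩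
        sum (λ j → c j * sum (λ k → S j k * ι (coord x k)))
          ≈⟨ sum-* c S (ι ∘ coord x) ⟩
        sum (λ k → sum (λ j → c j * S j k) * ι (coord x k))
          ≈⟨ sum-0 _ (λ k → trans (*-congʳ (cS≈0 k)) (zeroˡ _)) ⟩
        0# ∎

      left-cancel : ∀ (c d : Vector Carrier N) → (∀ k → sum (λ j → c j * S j k) ≈ sum (λ j → d j * S j k)) →
        ∀ j → c j ≈ d j
      left-cancel c d eq j = x-y≈0⇒x≈y (left-kernel (λ j → c j - d j) (λ k → begin
        sum (λ j → (c j - d j) * S j k)
          ≈⟨ sum-cong-≋ (λ j → solve 3 (λ c d s → (c :- d) :* s := c :* s :+ (:- con 1ℚ) :* (d :* s)) refl (c j) (d j) (S j k)) ⟩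
        sum (λ j → c j * S j k + (- ι 1ℚ) * (d j * S j k))
          ≈⟨ ∑-distrib-+ (λ j → c j * S j k) _ ⟩
        sum (λ j → c j * S j k) + sum (λ j → (- ι 1ℚ) * (d j * S j k))
          ≈⟨ +-cong (eq k) (sym (*-distribˡ-sum ((- ι 1ℚ)) (λ j → d j * S j k))) ⟩
        D k + (- ι 1ℚ) * D k
          ≈⟨ trans (solve 1 (λ d → d :+ (:- con 1ℚ) :* d := con 0ℚ) refl (D k)) ι-0 ⟩
        0# ∎) j)
        where
        D : Fin N → Carrier
        D k = sum (λ j → d j * S j k)

      -- The trace of the matrix of multiplication by `x`, hence rational by construction; that it
      -- is the sum of the conjugates is then a theorem.
      trace : E → ℚ
      trace x = ∑ℚ.sum (λ i → coord (x *ᴱ b i) i)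

      LeftInverse : (Fin N → Fin N → Carrier) → Set
      LeftInverse R = ∀ i k → sum (λ j → R i j * S j k) ≈ ι (δ i k)

      left-inverse-exists : ¬ ¬ ∃ LeftInverse
      left-inverse-exists = F-LA.sequence N
        (λ i → F-LA.independent⇒solvable N (λ k j → S j k)
          (λ c eqs → left-kernel c λ k → trans (sum-cong-≋ λ j → *-comm (c j) (S j k)) (eqs k))
          (ι ∘ δ i))
        >>= λ rows k → k ((λ i → proj₁ (rows i)) , λ i k → trans (sum-cong-≋ λ j → *-comm _ (S j k)) (proj₂ (rows i) k))
        where
        _>>=_ : ∀ {A B : Set} → ¬ ¬ A → (A → ¬ ¬ B) → ¬ ¬ B
        (x >>= f) k = x λ a → f a k

      -- Over the eigenbasis S of multiplication by x the matrix is diag (σ_j x); the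
      -- inverse of S exists only classically, but the conclusion is an equality.
      trace≈∑σ : ∀ x → sum (λ j → σ j x) ≈ ι (trace x)
      trace≈∑σ x = stable≈ λ k → left-inverse-exists λ (R , RS) → k (proof R RS)
        where
        m : Fin N → Fin N → ℚ
        m i = coord (x *ᴱ b i)
        proof : ∀ R → LeftInverse R → sum (λ j → σ j x) ≈ ι (trace x)
        proof R RS = begin
          sum (λ j → σ j x)
            ≈⟨ sum-cong-≋ step ⟩
          sum (λ j → sum (λ i → R i j * sum (λ k → S j k * ι (m i k))))
            ≈⟨ ∑-comm (λ j i → R i j * sum (λ k → S j k * ι (m i k))) ⟩
          sum (λ i → sum (λ j → R i j * sum (λ k → S j k * ι (m i k))))
            ≈⟨ sum-cong-≋ (λ i → trans (sum-* (R i) S (ι ∘ m i))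
                 (trans (sum-cong-≋ (λ k → *-congʳ (RS i k))) (sum-δˡ (ι ∘ m i) i))) ⟩
          sum (λ i → ι (m i i))
            ≈⟨ ι-sum (λ i → m i i) ⟨
          ι (trace x) ∎
          where
          -- A left inverse is also a right inverse: `(S R) S = S (R S) = S`, and `S` can be
          -- cancelled on the right.
          SR : ∀ j l → sum (λ i → S j i * R i l) ≈ ι (δ j l)
          SR j = left-cancel (λ l → sum (λ i → S j i * R i l)) (ι ∘ δ j) λ k → begin
            sum (λ l → sum (λ i → S j i * R i l) * S l k)   ≈⟨ sum-* (S j) R (λ l → S l k) ⟨
            sum (λ i → S j i * sum (λ l → R i l * S l k))   ≈⟨ sum-cong-≋ (λ i → *-congˡ (RS i k)) ⟩
            sum (λ i → S j i * ι (δ i k))                    ≈⟨ sum-δʳ (S j) k ⟩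
            S j k                                             ≈⟨ sum-δˡ (λ l → S l k) j ⟨
            sum (λ l → ι (δ j l) * S l k)                    ∎
          step : ∀ j → σ j x ≈ sum (λ i → R i j * sum (λ k → S j k * ι (m i k)))
          step j = begin
            σ j x                                           ≈⟨ *-identityʳ _ ⟨
            σ j x * 1#                                     ≈⟨ *-congˡ (trans (SR j j) (trans (ι-cong (δ-refl j)) ι-1)) ⟨
            σ j x * sum (λ i → S j i * R i j)             ≈⟨ *-distribˡ-sum _ (λ i → S j i * R i j) ⟩
            sum (λ i → σ j x * (S j i * R i j))
              ≈⟨ sum-cong-≋ (λ i → trans
                   (solve 3 (λ x s r → x :* (s :* r) := r :* (x :* s)) refl (σ j x) (S j i) (R i j))
                   (*-congˡ (trans (sym (σ-* j x (b i))) (expand j (x *ᴱ b i))))) ⟩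
            sum (λ i → R i j * sum (λ k → S j k * ι (m i k))) ∎

      T : Fin N → Fin N → ℚ
      T i k = trace (b i *ᴱ b k)

      SᵀS≈T : ∀ i k → sum (λ j → S j i * S j k) ≈ ι (T i k)
      SᵀS≈T i k = trans (sum-cong-≋ (λ j → sym (σ-* j (b i) (b k)))) (trace≈∑σ (b i *ᴱ b k))

      -- Nondegeneracy of the trace form: `T c = 0` reads `Sᵀ (S c) = 0`, so `S c` vanishes by
      -- `left-kernel`, and its entry at `o` is a rational relation between basis elements.
      T-independent : ℚ-LA.Independent T
      T-independent c Tc≡0 = basis-independent c (left-kernel (λ j → sum (λ k → S j k * ι (c k))) (λ i → begin
        sum (λ j → sum (λ k → S j k * ι (c k)) * S j i)
          ≈⟨ sum-cong-≋ (λ j → *-comm _ (S j i)) ⟩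
        sum (λ j → S j i * sum (λ k → S j k * ι (c k)))
          ≈⟨ sum-* (λ j → S j i) S (ι ∘ c) ⟩
        sum (λ k → sum (λ j → S j i * S j k) * ι (c k))
          ≈⟨ sum-cong-≋ (λ k → trans (*-congʳ (SᵀS≈T i k)) (sym (ι-* (T i k) (c k)))) ⟩
        sum (λ k → ι (T i k ℚ.* c k))
          ≈⟨ ι-sum (λ k → T i k ℚ.* c k) ⟨
        ι (∑ℚ.sum (λ k → T i k ℚ.* c k))
          ≈⟨ trans (ι-cong (Tc≡0 i)) ι-0 ⟩
        0# ∎) o)

      -- `U k` is column `k` of `T⁻¹`.
      U : Fin N → Fin N → ℚ
      U k = proj₁ (ℚ-LA.independent⇒solvable N T T-independent (λ i → δ i k))

      TU≡1 : ∀ m k → ∑ℚ.sum (λ i → T m i ℚ.* U k i) ≡ δ m k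
      TU≡1 m k = proj₂ (ℚ-LA.independent⇒solvable N T T-independent (λ i → δ i k)) m

      -- The columns of the inverse of S are given by the dual basis for the trace form.
      dual : Fin N → Fin N → Carrier
      dual i l = sum (λ k → ι (U k i) * S l k)

      S-dual : ∀ j l → sum (λ i → S j i * dual i l) ≈ ι (δ j l)
      S-dual j l = left-cancel (λ j → sum (λ i → S j i * dual i l)) (λ j → ι (δ j l)) (λ m → begin
        sum (λ j → sum (λ i → S j i * dual i l) * S j m)
          ≈⟨ sum-cong-≋ (λ j → *-comm _ (S j m)) ⟩
        sum (λ j → S j m * sum (λ i → S j i * dual i l))
          ≈⟨ sum-* (λ j → S j m) S (λ i → dual i l) ⟩
        sum (λ i → sum (λ j → S j m * S j i) * dual i l)
          ≈⟨ sum-cong-≋ (λ i → *-congʳ (SᵀS≈T m i)) ⟩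
        sum (λ i → ι (T m i) * sum (λ k → ι (U k i) * S l k))
          ≈⟨ sum-* (λ i → ι (T m i)) (λ i k → ι (U k i)) (S l) ⟩
        sum (λ k → sum (λ i → ι (T m i) * ι (U k i)) * S l k)
          ≈⟨ sum-cong-≋ (λ k → *-congʳ (trans (sum-cong-≋ (λ i → sym (ι-* (T m i) (U k i))))
               (trans (sym (ι-sum (λ i → T m i ℚ.* U k i))) (ι-cong (TU≡1 m k))))) ⟩
        sum (λ k → ι (δ m k) * S l k)
          ≈⟨ sum-δˡ (S l) m ⟩
        S l m
          ≈⟨ sum-δˡ (λ j → S j m) l ⟨
        sum (λ j → ι (δ l j) * S j m)
          ≈⟨ sum-cong-≋ (λ j → *-congʳ (ι-cong (δ-sym l j))) ⟩
        sum (λ j → ι (δ j l) * S j m) ∎) j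

      -- The vector `T⁻¹ (Sᵀ v)`, bracketed so that the inner sums are the quantities fixed by
      -- complex conjugation.
      solution : Vector Carrier N → Vector Carrier N
      solution v i = sum (λ k → ι (U k i) * sum (λ l → S l k * v l))

      solve-target : ∀ (v : Vector Carrier N) j → sum (λ i → S j i * solution v i) ≈ v j
      solve-target v j = begin
        sum (λ i → S j i * sum (λ k → ι (U k i) * sum (λ l → S l k * v l)))
          ≈⟨ sum-cong-≋ (λ i → *-congˡ (sum-* (λ k → ι (U k i)) (λ k l → S l k) v)) ⟩
        sum (λ i → S j i * sum (λ l → dual i l * v l))
          ≈⟨ sum-* (S j) dual v ⟩
        sum (λ l → sum (λ i → S j i * dual i l) * v l)
          ≈⟨ sum-cong-≋ (λ l → *-congʳ (S-dual j l)) ⟩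
        sum (λ l → ι (δ j l) * v l)
          ≈⟨ sum-δˡ v j ⟩
        v j ∎

      solve-target-≈ : ∀ v (x : Vector Carrier N) → (∀ i → x i ≈ solution v i) → ∀ j → sum (λ i → S j i * x i) ≈ v j
      solve-target-≈ v x x≈ j = trans (sum-cong-≋ λ i → *-congˡ {S j i} (x≈ i)) (solve-target v j)

      -- As `T⁻¹` is rational, a property closed under sums and rational multiples passes from
      -- `Sᵀ v` to the solution; reality is the intended case.
      solution-closed : ∀ {p} (P : Carrier → Set p) → P 0# → (∀ {x y} → P x → P y → P (x + y)) →
        (∀ q {x} → P x → P (ι q * x)) → ∀ v → (∀ k → P (sum (λ l → S l k * v l))) → ∀ i → P (solution v i)
      solution-closed P P-0 P-+ P-scale v h i = P-sum _ λ k → P-scale (U k i) (h k)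
        where
        P-sum : ∀ {m} (f : Vector Carrier m) → (∀ k → P (f k)) → P (sum f)
        P-sum {zero} f h = P-0
        P-sum {suc m} f h = P-+ (h zero) (P-sum (f ∘ suc) (h ∘ suc))

      -- Multiplication by a nonzero `β` keeps the basis independent, so the elements `β bₖ` span
      -- and in particular represent 1. The coefficients are the coordinates of `β⁻¹`.
      inverse : ∀ β → ¬ (σ o β ≈ 0#) →
        ∃ λ (e : Vector ℚ N) → ∀ j → σ j β * sum (λ k → S j k * ι (e k)) ≈ 1#
      inverse β β≉0 =
        let e , eqs = independent⇒spanning (λ k → β *ᴱ b k)
              (λ e e≈0 → basis-independent e (domain β≉0 (trans (sym (pull o e)) e≈0))) 1ᴱ
        in e , λ j → trans (sym (pull j e)) (trans (sym (eqs j)) (σ-1 j))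
        where
        pull : ∀ j e → sum (λ k → σ j (β *ᴱ b k) * ι (e k)) ≈ σ j β * sum (λ k → S j k * ι (e k))
        pull j e = trans (sum-cong-≋ (λ k → trans (*-congʳ (σ-* j β (b k)))
          (*-assoc (σ j β) (S j k) (ι (e k))))) (sym (*-distribˡ-sum (σ j β) (λ k → S j k * ι (e k))))

      -- With x the exact solution for the target Q/β, rounding x to c moves β · ∑ cᵢ bᵢ
      -- away from Q only by the conjugates of β times a bounded factor.
      rounding-error : ∀ β (e c : Vector ℚ N) (Q x : Vector Carrier N) →
        (∀ j → σ j β * sum (λ k → S j k * ι (e k)) ≈ 1#) →
        (∀ j → sum (λ i → S j i * x i) ≈ Q j * sum (λ k → S j k * ι (e k))) →
        ∀ j → - (σ j β * sum (λ i → S j i * (x i - ι (c i)))) ≈ σ j (β *ᴱ combo c) - Q j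
      rounding-error β e c Q x inv target j = begin
        - (σ j β * sum (λ i → S j i * (x i - ι (c i))))
          ≈⟨ -‿cong (*-congˡ (trans (sum-cong-≋ (λ i → solve 3 (λ s x c → s :* (x :- c) := s :* x :+ (:- con 1ℚ) :* (s :* c)) refl (S j i) (x i) (ι (c i))))
               (trans (∑-distrib-+ (λ i → S j i * x i) _) (+-congˡ (sym (*-distribˡ-sum (- ι 1ℚ) (λ i → S j i * ι (c i)))))))) ⟩
        - (σ j β * (sum (λ i → S j i * x i) + (- ι 1ℚ) * sum (λ i → S j i * ι (c i))))
          ≈⟨ -‿cong (*-congˡ (+-cong (target j) (*-congˡ (sym (σ-combo j c))))) ⟩
        - (σ j β * (Q j * g + (- ι 1ℚ) * σ j (combo c)))
          ≈⟨ solve 4 (λ s q g m → :- (s :* (q :* g :+ (:- con 1ℚ) :* m)) := s :* m :- q :* (s :* g)) refl (σ j β) (Q j) g (σ j (combo c)) ⟩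
        σ j β * σ j (combo c) - Q j * (σ j β * g)
          ≈⟨ +-cong (sym (σ-* j β (combo c))) (-‿cong (trans (*-congˡ (inv j)) (*-identityʳ (Q j)))) ⟩
        σ j (β *ᴱ combo c) - Q j ∎
        where
        g : Carrier
        g = sum (λ k → S j k * ι (e k))

      -- A rational relation at `o` forces the combined coordinates to vanish, and these do not
      -- depend on the embedding.
      transfer : ∀ {m} (v : Fin m → E) (c : Vector ℚ m) →
        sum (λ k → σ o (v k) * ι (c k)) ≈ 0# → ∀ j → sum (λ k → σ j (v k) * ι (c k)) ≈ 0#
      transfer v c relation j = trans (combine-coords v c w (λ _ → ≡.refl) j)
        (sum-0 _ λ i → trans (*-congˡ (trans (ι-cong (w≡0 i)) ι-0)) (zeroʳ (S j i)))
        where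
        w : Vector ℚ N
        w i = ∑ℚ.sum (λ k → coord (v k) i ℚ.* c k)
        w≡0 : ∀ i → w i ≡ 0ℚ
        w≡0 = basis-independent w (trans (sym (combine-coords v c w (λ _ → ≡.refl) o)) relation)

      infixr 8 _^ᴱ_
      _^ᴱ_ : E → ℕ → E
      x ^ᴱ zero = 1ᴱ
      x ^ᴱ suc n = x *ᴱ (x ^ᴱ n)

      σ-^ : ∀ j x n → σ j (x ^ᴱ n) ≈ σ j x ^ n
      σ-^ j x zero = σ-1 j
      σ-^ j x (suc n) = trans (σ-* j x (x ^ᴱ n)) (*-congˡ (σ-^ j x n))

      conjugate-root : ∀ {k} (a : Vector ℚ k) x → evalMonic a (σ o x) ≈ 0# → ∀ j → evalMonic a (σ j x) ≈ 0#
      conjugate-root {k} a x root j = trans (sym (linear j)) (transfer monomials (1ℚ ∷ a) (trans (linear o) root) j)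
        where
        monomials : Fin (suc k) → E
        monomials = (x ^ᴱ k) ∷ λ i → x ^ᴱ toℕ i
        linear : ∀ j → sum (λ i → σ j (monomials i) * ι ((1ℚ ∷ a) i)) ≈ evalMonic a (σ j x)
        linear j = +-cong (trans (*-congˡ ι-1) (trans (*-identityʳ _) (σ-^ j x k)))
          (sum-cong-≋ λ i → trans (*-comm _ (ι (a i))) (*-congˡ (σ-^ j x (toℕ i))))

      module Order (D : ℕ) (D-clears : ∀ i k l → Clears (coord (b i *ᴱ b k) l) D) where

        W : Vector Carrier N
        W i = σ o (b i) * ιℤ (+ D)

        -- With `bᵢ bₖ = ∑ aₗ bₗ` the product is `∑ (D aₗ)(D bₗ)`: one factor `D` clears the
        -- structure constants, the other restores the scaled basis.
        W*W∈⟨W⟩ : ∀ i k → W i * W k ∈⟨ W ⟩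
        W*W∈⟨W⟩ i k = span (λ l → proj₁ (D-clears i k l)) (begin
          (σ o (b i) * ιℤ (+ D)) * (σ o (b k) * ιℤ (+ D))
            ≈⟨ solve 3 (λ x y d → (x :* d) :* (y :* d) := (x :* y) :* (d :* d)) refl (σ o (b i)) (σ o (b k)) (ιℤ (+ D)) ⟩
          (σ o (b i) * σ o (b k)) * (ιℤ (+ D) * ιℤ (+ D))
            ≈⟨ *-congʳ (trans (sym (σ-* o (b i) (b k))) (expand o (b i *ᴱ b k))) ⟩
          sum (λ l → S o l * ι (a l)) * (ιℤ (+ D) * ιℤ (+ D))
            ≈⟨ *-distribʳ-sum _ (λ l → S o l * ι (a l)) ⟩
          sum (λ l → (S o l * ι (a l)) * (ιℤ (+ D) * ιℤ (+ D)))
            ≈⟨ sum-cong-≋ (λ l → trans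
                 (solve 3 (λ s a d → (s :* a) :* (d :* d) := (s :* d) :* (a :* d)) refl (S o l) (ι (a l)) (ιℤ (+ D)))
                 (*-congˡ (trans (sym (ι-* (a l) (fromℤ (+ D)))) (ι-cong (proj₂ (D-clears i k l)))))) ⟩
          sum (λ l → W l * ιℤ (proj₁ (D-clears i k l))) ∎)
          where
          a : Vector ℚ N
          a = coord (b i *ᴱ b k)

        *-closed : ∀ {x y} → x ∈⟨ W ⟩ → y ∈⟨ W ⟩ → x * y ∈⟨ W ⟩
        *-closed x∈ y∈ = ∈-* x∈ (λ i → ∈-cong (*-comm _ (W i)) (∈-* y∈ (λ k → W*W∈⟨W⟩ k i)))

        -- Restricted to positive exponents, since 1 need not lie in the span of the scaled basis.
        ^-closed : ∀ {x} → x ∈⟨ W ⟩ → ∀ n → x ^ suc n ∈⟨ W ⟩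
        ^-closed {x} x∈ zero = ∈-cong (sym (*-identityʳ x)) x∈
        ^-closed {x} x∈ (suc n) = *-closed x∈ (^-closed x∈ n)

        lattice : Vector ℤ N → E
        lattice c = combo (λ i → fromℤ (c i) ℚ.* fromℤ (+ D))

        lattice∈ : ∀ c → σ o (lattice c) ∈⟨ W ⟩
        lattice∈ c = span c (trans (σ-combo o _) (sum-cong-≋ λ i → trans (*-congˡ (ι-* (fromℤ (c i)) (fromℤ (+ D))))
          (solve 3 (λ s c d → s :* (c :* d) := (s :* d) :* c) refl (S o i) (ιℤ (c i)) (ιℤ (+ D)))))

        product∈ : ∀ c d → σ o (lattice c *ᴱ lattice d) ∈⟨ W ⟩
        product∈ c d = ∈-cong (sym (σ-* o (lattice c) (lattice d))) (*-closed (lattice∈ c) (lattice∈ d))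

        lattice≉0 : .{{_ : ℕ.NonZero D}} → ∀ c → ¬ (∀ i → c i ≡ ℤ.0ℤ) → ¬ (σ o (lattice c) ≈ 0#)
        lattice≉0 c c≢0 e = c≢0 λ i → fromℤ-injective {c i} {ℤ.0ℤ}
          (product≡0 (fromℤ (c i)) (fromℤ (+ D)) (λ D≡0 → ℚₚ.<-irrefl (≡.sym D≡0) (0<fromℕ D))
            (basis-independent (λ i → fromℤ (c i) ℚ.* fromℤ (+ D)) (trans (sym (σ-combo o _)) e) i))
          where
          product≡0 : ∀ p d → d ≢ 0ℚ → p ℚ.* d ≡ 0ℚ → p ≡ 0ℚ
          product≡0 p d d≢0 pd≡0 = ≡.trans (≡.sym (ℚₚ.*-identityʳ p)) (≡.trans (≡.cong (λ t → p ℚ.* t) (≡.sym (recip-inverse d≢0)))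
            (≡.trans (≡.sym (ℚₚ.*-assoc p d (recip d))) (≡.trans (≡.cong (λ t → t ℚ.* recip d) pd≡0) (ℚₚ.*-zeroˡ (recip d)))))

      module Primitive (θ : E) (θ-isolated : ∀ j → j ≢ o → ¬ (σ j θ ≈ σ o θ)) where

        z : Fin N → Carrier
        z j = σ j θ

        open Characters ℕ._+_ using () renaming (coefficient≈0 to powers-coefficient≈0)

        -- An element trace-orthogonal to 1, θ, …, θᵏ⁻¹ would be orthogonal to all
        -- powers of θ, hence have o-coefficient 0 in the relation ∑ σ_j(y) σ_j(θ)ⁿ = 0.
        no-small-relation : ∀ {k} → k ℕ.< N → (a : Vector ℚ k) → ¬ (evalMonic a (z o) ≈ 0#)
        no-small-relation {k} k<N a root = ⊥-elim (nonzero (basis-independent c Yo≈0))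
          where
          kernel : ℚ-LA.NontrivialKernel (λ (i : Fin k) l → trace ((θ ^ᴱ toℕ i) *ᴱ b l))
          kernel = ℚ-LA.underdetermined-< k<N (λ i l → trace ((θ ^ᴱ toℕ i) *ᴱ b l))
          c = proj₁ kernel
          nonzero : ¬ (∀ l → c l ≡ 0ℚ)
          nonzero c≡0 = let l , y , cy≡1 = proj₂ (proj₂ kernel) in
            ℚₚ.1≢0 (≡.trans (≡.sym cy≡1) (≡.trans (≡.cong (ℚ._* y) (c≡0 l)) (ℚₚ.*-zeroˡ y)))
          -- `Y j` is the `j`-th conjugate of the orthogonal element `y` with coordinates `c`, and
          -- `u m` is the trace of `y θᵐ`.
          Y : Fin N → Carrier
          Y j = sum (λ l → S j l * ι (c l))
          u : ℕ → Carrier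
          u m = sum (λ j → Y j * z j ^ m)
          small : ∀ i → u (toℕ {k} i) ≈ 0#
          small i = begin
            sum (λ j → Y j * z j ^ toℕ i)
              ≈⟨ sum-cong-≋ (λ j → trans (*-comm (Y j) _) (*-congʳ (sym (σ-^ j θ (toℕ i))))) ⟩
            sum (λ j → σ j (θ ^ᴱ toℕ i) * sum (λ l → S j l * ι (c l)))
              ≈⟨ sum-* (λ j → σ j (θ ^ᴱ toℕ i)) S (ι ∘ c) ⟩
            sum (λ l → sum (λ j → σ j (θ ^ᴱ toℕ i) * S j l) * ι (c l))
              ≈⟨ sum-cong-≋ (λ l → trans (*-congʳ (trans (sum-cong-≋ (λ j → sym (σ-* j (θ ^ᴱ toℕ i) (b l)))) (trace≈∑σ _)))
                   (sym (ι-* _ (c l)))) ⟩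
            sum (λ l → ι (trace ((θ ^ᴱ toℕ i) *ᴱ b l) ℚ.* c l))
              ≈⟨ ι-sum (λ l → trace ((θ ^ᴱ toℕ i) *ᴱ b l) ℚ.* c l) ⟨
            ι (∑ℚ.sum (λ l → trace ((θ ^ᴱ toℕ i) *ᴱ b l) ℚ.* c l))
              ≈⟨ trans (ι-cong (proj₁ (proj₂ kernel) i)) ι-0 ⟩
            0# ∎
          -- All conjugates `z j` are roots of the same rational polynomial, so `u` obeys the linear
          -- recurrence with coefficients `a`, and its first `k` values determine it.
          recurrence : ∀ m → u (m ℕ.+ k) + sum (λ i → ι (a i) * u (m ℕ.+ toℕ i)) ≈ 0#
          recurrence m = begin
            u (m ℕ.+ k) + sum (λ i → ι (a i) * sum (λ j → Y j * z j ^ (m ℕ.+ toℕ i)))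
              ≈⟨ +-congˡ (sum-cong-≋ (λ i → *-congˡ {ι (a i)} (sum-cong-≋ (λ j → *-comm (Y j) (z j ^ (m ℕ.+ toℕ i)))))) ⟩
            u (m ℕ.+ k) + sum (λ i → ι (a i) * sum (λ j → z j ^ (m ℕ.+ toℕ i) * Y j))
              ≈⟨ +-congˡ (sum-* (ι ∘ a) (λ i j → z j ^ (m ℕ.+ toℕ i)) Y) ⟩
            u (m ℕ.+ k) + sum (λ j → sum (λ i → ι (a i) * z j ^ (m ℕ.+ toℕ i)) * Y j)
              ≈⟨ ∑-distrib-+ (λ j → Y j * z j ^ (m ℕ.+ k)) _ ⟨
            sum (λ j → Y j * z j ^ (m ℕ.+ k) + sum (λ i → ι (a i) * z j ^ (m ℕ.+ toℕ i)) * Y j)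
              ≈⟨ sum-0 _ (λ j → begin
                   Y j * z j ^ (m ℕ.+ k) + sum (λ i → ι (a i) * z j ^ (m ℕ.+ toℕ i)) * Y j
                     ≈⟨ +-cong (*-congˡ (^-homo-* (z j) m k)) (*-congʳ (trans (sum-cong-≋ (λ i →
                          trans (*-congˡ (^-homo-* (z j) m (toℕ i)))
                            (solve 3 (λ a p q → a :* (p :* q) := p :* (a :* q)) refl (ι (a i)) (z j ^ m) (z j ^ toℕ i))))
                          (sym (*-distribˡ-sum (z j ^ m) (λ i → ι (a i) * z j ^ toℕ i))))) ⟩
                   Y j * (z j ^ m * z j ^ k) + (z j ^ m * sum (λ i → ι (a i) * z j ^ toℕ i)) * Y j
                     ≈⟨ solve 4 (λ y p q s → y :* (p :* q) :+ (p :* s) :* y := y :* (p :* (q :+ s))) refl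
                          (Y j) (z j ^ m) (z j ^ k) (sum (λ i → ι (a i) * z j ^ toℕ i)) ⟩
                   Y j * (z j ^ m * evalMonic a (z j))
                     ≈⟨ *-congˡ (trans (*-congˡ (conjugate-root a θ root j)) (zeroʳ _)) ⟩
                   Y j * 0#
                     ≈⟨ zeroʳ (Y j) ⟩
                   0# ∎) ⟩
            0# ∎
          vanishes : ∀ m → u m ≈ 0#
          vanishes = <-rec (λ m → u m ≈ 0#) λ m rec → step m (λ {l} → rec {l}) (m ℕₚ.<? k)
            where
            step : ∀ m → (∀ {l} → l ℕ.< m → u l ≈ 0#) → Dec (m ℕ.< k) → u m ≈ 0#
            step m rec (yes m<k) = ≡.subst (λ l → u l ≈ 0#) (Finₚ.toℕ-fromℕ< m<k) (small (fromℕ< m<k))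
            step m rec (no m≮k) = trans (sym (+-identityʳ (u m))) (trans
              (+-cong (reflexive (≡.cong u (≡.sym m≡))) (sym (sum-0 _ λ i → trans (*-congˡ (rec (lower i))) (zeroʳ (ι (a i))))))
              (recurrence (m ℕ.∸ k)))
              where
              m≡ : m ℕ.∸ k ℕ.+ k ≡ m
              m≡ = ℕₚ.m∸n+n≡m (ℕₚ.≮⇒≥ m≮k)
              lower : ∀ (i : Fin k) → m ℕ.∸ k ℕ.+ toℕ i ℕ.< m
              lower i = ≡.subst (m ℕ.∸ k ℕ.+ toℕ i ℕ.<_) m≡ (ℕₚ.+-monoʳ-< (m ℕ.∸ k) (Finₚ.toℕ<n i))
          -- The maps `m ↦ z j ^ m` are characters of `(ℕ, +)`, and the one at `o` differs from the
          -- others already at `m = 1`. Evaluation at 0 isolates `Y o`.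
          Yo≈0 : Y o ≈ 0#
          Yo≈0 = trans (sym (*-identityʳ (Y o))) (powers-coefficient≈0 Y (λ j m → z j ^ m)
            (λ j → ^-homo-* (z j)) o (λ j j≢o h → θ-isolated j j≢o
              (trans (sym (*-identityʳ (z j))) (trans (h 1) (*-identityʳ (z o))))) vanishes 0)

        -- An invertible top coefficient could be divided out to give a monic relation of degree
        -- below `N`; so it is zero, and the shorter relation is treated by induction.
        powers-independent : ∀ m → m ℕ.≤ N → (e : Vector ℚ m) →
          sum (λ i → z o ^ toℕ i * ι (e i)) ≈ 0# → ∀ i → e i ≡ 0ℚ
        powers-independent zero _ e _ ()
        powers-independent (suc m) m<N e relation = all-zero
          where
          lead = e (fromℕ m)
          split : sum (λ i → z o ^ toℕ i * ι (e (inject₁ i))) + z o ^ m * ι lead ≈ 0#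
          split = trans (+-cong (sum-cong-≋ λ i → *-congʳ {ι (e (inject₁ i))} (reflexive (≡.cong (z o ^_) (≡.sym (Finₚ.toℕ-inject₁ i)))))
            (*-congʳ (reflexive (≡.cong (z o ^_) (≡.sym (Finₚ.toℕ-fromℕ m))))))
            (trans (sym (sum-init-last (λ i → z o ^ toℕ i * ι (e i)))) relation)
          lead≡0 : lead ≡ 0ℚ
          lead≡0 with ℚ-zero-or-invertible lead
          ... | inj₁ lead≡0 = lead≡0
          ... | inj₂ (y , lead*y≡1) = ⊥-elim (no-small-relation m<N (λ i → y ℚ.* e (inject₁ i)) (begin
            z o ^ m + sum (λ i → ι (y ℚ.* e (inject₁ i)) * z o ^ toℕ i)
              ≈⟨ +-cong
                   (trans (sym (*-identityʳ _)) (trans (*-congˡ (trans (sym ι-1) (trans (ι-cong (≡.sym lead*y≡1)) (ι-* lead y))))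
                     (solve 3 (λ p l y → p :* (l :* y) := y :* (p :* l)) refl (z o ^ m) (ι lead) (ι y))))
                   (trans (sum-cong-≋ λ i → trans (*-congʳ (ι-* y (e (inject₁ i))))
                     (solve 3 (λ y e p → (y :* e) :* p := y :* (p :* e)) refl (ι y) (ι (e (inject₁ i))) (z o ^ toℕ i)))
                     (sym (*-distribˡ-sum (ι y) (λ i → z o ^ toℕ i * ι (e (inject₁ i)))))) ⟩
            ι y * (z o ^ m * ι lead) + ι y * sum (λ i → z o ^ toℕ i * ι (e (inject₁ i)))
              ≈⟨ solve 3 (λ y p s → y :* p :+ y :* s := y :* (s :+ p)) refl (ι y) _ _ ⟩
            ι y * (sum (λ i → z o ^ toℕ i * ι (e (inject₁ i))) + z o ^ m * ι lead)
              ≈⟨ trans (*-congˡ split) (zeroʳ (ι y)) ⟩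
            0# ∎))
          init≡0 : ∀ i → e (inject₁ i) ≡ 0ℚ
          init≡0 = powers-independent m (ℕₚ.<⇒≤ m<N) (e ∘ inject₁)
            (trans (trans (sym (+-identityʳ _)) (+-congˡ (sym (trans (*-congˡ (trans (ι-cong lead≡0) ι-0)) (zeroʳ _))))) split)
          all-zero : ∀ i → e i ≡ 0ℚ
          all-zero i with view i
          ... | ‵fromℕ = lead≡0
          ... | ‵inject₁ j = init≡0 j

        powersᴱ-span : ∀ x → ∃ λ (e : Vector ℚ N) → ∀ j → σ j x ≈ sum (λ k → σ j (θ ^ᴱ toℕ k) * ι (e k))
        powersᴱ-span = independent⇒spanning (λ k → θ ^ᴱ toℕ k)
          (λ e h → powers-independent N ℕₚ.≤-refl e (trans (sum-cong-≋ λ k → *-congʳ {ι (e k)} (sym (σ-^ o θ (toℕ k)))) h))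

        powers-span : ∀ x → ∃ λ (e : Vector ℚ N) → ∀ j → σ j x ≈ sum (λ k → z j ^ toℕ k * ι (e k))
        powers-span x = let e , eqs = powersᴱ-span x in
          e , λ j → trans (eqs j) (sum-cong-≋ λ k → *-congʳ {ι (e k)} (σ-^ j θ (toℕ k)))

        -- Powers of `θ` span, so an embedding is determined by its value at `θ`.
        conjugates-distinct : ∀ i j → i ≢ j → ¬ (z i ≈ z j)
        conjugates-distinct i j i≢j zi≈zj = σ-distinct i j i≢j λ x → let e , eqs = powers-span x in
          trans (eqs i) (trans (sum-cong-≋ λ k → *-congʳ {ι (e k)} (^-congˡ (toℕ k) zi≈zj)) (sym (eqs j)))

        monic-relation : ∃ λ (a : Vector ℚ N) → evalMonic a (z o) ≈ 0#
        monic-relation = let e , eqs = powers-span (θ ^ᴱ N) in (λ i → ℚ.- e i) , (begin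
          z o ^ N + sum (λ i → ι (ℚ.- e i) * z o ^ toℕ i)
            ≈⟨ +-cong (trans (sym (σ-^ o θ N)) (eqs o)) (sum-cong-≋ λ i → trans (*-congʳ (ι-neg (e i)))
                 (solve 2 (λ e p → (:- e) :* p := (:- con 1ℚ) :* (p :* e)) refl (ι (e i)) (z o ^ toℕ i))) ⟩
          sum (λ k → z o ^ toℕ k * ι (e k)) + sum (λ i → (- ι 1ℚ) * (z o ^ toℕ i * ι (e i)))
            ≈⟨ +-congˡ (*-distribˡ-sum (- ι 1ℚ) (λ k → z o ^ toℕ k * ι (e k))) ⟨
          sum (λ k → z o ^ toℕ k * ι (e k)) + (- ι 1ℚ) * sum (λ k → z o ^ toℕ k * ι (e k))
            ≈⟨ trans (solve 1 (λ d → d :+ (:- con 1ℚ) :* d := con 0ℚ) refl _) ι-0 ⟩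
          0# ∎)

        -- Otherwise `w` and the `z j` would be `N + 1` distinct roots of a polynomial of degree at
        -- most `N`. The conclusion is negative because equality in the field cannot be decided to
        -- single out one `z j`.
        all-conjugates : ∀ {k} (a : Vector ℚ k) → k ℕ.≤ N → evalMonic a (z o) ≈ 0# →
          ∀ w → evalMonic a w ≈ 0# → ¬ (∀ j → ¬ (w ≈ z j))
        all-conjugates {k} a k≤N root w w-root w≉z = monic-roots k (ι ∘ a) (λ i → r (inject≤ i (ℕ.s≤s k≤N)))
          (λ i j i≢j → r-distinct _ _ (λ eq → i≢j (Finₚ.inject≤-injective _ _ i j eq)))
          (λ i → r-root (inject≤ i (ℕ.s≤s k≤N)))
          where
          r : Vector Carrier (suc N)
          r = w ∷ z
          r-distinct : ∀ i j → i ≢ j → ¬ (r i ≈ r j)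
          r-distinct zero zero i≢j _ = i≢j ≡.refl
          r-distinct zero (suc j) _ w≈zj = w≉z j w≈zj
          r-distinct (suc i) zero _ zi≈w = w≉z i (sym zi≈w)
          r-distinct (suc i) (suc j) i≢j = conjugates-distinct i j (i≢j ∘ ≡.cong suc)
          r-root : ∀ i → horner (ι ∘ a) (r i) ≈ 0#
          r-root zero = trans (sym (evalMonic≈horner a w)) w-root
          r-root (suc j) = trans (sym (evalMonic≈horner a (z j))) (conjugate-root a θ root j)

        -- Positive powers of `z o` stay in the integer span of `W`. Writing the basis in powers of
        -- `θ` with a common denominator `Δ` turns this into a uniform denominator for all of them,
        -- as `integral` requires.
        integral-relation : ∀ D (D-clears : ∀ i k l → Clears (coord (b i *ᴱ b k) l) D) →
          z o ∈⟨ Order.W D D-clears ⟩ →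
          ∃ λ m → ∃ λ (a : Vector ℤ m) → evalMonic (fromℤ ∘ a) (z o) ≈ 0#
        integral-relation D D-clears z∈ = integral Δ {{Δ≢0}} (z o) λ n → ∈-* (^-closed z∈ n) (λ i →
            ∈-cong (solve 3 (λ s d e → (s :* e) :* d := (s :* d) :* e) refl (S o i) (ιℤ (+ D)) (ιℤ (+ Δ)))
              (∈-scale (+ D) (span (λ k → proj₁ (Δ-clears i k)) (begin
                S o i * ιℤ (+ Δ)                                          ≈⟨ *-congʳ (proj₂ (powers-span (b i)) o) ⟩
                sum (λ k → z o ^ toℕ k * ι (e i k)) * ιℤ (+ Δ)            ≈⟨ *-distribʳ-sum _ (λ k → z o ^ toℕ k * ι (e i k)) ⟩
                sum (λ k → (z o ^ toℕ k * ι (e i k)) * ιℤ (+ Δ))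
                  ≈⟨ sum-cong-≋ (λ k → trans (*-assoc _ _ _)
                       (*-congˡ (trans (sym (ι-* (e i k) (fromℤ (+ Δ)))) (ι-cong (proj₂ (Δ-clears i k)))))) ⟩
                sum (λ k → z o ^ toℕ k * ιℤ (proj₁ (Δ-clears i k)))       ∎))))
          where
          open Order D D-clears
          e : Fin N → Vector ℚ N
          e i = proj₁ (powers-span (b i))
          denominator = common-denominator₂ e
          Δ = proj₁ denominator
          Δ≢0 = proj₁ (proj₂ denominator)
          Δ-clears = proj₂ (proj₂ denominator)

-- The complex numbers as a field with stable equality

module ComplexField where

  open import Defs
  open Rationals
  open Reals
  open Fields
  open import Algebra.Structures using (IsCommutativeRing)
  open ≡ using (refl; sym; trans; subst; subst₂)

  module ℝᵣ = CommutativeRing ℝ-ring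

  ι : ℚ → ℂ
  ι q = fromℝ (fromℚ q)

  0ᶜ 1ᶜ : ℂ
  0ᶜ = fromℝ 0ʳ
  1ᶜ = fromℝ 1ʳ

  open ℝ-Solver using (solve; _:+_; _:*_; _:-_; :-_; _:=_; con)

  *ᶜ-cong : ∀ {x y u v} → x ≈ᶜ y → u ≈ᶜ v → x *ᶜ u ≈ᶜ y *ᶜ v
  *ᶜ-cong (mk≈ᶜ r i) (mk≈ᶜ r′ i′) = mk≈ᶜ
    (ℝᵣ.+-cong (ℝᵣ.*-cong r r′) (ℝᵣ.-‿cong (ℝᵣ.*-cong i i′)))
    (ℝᵣ.+-cong (ℝᵣ.*-cong r i′) (ℝᵣ.*-cong i r′))

  *ᶜ-comm : ∀ x y → x *ᶜ y ≈ᶜ y *ᶜ x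
  *ᶜ-comm (a +i b) (c +i d) = mk≈ᶜ
    (solve 4 (λ a b c d → a :* c :- b :* d := c :* a :- d :* b) ≈-reflʳ a b c d)
    (solve 4 (λ a b c d → a :* d :+ b :* c := c :* b :+ d :* a) ≈-reflʳ a b c d)

  *ᶜ-assoc : ∀ x y z → (x *ᶜ y) *ᶜ z ≈ᶜ x *ᶜ (y *ᶜ z)
  *ᶜ-assoc (a +i b) (c +i d) (e +i f) = mk≈ᶜ
    (solve 6 (λ a b c d e f → (a :* c :- b :* d) :* e :- (a :* d :+ b :* c) :* f
      := a :* (c :* e :- d :* f) :- b :* (c :* f :+ d :* e)) ≈-reflʳ a b c d e f)
    (solve 6 (λ a b c d e f → (a :* c :- b :* d) :* f :+ (a :* d :+ b :* c) :* e
      := a :* (c :* f :+ d :* e) :+ b :* (c :* e :- d :* f)) ≈-reflʳ a b c d e f)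

  *ᶜ-identityˡ : ∀ x → 1ᶜ *ᶜ x ≈ᶜ x
  *ᶜ-identityˡ (a +i b) = mk≈ᶜ
    (solve 2 (λ a b → con 1ℚ :* a :- con 0ℚ :* b := a) ≈-reflʳ a b)
    (solve 2 (λ a b → con 1ℚ :* b :+ con 0ℚ :* a := b) ≈-reflʳ a b)

  *ᶜ-distribˡ : ∀ x y z → x *ᶜ (y +ᶜ z) ≈ᶜ x *ᶜ y +ᶜ x *ᶜ z
  *ᶜ-distribˡ (a +i b) (c +i d) (e +i f) = mk≈ᶜ
    (solve 6 (λ a b c d e f → a :* (c :+ e) :- b :* (d :+ f)
      := (a :* c :- b :* d) :+ (a :* e :- b :* f)) ≈-reflʳ a b c d e f)
    (solve 6 (λ a b c d e f → a :* (d :+ f) :+ b :* (c :+ e)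
      := (a :* d :+ b :* c) :+ (a :* f :+ b :* e)) ≈-reflʳ a b c d e f)

  ≈ᶜ-trans : ∀ {x y z} → x ≈ᶜ y → y ≈ᶜ z → x ≈ᶜ z
  ≈ᶜ-trans (mk≈ᶜ r i) (mk≈ᶜ r′ i′) = mk≈ᶜ (≈-transʳ r r′) (≈-transʳ i i′)

  +ᶜ-cong : ∀ {x y u v} → x ≈ᶜ y → u ≈ᶜ v → x +ᶜ u ≈ᶜ y +ᶜ v
  +ᶜ-cong (mk≈ᶜ r i) (mk≈ᶜ r′ i′) = mk≈ᶜ (ℝᵣ.+-cong r r′) (ℝᵣ.+-cong i i′)

  ℂ-isCommutativeRing : IsCommutativeRing _≈ᶜ_ _+ᶜ_ _*ᶜ_ -ᶜ_ 0ᶜ 1ᶜ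
  ℂ-isCommutativeRing = record
    { isRing = record
      { +-isAbelianGroup = record
        { isGroup = record
          { isMonoid = record
            { isSemigroup = record
              { isMagma = record
                { isEquivalence = record
                  { refl = mk≈ᶜ ≈-reflʳ ≈-reflʳ
                  ; sym = λ (mk≈ᶜ r i) → mk≈ᶜ (≈-symʳ r) (≈-symʳ i)
                  ; trans = ≈ᶜ-trans }
                ; ∙-cong = +ᶜ-cong }
              ; assoc = λ x y z → mk≈ᶜ (ℝᵣ.+-assoc (re x) (re y) (re z)) (ℝᵣ.+-assoc (im x) (im y) (im z)) }
            ; identity = (λ x → mk≈ᶜ (ℝᵣ.+-identityˡ (re x)) (ℝᵣ.+-identityˡ (im x)))
                       , (λ x → mk≈ᶜ (ℝᵣ.+-identityʳ (re x)) (ℝᵣ.+-identityʳ (im x))) }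
          ; inverse = (λ x → mk≈ᶜ (ℝᵣ.-‿inverseˡ (re x)) (ℝᵣ.-‿inverseˡ (im x)))
                    , (λ x → mk≈ᶜ (ℝᵣ.-‿inverseʳ (re x)) (ℝᵣ.-‿inverseʳ (im x)))
          ; ⁻¹-cong = λ (mk≈ᶜ r i) → mk≈ᶜ (ℝᵣ.-‿cong r) (ℝᵣ.-‿cong i) }
        ; comm = λ x y → mk≈ᶜ (ℝᵣ.+-comm (re x) (re y)) (ℝᵣ.+-comm (im x) (im y)) }
      ; *-cong = *ᶜ-cong
      ; *-assoc = *ᶜ-assoc
      ; *-identity = *ᶜ-identityˡ , λ x → ≈ᶜ-trans (*ᶜ-comm x 1ᶜ) (*ᶜ-identityˡ x)
      ; distrib = *ᶜ-distribˡ , λ x y z → ≈ᶜ-trans (*ᶜ-comm (y +ᶜ z) x) (≈ᶜ-trans (*ᶜ-distribˡ x y z)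
          (+ᶜ-cong (*ᶜ-comm x y) (*ᶜ-comm x z))) }
    ; *-comm = *ᶜ-comm }

  ℂ-ring : CommutativeRing 0ℓ 0ℓ
  ℂ-ring = record { isCommutativeRing = ℂ-isCommutativeRing }

  module ℂᵣ = CommutativeRing ℂ-ring

  fromℝ-cong : ∀ {x y} → x ≈ʳ y → fromℝ x ≈ᶜ fromℝ y
  fromℝ-cong x≈y = mk≈ᶜ x≈y ≈-reflʳ

  fromℝ-+ : ∀ x y → fromℝ (x +ʳ y) ≈ᶜ fromℝ x +ᶜ fromℝ y
  fromℝ-+ x y = mk≈ᶜ ≈-reflʳ (pointwise λ _ → refl)

  fromℝ-neg : ∀ x → fromℝ (-ʳ x) ≈ᶜ -ᶜ fromℝ x
  fromℝ-neg x = mk≈ᶜ ≈-reflʳ (pointwise λ _ → refl)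

  fromℝ-* : ∀ x y → fromℝ (x *ʳ y) ≈ᶜ fromℝ x *ᶜ fromℝ y
  fromℝ-* x y = mk≈ᶜ
    (solve 2 (λ x y → x :* y := x :* y :- con 0ℚ :* con 0ℚ) ≈-reflʳ x y)
    (solve 2 (λ x y → con 0ℚ := x :* con 0ℚ :+ con 0ℚ :* y) ≈-reflʳ x y)

  ι-+ : ∀ p q → ι (p ℚ.+ q) ≈ᶜ ι p +ᶜ ι q
  ι-+ p q = ℂᵣ.trans (fromℝ-cong (pointwise λ _ → refl)) (fromℝ-+ (fromℚ p) (fromℚ q))

  ι-* : ∀ p q → ι (p ℚ.* q) ≈ᶜ ι p *ᶜ ι q
  ι-* p q = ℂᵣ.trans (fromℝ-cong (pointwise λ _ → refl)) (fromℝ-* (fromℚ p) (fromℚ q))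

  ι-neg : ∀ p → ι (ℚ.- p) ≈ᶜ -ᶜ ι p
  ι-neg p = ℂᵣ.trans (fromℝ-cong (pointwise λ _ → refl)) (fromℝ-neg (fromℚ p))

  conj-cong : ∀ {z w} → z ≈ᶜ w → conj z ≈ᶜ conj w
  conj-cong (mk≈ᶜ r i) = mk≈ᶜ r (ℝᵣ.-‿cong i)

  conj-* : ∀ z w → conj (z *ᶜ w) ≈ᶜ conj z *ᶜ conj w
  conj-* (a +i b) (c +i d) = mk≈ᶜ
    (solve 4 (λ a b c d → a :* c :- b :* d := a :* c :- (:- b) :* (:- d)) ≈-reflʳ a b c d)
    (solve 4 (λ a b c d → :- (a :* d :+ b :* c) := a :* (:- d) :+ (:- b) :* c) ≈-reflʳ a b c d)

  z*conj-z : ∀ z → z *ᶜ conj z ≈ᶜ fromℝ (normSq z)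
  z*conj-z (a +i b) = mk≈ᶜ
    (solve 2 (λ a b → a :* a :- b :* (:- b) := a :* a :+ b :* b) ≈-reflʳ a b)
    (solve 2 (λ a b → a :* (:- b) :+ b :* a := con 0ℚ) ≈-reflʳ a b)

  squares≈0 : ∀ x y → x *ʳ x +ʳ y *ʳ y ≈ʳ 0ʳ → x ≈ʳ 0ʳ
  squares≈0 x y sum≈0 = ≺⇒≈0 λ ε 0<ε → decide ε (small-or-apart x ε 0<ε)
    where
    decide : ∀ ε → x ≺ ε ⊎ Apart x → x ≺ ε
    decide ε (inj₁ small) = small
    decide ε (inj₂ (r , 0<r , away)) = ⊥-elim (≈0-apart sum≈0
      (r ℚ.* r , 0<p*q 0<r 0<r , ev-map (λ n r≤∣x∣ → ℚₚ.≤-trans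
        (*-mono-≤ (ℚₚ.0≤∣p∣ (seq x n)) (ℚₚ.<⇒≤ 0<r) r≤∣x∣ r≤∣x∣)
        (subst (ℚ._≤ ∣ seq x n ℚ.* seq x n ℚ.+ seq y n ℚ.* seq y n ∣) (ℚₚ.∣p*q∣≡∣p∣*∣q∣ (seq x n) (seq x n))
          (bound (0≤p*p (seq x n)) (0≤p*p (seq y n))))) away))
      where
      bound : ∀ {p q} → 0ℚ ℚ.≤ p → 0ℚ ℚ.≤ q → ∣ p ∣ ℚ.≤ ∣ p ℚ.+ q ∣
      bound {p} {q} 0≤p 0≤q = subst₂ ℚ._≤_ (sym (ℚₚ.0≤p⇒∣p∣≡p 0≤p)) (sym (ℚₚ.0≤p⇒∣p∣≡p (0≤p+q 0≤p 0≤q)))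
        (≤-cert 0≤q refl)

  normSq≈0 : ∀ z → normSq z ≈ʳ 0ʳ → z ≈ᶜ 0ᶜ
  normSq≈0 z h = mk≈ᶜ (squares≈0 (re z) (im z) h)
    (squares≈0 (im z) (re z) (≈-transʳ (ℝᵣ.+-comm (im z *ʳ im z) (re z *ʳ re z)) h))

  -- An inverse of `normSq z` would make `conj z / normSq z` an inverse of `z`; so the real number
  -- `normSq z` vanishes, and with it both components.
  noninvertible⇒≈0ᶜ : ∀ {z} → ¬ (∃ λ w → z *ᶜ w ≈ᶜ 1ᶜ) → z ≈ᶜ 0ᶜ
  noninvertible⇒≈0ᶜ {z} h = normSq≈0 z (noninvertible⇒≈0 λ (y , eq) →
    h (conj z *ᶜ fromℝ y , ℂᵣ.trans (ℂᵣ.sym (ℂᵣ.*-assoc z (conj z) (fromℝ y)))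
      (ℂᵣ.trans (ℂᵣ.*-congʳ (z*conj-z z)) (ℂᵣ.trans (ℂᵣ.sym (fromℝ-* (normSq z) y)) (fromℝ-cong eq)))))

  stableᶜ : ∀ {z} → ¬ ¬ (z ≈ᶜ 0ᶜ) → z ≈ᶜ 0ᶜ
  stableᶜ h = mk≈ᶜ (stable0 λ k → h λ e → k (_≈ᶜ_.re≈ e)) (stable0 λ k → h λ e → k (_≈ᶜ_.im≈ e))

  ι-injective : ∀ {p q} → ι p ≈ᶜ ι q → p ≡ q
  ι-injective (mk≈ᶜ r _) = fromℚ-injective r

  ℂ-field : ClassicalField
  ℂ-field = record
    { ring = ℂ-ring ; ι = ι ; ι-+ = ι-+ ; ι-* = ι-* ; ι-neg = ι-neg ; ι-0 = ℂᵣ.refl ; ι-1 = ℂᵣ.refl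
    ; ι-injective = ι-injective ; noninvertible⇒≈0 = noninvertible⇒≈0ᶜ ; stable₀ = stableᶜ }

-- Rational combinations in subfields and under embeddings

module FieldElements where

  open import Defs
  open Rationals
  open Reals
  open Fields
  open ComplexField
  open import Algebra.Morphism.Structures using (module RingMorphisms)
  open import Relation.Unary using (Pred; _∈_)
  open ≡ using (refl)
  open import Relation.Binary.Reasoning.Setoid ℂᵣ.setoid
  open FieldProperties ℂ-field using (sum; domain; x-y≈0⇒x≈y; ι-cong; module Solver)
  open Solver using (solve; _:*_; _:-_; _:=_)

  denominator≢0 : ∀ q → fromℤ (ℚ.↧ q) ≢ 0ℚ
  denominator≢0 q e = ℚₚ.<-irrefl (≡.sym e) (0<fromℕ-suc (ℚ.ℚ.denominator-1 q))

  -- Kept general because rational combinations have to be placed both in `K` and in `ℚ⟨ θ ⟩`.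
  module Subfield {ℓ} {P : Pred ℝ ℓ} (isSubfield : IsSubfield P) where
    open IsSubfield isSubfield

    fromℕ∈ : ∀ n → fromℚ (fromℕ′ n) ∈ P
    fromℕ∈ zero = resp (pointwise λ _ → refl) 0∈
    fromℕ∈ (suc n) = resp (pointwise λ _ → ≡.sym (fromℕ-suc n)) (+-closed (fromℕ∈ n) 1∈)

    fromℤ∈ : ∀ k → fromℚ (fromℤ k) ∈ P
    fromℤ∈ (+ n) = fromℕ∈ n
    fromℤ∈ -[1+ n ] = resp (pointwise λ _ → ≡.sym (fromℤ-neg (+ suc n))) (neg-closed (fromℕ∈ (suc n)))

    fromℚ∈ : ∀ q → fromℚ q ∈ P
    fromℚ∈ q = resp (pointwise λ _ → num*inv≡q) (*-closed (fromℤ∈ (ℚ.↥ q)) inv∈)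
      where
      den = fromℤ (ℚ.↧ q)
      den≢0 : den ≢ 0ℚ
      den≢0 = denominator≢0 q
      inv∈ : fromℚ (recip den) ∈ P
      inv∈ = inv-closed {fromℚ den} (pointwise λ _ → recip-inverse den≢0) (fromℤ∈ (ℚ.↧ q))
      num*inv≡q : fromℤ (ℚ.↥ q) ℚ.* recip den ≡ q
      num*inv≡q = ≡.trans (≡.cong (ℚ._* recip den) (≡.sym (denominator-clears q)))
        (≡.trans (≡.cong (ℚ._* recip den) (ℚₚ.*-comm den q))
        (≡.trans (ℚₚ.*-assoc q den (recip den)) (≡.trans (≡.cong (λ t → q ℚ.* t) (recip-inverse den≢0)) (ℚₚ.*-identityʳ q))))

    combination∈ : ∀ {n} (c : Vector ℚ n) (v : Vector ℝ n) → (∀ i → v i ∈ P) → combination c v ∈ P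
    combination∈ {zero} c v v∈ = 0∈
    combination∈ {suc n} c v v∈ = +-closed (*-closed (fromℚ∈ (c zero)) (v∈ zero)) (combination∈ (c ∘ suc) (v ∘ suc) (v∈ ∘ suc))

  module Elements {ℓ} (K : RealNumberField ℓ) where
    open RealNumberField K public
      using (member; isSubfield; resp; 0∈; 1∈; +-closed; *-closed; neg-closed; inv-closed; Element; rawRing)
    open RawRing rawRing public using () renaming (_+_ to _+ᴱ_; _*_ to _*ᴱ_; -_ to -ᴱ_; 0# to 0ᴱ; 1# to 1ᴱ)

    open Subfield isSubfield public

    embedℚ : ℚ → Element
    embedℚ q = fromℚ q , fromℚ∈ q

    combo : ∀ {n} → Vector ℚ n → (Fin n → Element) → Element
    combo c v = combination c (proj₁ ∘ v) , combination∈ c (proj₁ ∘ v) (proj₂ ∘ v)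

    module EmbeddingProperties (τ : Embedding K) where
      open RingMorphisms.IsRingMonomorphism (Embedding.isRingMonomorphism τ) public
        using (+-homo; *-homo; -‿homo; 0#-homo; 1#-homo) renaming (⟦⟧-cong to cong)

      on-fromℕ : ∀ n → ⟦ τ ⟧ (embedℚ (fromℕ′ n)) ≈ᶜ ι (fromℕ′ n)
      on-fromℕ zero = ℂᵣ.trans (cong (pointwise λ _ → refl)) 0#-homo
      on-fromℕ (suc n) = begin
        ⟦ τ ⟧ (embedℚ (fromℕ′ (suc n)))             ≈⟨ cong (pointwise λ _ → fromℕ-suc n) ⟩
        ⟦ τ ⟧ (embedℚ (fromℕ′ n) +ᴱ 1ᴱ)             ≈⟨ +-homo (embedℚ (fromℕ′ n)) 1ᴱ ⟩
        ⟦ τ ⟧ (embedℚ (fromℕ′ n)) +ᶜ ⟦ τ ⟧ 1ᴱ       ≈⟨ ℂᵣ.+-cong (on-fromℕ n) 1#-homo ⟩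
        ι (fromℕ′ n) +ᶜ 1ᶜ                          ≈⟨ ι-+ (fromℕ′ n) 1ℚ ⟨
        ι (fromℕ′ n ℚ.+ 1ℚ)                         ≈⟨ ι-cong (fromℕ-suc n) ⟨
        ι (fromℕ′ (suc n))                          ∎

      on-fromℤ : ∀ k → ⟦ τ ⟧ (embedℚ (fromℤ k)) ≈ᶜ ι (fromℤ k)
      on-fromℤ (+ n) = on-fromℕ n
      on-fromℤ -[1+ n ] = begin
        ⟦ τ ⟧ (embedℚ (fromℤ -[1+ n ]))        ≈⟨ cong (pointwise λ _ → fromℤ-neg (+ suc n)) ⟩
        ⟦ τ ⟧ (-ᴱ embedℚ (fromℕ′ (suc n)))     ≈⟨ -‿homo (embedℚ (fromℕ′ (suc n))) ⟩
        -ᶜ ⟦ τ ⟧ (embedℚ (fromℕ′ (suc n)))     ≈⟨ ℂᵣ.-‿cong (on-fromℕ (suc n)) ⟩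
        -ᶜ ι (fromℕ′ (suc n))                  ≈⟨ ι-neg (fromℕ′ (suc n)) ⟨
        ι (ℚ.- fromℕ′ (suc n))                 ≈⟨ ι-cong (fromℤ-neg (+ suc n)) ⟨
        ι (fromℤ -[1+ n ])                     ∎

      private
        -- Both values agree after multiplication by the denominator, which is then cancelled in ℂ;
        -- only multiplicativity of `τ` is used.
        on-quotient : ∀ d m q → d ≢ 0ℚ → d ℚ.* q ≡ m → ⟦ τ ⟧ (embedℚ d) ≈ᶜ ι d → ⟦ τ ⟧ (embedℚ m) ≈ᶜ ι m →
          ⟦ τ ⟧ (embedℚ q) ≈ᶜ ι q
        on-quotient d m q d≢0 dq≡m on-d on-m = x-y≈0⇒x≈y (domain {ι d} (λ e → d≢0 (ι-injective e)) (begin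
          ι d *ᶜ (⟦ τ ⟧ (embedℚ q) -ᶜ ι q)
            ≈⟨ solve 3 (λ d x y → d :* (x :- y) := d :* x :- d :* y) ℂᵣ.refl (ι d) (⟦ τ ⟧ (embedℚ q)) (ι q) ⟩
          ι d *ᶜ ⟦ τ ⟧ (embedℚ q) -ᶜ ι d *ᶜ ι q
            ≈⟨ ℂᵣ.+-cong (begin
                 ι d *ᶜ ⟦ τ ⟧ (embedℚ q)                   ≈⟨ ℂᵣ.*-congʳ on-d ⟨
                 ⟦ τ ⟧ (embedℚ d) *ᶜ ⟦ τ ⟧ (embedℚ q)      ≈⟨ *-homo (embedℚ d) (embedℚ q) ⟨
                 ⟦ τ ⟧ (embedℚ d *ᴱ embedℚ q)              ≈⟨ cong (pointwise λ _ → dq≡m) ⟩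
                 ⟦ τ ⟧ (embedℚ m)                          ≈⟨ on-m ⟩
                 ι m                                       ∎)
               (ℂᵣ.-‿cong (ℂᵣ.trans (ℂᵣ.sym (ι-* d q)) (ι-cong dq≡m))) ⟩
          ι m -ᶜ ι m
            ≈⟨ ℂᵣ.-‿inverseʳ (ι m) ⟩
          0ᶜ ∎))

      on-ℚ : ∀ q → ⟦ τ ⟧ (embedℚ q) ≈ᶜ ι q
      on-ℚ q = on-quotient (fromℤ (ℚ.↧ q)) (fromℤ (ℚ.↥ q)) q (denominator≢0 q)
        (denominator-clears q) (on-fromℤ (ℚ.↧ q)) (on-fromℤ (ℚ.↥ q))

      on-combo : ∀ {n} (c : Vector ℚ n) v → ⟦ τ ⟧ (combo c v) ≈ᶜ sum (λ i → ⟦ τ ⟧ (v i) *ᶜ ι (c i))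
      on-combo {zero} c v = 0#-homo
      on-combo {suc n} c v = begin
        ⟦ τ ⟧ ((embedℚ (c zero) *ᴱ v zero) +ᴱ combo (c ∘ suc) (v ∘ suc))
          ≈⟨ +-homo (embedℚ (c zero) *ᴱ v zero) (combo (c ∘ suc) (v ∘ suc)) ⟩
        ⟦ τ ⟧ (embedℚ (c zero) *ᴱ v zero) +ᶜ ⟦ τ ⟧ (combo (c ∘ suc) (v ∘ suc))
          ≈⟨ ℂᵣ.+-cong (ℂᵣ.trans (*-homo (embedℚ (c zero)) (v zero))
               (ℂᵣ.trans (ℂᵣ.*-congʳ (on-ℚ (c zero))) (ℂᵣ.*-comm _ _))) (on-combo (c ∘ suc) (v ∘ suc)) ⟩
        ⟦ τ ⟧ (v zero) *ᶜ ι (c zero) +ᶜ sum (λ i → ⟦ τ ⟧ (v (suc i)) *ᶜ ι (c (suc i))) ∎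

-- Small integer values of real linear forms (Dirichlet's box principle)

module LinearForms where

  open import Defs
  open Rationals
  open Reals
  open Fields using (module ∑ℚ)
  open IntegerSpans using (funToFin-injective)
  import Algebra.Properties.Semiring.Sum as SemiringSum
  open import Data.Rational.Base
  open import Data.Rational.Solver using (module +-*-Solver)
  open ≡ using (refl; sym; trans; cong; cong₂; subst; subst₂)

  module ∑ℝ = SemiringSum (CommutativeRing.semiring ℝ-ring)

  fromℚ-sum : ∀ {n} (f : Vector ℚ n) → fromℚ (∑ℚ.sum f) ≈ʳ ∑ℝ.sum (fromℚ ∘ f)
  fromℚ-sum {zero} f = ≈-reflʳ
  fromℚ-sum {suc n} f = ≈-transʳ (pointwise λ _ → refl) (+-congʳ ≈-reflʳ (fromℚ-sum (f ∘ suc)))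

  ≺-sum : ∀ {n} (f : Vector ℝ n) {r} → 0ℚ < r → (∀ i → f i ≺ r) → ∑ℝ.sum f ≺ fromℕ′ (suc n) * r
  ≺-sum {zero} f {r} 0<r h = subst (0ʳ ≺_) (sym (ℚₚ.*-identityˡ r)) (≺-fromℚ 0<r)
  ≺-sum {suc n} f {r} 0<r h = subst (λ t → ∑ℝ.sum f ≺ t) eq (≺-+ (h zero) (≺-sum (f ∘ suc) 0<r (h ∘ suc)))
    where
    open +-*-Solver
    eq : r + fromℕ′ (suc n) * r ≡ fromℕ′ (suc (suc n)) * r
    eq = trans (solve 2 (λ r k → r :+ k :* r := (k :+ con 1ℚ) :* r) refl r (fromℕ′ (suc n)))
      (cong (λ t → t * r) (sym (fromℕ-suc (suc n))))

  ∣sum∣≤ : ∀ {n} (f : Vector ℚ n) {r} → (∀ i → ∣ f i ∣ ≤ r) → ∣ ∑ℚ.sum f ∣ ≤ fromℕ′ n * r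
  ∣sum∣≤ {zero} f {r} h = ℚₚ.≤-reflexive (sym (ℚₚ.*-zeroˡ r))
  ∣sum∣≤ {suc n} f {r} h = ℚₚ.≤-trans (ℚₚ.∣p+q∣≤∣p∣+∣q∣ (f zero) (∑ℚ.sum (f ∘ suc)))
    (ℚₚ.≤-trans (ℚₚ.+-mono-≤ (h zero) (∣sum∣≤ (f ∘ suc) (h ∘ suc))) (ℚₚ.≤-reflexive eq))
    where
    open +-*-Solver
    eq : r + fromℕ′ n * r ≡ fromℕ′ (suc n) * r
    eq = trans (solve 2 (λ r k → r :+ k :* r := (k :+ con 1ℚ) :* r) refl r (fromℕ′ n))
      (cong (λ t → t * r) (sym (fromℕ-suc n)))

  fromℕ-* : ∀ m n → fromℕ′ (m ℕ.* n) ≡ fromℕ′ m * fromℕ′ n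
  fromℕ-* m n = trans (cong fromℤ (ℤₚ.pos-* m n)) (fromℤ-* (+ m) (+ n))

  fromℕ-mono-≤ : ∀ {m n} → m ℕ.≤ n → fromℕ′ m ≤ fromℕ′ n
  fromℕ-mono-≤ {m} {n} m≤n = fromℤ-mono-≤ {+ m} {+ n} (ℤ.+≤+ m≤n)

  ^-distribʳ-* : ∀ n a b → (a ℕ.* b) ℕ.^ n ≡ a ℕ.^ n ℕ.* b ℕ.^ n
  ^-distribʳ-* zero a b = refl
  ^-distribʳ-* (suc n) a b = trans (cong (λ t → (a ℕ.* b) ℕ.* t) (^-distribʳ-* n a b))
    (ℕₚ.[m*n]*[o*p]≡[m*o]*[n*p] a b (a ℕ.^ n) (b ℕ.^ n))

  same-cell : ∀ {k s t w v} → 0ℚ < w → w * v ≡ 1ℚ → ∀ Y →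
    k ≤ (s + Y) * v → (s + Y) * v < k + 1ℚ →
    k ≤ (t + Y) * v → (t + Y) * v < k + 1ℚ → ∣ s - t ∣ ≤ w
  same-cell {k} {s} {t} {w} {v} 0<w wv≡1 Y lo hi lo′ hi′ = ∣p∣≤
    (bound s t lo′ hi) (subst (_≤ w) (solve 2 (λ s t → t :- s := :- (s :- t)) refl s t) (bound t s lo hi′))
    where
    open +-*-Solver
    bound : ∀ s t → k ≤ (t + Y) * v → (s + Y) * v < k + 1ℚ → s - t ≤ w
    bound s t lo hi = ≤-cert {t = w * (((t + Y) * v - k) + ((k + 1ℚ) - (s + Y) * v))}
      (0≤p*q (ℚₚ.<⇒≤ 0<w) (0≤p+q (p≤q⇒0≤q-p lo) (p≤q⇒0≤q-p (ℚₚ.<⇒≤ hi))))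
      (trans (solve 6 (λ s t Y v k w →
          (s :- t) :+ w :* (((t :+ Y) :* v :- k) :+ ((k :+ con 1ℚ) :- (s :+ Y) :* v))
            := (s :- t) :* (con 1ℚ :- w :* v) :+ w) refl s t Y v k w)
        (trans (cong (λ e → (s - t) * (1ℚ - e) + w) wv≡1)
          (solve 2 (λ d w → d :* con 0ℚ :+ w := w) refl (s - t) w)))

  sum-difference : ∀ {l} (g c a b : Vector ℚ l) → (∀ i → c i ≡ a i - b i) →
    ∑ℚ.sum (λ i → g i * c i) ≡ ∑ℚ.sum (λ i → g i * a i) - ∑ℚ.sum (λ i → g i * b i)
  sum-difference {zero} g c a b eq = sym (ℚₚ.+-inverseʳ 0ℚ)
  sum-difference {suc l} g c a b eq = trans
    (cong₂ _+_ (cong (λ z → g zero * z) (eq zero)) (sum-difference (g ∘ suc) (c ∘ suc) (a ∘ suc) (b ∘ suc) (eq ∘ suc)))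
    (solve 5 (λ g a b s r → g :* (a :- b) :+ (s :- r) := (g :* a :+ s) :- (g :* b :+ r)) refl
      (g zero) (a zero) (b zero) (∑ℚ.sum (λ i → g (suc i) * a (suc i))) (∑ℚ.sum (λ i → g (suc i) * b (suc i))))
    where open +-*-Solver

  rewrite-∣∣ : ∀ {s t r} → s ≡ t → ∣ t ∣ ≤ r → ∣ s ∣ ≤ r
  rewrite-∣∣ refl h = h

  module Pigeonhole (n B : ℕ) (w : ℚ) (0<w : 0ℚ < w) where

    private
      m : ℕ
      m = suc n
      v : ℚ
      v = proj₁ (inverse>0 0<w)
      0<v = proj₁ (proj₂ (inverse>0 0<w))
      wv≡1 = proj₂ (proj₂ (inverse>0 0<w))
      -- On vectors with entries below `H` the forms take values between `−mBH` and `mBH`, an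
      -- interval of `two-sided * H` cells of width `w`; the factor in front of `H` does not depend
      -- on `H`.
      two-sided : ℚ
      two-sided = (fromℕ′ m * fromℕ′ B + fromℕ′ m * fromℕ′ B) * v
      A′ A : ℕ
      A′ = proj₁ (archimedean two-sided)
      A = suc A′

    -- There are `H ^ m` integer vectors and `(A * H) ^ n` boxes with `m = n + 1`; the vectors
    -- outnumber the boxes exactly when `H` exceeds `A ^ n`.
    H : ℕ
    H = suc (A ℕ.^ n)

    private
      fewer-cells : (A ℕ.* H) ℕ.^ n ℕ.< H ℕ.^ m
      fewer-cells = subst (ℕ._< H ℕ.^ m) (sym (^-distribʳ-* n A H))
        (ℕₚ.*-monoˡ-< (H ℕ.^ n) {{ℕₚ.m^n≢0 H n}} (ℕₚ.n<1+n (A ℕ.^ n)))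

    SmallCombination : (Fin n → Fin m → ℚ) → Set
    SmallCombination G = ∃ λ (c : Vector ℤ m) → ¬ (∀ i → c i ≡ 0ℤ) ×
      (∀ i → ∣ fromℤ (c i) ∣ ≤ fromℕ′ H) × ∀ k → ∣ ∑ℚ.sum (λ i → G k i * fromℤ (c i)) ∣ ≤ w

    small-combination : (G : Fin n → Fin m → ℚ) → (∀ k i → ∣ G k i ∣ ≤ fromℕ′ B) →
      SmallCombination G
    small-combination G G≤B =
      let i₁ , i₂ , i₁<i₂ , eq = Finₚ.pigeonhole fewer-cells (λ i → funToFin (cell (finToFun i)))
      in from-collision i₁ i₂ i₁<i₂ (funToFin-injective (cell (finToFun i₁)) (cell (finToFun i₂)) eq)
      where
      open +-*-Solver
      y : (Fin m → Fin H) → Fin n → ℚ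
      y p k = ∑ℚ.sum (λ i → G k i * fromℕ′ (toℕ (p i)))
      Y : ℚ
      Y = fromℕ′ m * (fromℕ′ B * fromℕ′ H)
      toℕ≤H : ∀ (i : Fin H) → fromℕ′ (toℕ i) ≤ fromℕ′ H
      toℕ≤H i = fromℕ-mono-≤ (ℕₚ.<⇒≤ (Finₚ.toℕ<n i))
      ∣y∣≤Y : ∀ p k → ∣ y p k ∣ ≤ Y
      ∣y∣≤Y p k = ∣sum∣≤ _ λ i → subst (_≤ fromℕ′ B * fromℕ′ H)
        (trans (cong (λ t → ∣ G k i ∣ * t) (sym (ℚₚ.0≤p⇒∣p∣≡p (0≤fromℕ (toℕ (p i))))))
          (sym (ℚₚ.∣p*q∣≡∣p∣*∣q∣ (G k i) (fromℕ′ (toℕ (p i))))))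
        (*-mono-≤ (0≤fromℕ B) (0≤fromℕ (toℕ (p i))) (G≤B k i) (toℕ≤H (p i)))
      t : (Fin m → Fin H) → Fin n → ℚ
      t p k = (y p k + Y) * v
      0≤t : ∀ p k → 0ℚ ≤ t p k
      0≤t p k = 0≤p*q (subst (_≤ y p k + Y) (ℚₚ.+-inverseʳ (y p k))
        (ℚₚ.+-monoʳ-≤ (y p k) (ℚₚ.≤-trans (-p≤∣p∣ (y p k)) (∣y∣≤Y p k)))) (ℚₚ.<⇒≤ 0<v)
      t< : ∀ p k → t p k < fromℕ′ (A ℕ.* H)
      t< p k = ℚₚ.≤-<-trans
        (ℚₚ.*-monoʳ-≤-nonNeg v {{nonNegative (ℚₚ.<⇒≤ 0<v)}}
          (ℚₚ.+-monoˡ-≤ Y (ℚₚ.≤-trans (p≤∣p∣ (y p k)) (∣y∣≤Y p k))))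
        (ℚₚ.≤-<-trans (ℚₚ.≤-reflexive
            (solve 4 (λ m B H v → (m :* (B :* H) :+ m :* (B :* H)) :* v := ((m :* B :+ m :* B) :* v) :* H) refl
              (fromℕ′ m) (fromℕ′ B) (fromℕ′ H) v))
          (ℚₚ.≤-<-trans (ℚₚ.*-monoʳ-≤-nonNeg (fromℕ′ H) {{nonNegative (0≤fromℕ H)}} (proj₂ (archimedean two-sided)))
            (subst (fromℕ′ A′ * fromℕ′ H <_) (sym (fromℕ-* A H))
              (ℚₚ.*-monoˡ-<-pos (fromℕ′ H) {{positive (0<fromℕ-suc (A ℕ.^ n))}}
                (subst (fromℕ′ A′ <_) (sym (fromℕ-suc A′)) (<-cert 0<1 refl))))))
      abstract
        located : ∀ p k → ∃ λ (l : Fin (A ℕ.* H)) → fromℕ′ (toℕ l) ≤ t p k × t p k < fromℕ′ (toℕ l) + 1ℚ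
        located p k = locate (A ℕ.* H) (t p k) (0≤t p k) (t< p k)
      same-located : ∀ {a b} {l₁ l₂ : Fin (A ℕ.* H)} → l₁ ≡ l₂ →
        fromℕ′ (toℕ l₁) ≤ (a + Y) * v × (a + Y) * v < fromℕ′ (toℕ l₁) + 1ℚ →
        fromℕ′ (toℕ l₂) ≤ (b + Y) * v × (b + Y) * v < fromℕ′ (toℕ l₂) + 1ℚ → ∣ a - b ∣ ≤ w
      same-located {a} {b} {l₁} refl (lo , hi) (lo′ , hi′) =
        same-cell {fromℕ′ (toℕ l₁)} {a} {b} 0<w wv≡1 Y lo hi lo′ hi′
      cell : (Fin m → Fin H) → Fin n → Fin (A ℕ.* H)
      cell p k = proj₁ (located p k)
      from-collision : ∀ (i₁ i₂ : Fin (H ℕ.^ m)) → toℕ i₁ ℕ.< toℕ i₂ →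
        (∀ k → cell (finToFun i₁) k ≡ cell (finToFun i₂) k) → SmallCombination G
      from-collision i₁ i₂ i₁<i₂ cells≡ = c , c≢0 , c≤H , c-small
        where
        p₁ p₂ : Fin m → Fin H
        p₁ = finToFun i₁
        p₂ = finToFun i₂
        c : Vector ℤ m
        c i = + toℕ (p₁ i) ℤ.- + toℕ (p₂ i)
        fromℤ-c : ∀ i → fromℤ (c i) ≡ fromℕ′ (toℕ (p₁ i)) - fromℕ′ (toℕ (p₂ i))
        fromℤ-c i = trans (fromℤ-+ (+ toℕ (p₁ i)) (ℤ.- + toℕ (p₂ i)))
          (cong (λ z → fromℕ′ (toℕ (p₁ i)) + z) (fromℤ-neg (+ toℕ (p₂ i))))
        funToFin-cong : ∀ {a b} {f g : Fin a → Fin b} → (∀ i → f i ≡ g i) → funToFin f ≡ funToFin g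
        funToFin-cong {zero} h = refl
        funToFin-cong {suc a} h = cong₂ Data.Fin.Base.combine (h zero) (funToFin-cong (h ∘ suc))
        c≢0 : ¬ (∀ i → c i ≡ 0ℤ)
        c≢0 c≡0 = ℕₚ.<⇒≢ i₁<i₂ (cong toℕ
          (trans (sym (Finₚ.funToFin-finToFin {m} {H} i₁))
            (trans (funToFin-cong {f = p₁} {g = p₂} λ i → Finₚ.toℕ-injective (ℤₚ.+-injective (ℤₚ.i-j≡0⇒i≡j _ _ (c≡0 i))))
              (Finₚ.funToFin-finToFin {m} {H} i₂))))
        c≤H : ∀ i → ∣ fromℤ (c i) ∣ ≤ fromℕ′ H
        c≤H i = subst (λ z → ∣ z ∣ ≤ fromℕ′ H) (sym (fromℤ-c i))
          (difference (0≤fromℕ (toℕ (p₁ i))) (0≤fromℕ (toℕ (p₂ i))) (toℕ≤H (p₁ i)) (toℕ≤H (p₂ i)))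
          where
          difference : ∀ {a b h} → 0ℚ ≤ a → 0ℚ ≤ b → a ≤ h → b ≤ h → ∣ a - b ∣ ≤ h
          difference {a} {b} {h} 0≤a 0≤b a≤h b≤h = ∣p∣≤
            (≤-cert (0≤p+q (p≤q⇒0≤q-p a≤h) 0≤b) (solve 3 (λ a b h → (a :- b) :+ ((h :- a) :+ b) := h) refl a b h))
            (≤-cert (0≤p+q (p≤q⇒0≤q-p b≤h) 0≤a) (solve 3 (λ a b h → (:- (a :- b)) :+ ((h :- b) :+ a) := h) refl a b h))
        c-small : ∀ k → ∣ ∑ℚ.sum (λ i → G k i * fromℤ (c i)) ∣ ≤ w
        c-small k = rewrite-∣∣ {t = y p₁ k - y p₂ k}
          (sum-difference (G k) (λ i → fromℤ (c i)) (λ i → fromℕ′ (toℕ (p₁ i))) (λ i → fromℕ′ (toℕ (p₂ i))) fromℤ-c)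
          (same-located {y p₁ k} {y p₂ k} (cells≡ k) (proj₂ (located p₁ k)) (proj₂ (located p₂ k)))

  ≺-fromℚ⁻¹ : ∀ {q r} → fromℚ q ≺ r → ∣ q ∣ < r
  ≺-fromℚ⁻¹ (mk≺ b b<r h) = ℚₚ.≤-<-trans (proj₂ (ev-witness h)) b<r

  bounded-family : ∀ {n} (f : Vector ℝ n) → ∃ λ r → ∀ i → f i ≺ r
  bounded-family {zero} f = 0ℚ , λ ()
  bounded-family {suc n} f =
    let r , h = ≺-bounded (f zero)
        s , hs = bounded-family (f ∘ suc)
    in r ⊔ s , λ { zero → ≺-weaken (ℚₚ.p≤p⊔q r s) h ; (suc i) → ≺-weaken (ℚₚ.p≤q⊔p r s) (hs i) }

  bounded-family₂ : ∀ {m n} (f : Fin m → Vector ℝ n) → ∃ λ r → ∀ i k → f i k ≺ r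
  bounded-family₂ {zero} f = 0ℚ , λ ()
  bounded-family₂ {suc m} f =
    let r , h = bounded-family (f zero)
        s , hs = bounded-family₂ (f ∘ suc)
    in r ⊔ s , λ { zero k → ≺-weaken (ℚₚ.p≤p⊔q r s) (h k) ; (suc i) k → ≺-weaken (ℚₚ.p≤q⊔p r s) (hs i k) }

  -- The forms are approximated by rational ones to precision `η`, which must be small relative to
  -- `H`, while `H` depends on the bound `B` for the approximations. The circle is broken by taking
  -- `B` from `r + δ′`, valid for every `η ≤ δ′`. Half of `δ` pays for the pigeonhole, half for the
  -- approximation.
  linearFormsTheorem : ∀ n (F : Fin n → Fin (suc n) → ℝ) δ → 0ℚ < δ →
    ∃ λ (c : Vector ℤ (suc n)) → ¬ (∀ i → c i ≡ 0ℤ) ×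
      ∀ k → ∑ℝ.sum (λ i → F k i *ʳ fromℚ (fromℤ (c i))) ≺ δ
  linearFormsTheorem n F δ 0<δ = c , c≢0 , small
    where
    h₁ = half 0<δ
    δ′ = proj₁ h₁
    0<δ′ = proj₁ (proj₂ h₁)
    h₂ = half 0<δ′
    w = proj₁ h₂
    0<w = proj₁ (proj₂ h₂)
    w<δ′ : w < δ′
    w<δ′ = <-cert 0<w (proj₂ (proj₂ h₂))
    r = proj₁ (bounded-family₂ F)
    B = proj₁ (archimedean (r + δ′))
    open Pigeonhole n B w 0<w
    -- Returning from `G` to `F` costs at most `L * η`: the first factor comes from `≺-sum`, the
    -- second bounds the coefficients.
    L = fromℕ′ (suc (suc n)) * fromℕ′ (suc H)
    1≤L : 1ℚ ≤ L
    1≤L = subst (1ℚ ≤_) (fromℕ-* (suc (suc n)) (suc H)) (fromℕ-mono-≤ {1} {suc (suc n) ℕ.* suc H} (ℕ.s≤s ℕ.z≤n))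
    0<L : 0ℚ < L
    0<L = ℚₚ.<-≤-trans 0<1 1≤L
    h₃ = divide 0<L 0<δ′
    η = proj₁ h₃
    0<η = proj₁ (proj₂ h₃)
    η≤δ′ : η ≤ δ′
    η≤δ′ = subst₂ _≤_ (ℚₚ.*-identityˡ η) (proj₂ (proj₂ h₃))
      (ℚₚ.*-monoʳ-≤-nonNeg η {{nonNegative (ℚₚ.<⇒≤ 0<η)}} 1≤L)
    G : Fin n → Fin (suc n) → ℚ
    G k i = proj₁ (approximate (F k i) η 0<η)
    F-G : ∀ k i → F k i -ʳ fromℚ (G k i) ≺ η
    F-G k i = proj₂ (approximate (F k i) η 0<η)
    G≤B : ∀ k i → ∣ G k i ∣ ≤ fromℕ′ B
    G≤B k i = ℚₚ.≤-trans (ℚₚ.<⇒≤ (≺-fromℚ⁻¹ (≺-weaken (ℚₚ.+-monoʳ-≤ r η≤δ′)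
        (≺-pointwise (λ j → identity (seq (F k i) j) (G k i))
          (≺-+ (proj₂ (bounded-family₂ F) k i) (≺-neg (F-G k i)))))))
      (proj₂ (archimedean (r + δ′)))
      where
      open +-*-Solver
      identity : ∀ a b → a + (- (a + (- b))) ≡ b
      identity = solve 2 (λ a b → a :+ (:- (a :+ (:- b))) := b) refl
    sol = small-combination G G≤B
    c = proj₁ sol
    c≢0 = proj₁ (proj₂ sol)
    cℝ : Fin (suc n) → ℝ
    cℝ i = fromℚ (fromℤ (c i))
    c≺ : ∀ i → cℝ i ≺ fromℕ′ (suc H)
    c≺ i = ≺-fromℚ (ℚₚ.≤-<-trans (proj₁ (proj₂ (proj₂ sol)) i)
      (subst (fromℕ′ H <_) (sym (fromℕ-suc H)) (<-cert 0<1 refl)))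
    main : ∀ k → fromℚ (∑ℚ.sum (λ i → G k i * fromℤ (c i))) ≺ δ′
    main k = ≺-fromℚ (ℚₚ.≤-<-trans (proj₂ (proj₂ (proj₂ sol)) k) w<δ′)
    error : ∀ k → ∑ℝ.sum (λ i → (F k i -ʳ fromℚ (G k i)) *ʳ cℝ i) ≺ δ′
    error k = subst (λ z → ∑ℝ.sum (λ i → (F k i -ʳ fromℚ (G k i)) *ʳ cℝ i) ≺ z)
      (trans (solve 3 (λ N η H → N :* (η :* H) := N :* H :* η) refl (fromℕ′ (suc (suc n))) η (fromℕ′ (suc H))) (proj₂ (proj₂ h₃)))
      (≺-sum _ (0<p*q 0<η (0<fromℕ-suc H)) (λ i → ≺-* (F-G k i) (c≺ i)))
      where open +-*-Solver
    split : ∀ k → fromℚ (∑ℚ.sum (λ i → G k i * fromℤ (c i))) +ʳ ∑ℝ.sum (λ i → (F k i -ʳ fromℚ (G k i)) *ʳ cℝ i)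
      ≈ʳ ∑ℝ.sum (λ i → F k i *ʳ cℝ i)
    split k = ≈-transʳ (+-congʳ (fromℚ-sum (λ i → G k i * fromℤ (c i))) ≈-reflʳ)
      (≈-transʳ (≈-symʳ (∑ℝ.∑-distrib-+ (λ i → fromℚ (G k i * fromℤ (c i))) (λ i → (F k i -ʳ fromℚ (G k i)) *ʳ cℝ i)))
        (∑ℝ.sum-cong-≋ (λ i → pointwise {fromℚ (G k i * fromℤ (c i)) +ʳ (F k i -ʳ fromℚ (G k i)) *ʳ cℝ i} {F k i *ʳ cℝ i}
          λ j → identity (G k i) (fromℤ (c i)) (seq (F k i) j))))
      where
      open +-*-Solver
      identity : ∀ g c f → g * c + (f + (- g)) * c ≡ f * c
      identity = solve 3 (λ g c f → g :* c :+ (f :+ (:- g)) :* c := f :* c) refl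
    small : ∀ k → ∑ℝ.sum (λ i → F k i *ʳ cℝ i) ≺ δ
    small k = ≺-resp (split k) (subst (λ z → fromℚ (∑ℚ.sum (λ i → G k i * fromℤ (c i))) +ʳ ∑ℝ.sum (λ i → (F k i -ʳ fromℚ (G k i)) *ʳ cℝ i) ≺ z)
      (proj₂ (proj₂ h₁)) (≺-+ (main k) (error k)))

-- Explicit estimates: discs, shrinking, rounding, reality

module Estimates where

  open import Defs
  open Rationals
  open Reals
  open ComplexField
  open Fields using (module FieldProperties)
  open import Data.Rational.Base
  open import Data.Rational.Solver using (module +-*-Solver)
  open ≡ using (refl; sym; trans; cong; subst; subst₂)
  open +-*-Solver
  open FieldProperties ℂ-field using (sum)

  infix 4 _≺ᶜ_
  -- The sup norm on components instead of the modulus: it needs no square roots, and a product only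
  -- costs a factor 2.
  record _≺ᶜ_ (z : ℂ) (r : ℚ) : Set where
    constructor mk≺ᶜ
    field
      re≺ : re z ≺ r
      im≺ : im z ≺ r

  ≺ᶜ-resp : ∀ {z w r} → z ≈ᶜ w → z ≺ᶜ r → w ≺ᶜ r
  ≺ᶜ-resp (mk≈ᶜ r i) (mk≺ᶜ p q) = mk≺ᶜ (≺-resp r p) (≺-resp i q)

  ≺ᶜ-* : ∀ {z w r s} → z ≺ᶜ r → w ≺ᶜ s → z *ᶜ w ≺ᶜ r * s + r * s
  ≺ᶜ-* (mk≺ᶜ a b) (mk≺ᶜ c d) = mk≺ᶜ (≺-+ (≺-* a c) (≺-neg (≺-* b d))) (≺-+ (≺-* a d) (≺-* b c))

  ≺ᶜ-+ : ∀ {z w r s} → z ≺ᶜ r → w ≺ᶜ s → z +ᶜ w ≺ᶜ r + s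
  ≺ᶜ-+ (mk≺ᶜ a b) (mk≺ᶜ c d) = mk≺ᶜ (≺-+ a c) (≺-+ b d)

  ≺ᶜ-fromℝ : ∀ {x r} → x ≺ r → fromℝ x ≺ᶜ r
  ≺ᶜ-fromℝ {x} h = mk≺ᶜ h (≺-fromℚ (≺-0< h))

  ≺ᶜ-sum : ∀ {n} (f : Vector ℂ n) {r} → 0ℚ < r → (∀ i → f i ≺ᶜ r) → sum f ≺ᶜ fromℕ′ (suc n) * r
  ≺ᶜ-sum {zero} f {r} 0<r h = subst (0ᶜ ≺ᶜ_) (sym (ℚₚ.*-identityˡ r)) (≺ᶜ-fromℝ (≺-fromℚ 0<r))
  ≺ᶜ-sum {suc n} f {r} 0<r h = subst (λ t → sum f ≺ᶜ t) eq (≺ᶜ-+ (h zero) (≺ᶜ-sum (f ∘ suc) 0<r (h ∘ suc)))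
    where
    eq : r + fromℕ′ (suc n) * r ≡ fromℕ′ (suc (suc n)) * r
    eq = trans (solve 2 (λ r k → r :+ k :* r := (k :+ con 1ℚ) :* r) refl r (fromℕ′ (suc n)))
      (cong (λ t → t * r) (sym (fromℕ-suc (suc n))))

  ≺ᶜ-bounded : ∀ z → ∃ λ r → z ≺ᶜ r
  ≺ᶜ-bounded z =
    let r , h = ≺-bounded (re z)
        s , k = ≺-bounded (im z)
    in r ⊔ s , mk≺ᶜ (≺-weaken (ℚₚ.p≤p⊔q r s) h) (≺-weaken (ℚₚ.p≤q⊔p r s) k)

  record Below (x : ℝ) (r : ℚ) : Set where
    constructor below
    field
      bound  : ℚ
      bound< : bound < r
      holds  : Ev λ n → seq x n ≤ bound

  near : ∀ {x y} → x ≈ʳ y → ∀ ε → 0ℚ < ε → Ev λ n → seq y n ≤ seq x n + ε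
  near {x} {y} (mk≈ c) ε 0<ε = ev-map (λ n ∣x-y∣<ε →
    ≤-cert (0≤p+q (p≤q⇒0≤q-p (-p≤∣p∣ (seq x n - seq y n))) (p≤q⇒0≤q-p (ℚₚ.<⇒≤ ∣x-y∣<ε)))
      (solve 4 (λ x y a e → y :+ ((a :- (:- (x :- y))) :+ (e :- a)) := x :+ e) refl
        (seq x n) (seq y n) (∣ seq x n - seq y n ∣) ε)) (c ε 0<ε)

  Below-resp : ∀ {x y r} → x ≈ʳ y → Below x r → Below y r
  Below-resp {x} {y} {r} x≈y (below b b<r h) =
    let δ , 0<δ , eq = half (p<q⇒0<q-p b<r)
    in below (b + δ) (<-cert 0<δ (trans (ℚₚ.+-assoc b δ δ) (trans (cong (λ t → b + t) eq) (p+[q-p]≡q b r))))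
      (ev-zip (λ n p q → ℚₚ.≤-trans q (ℚₚ.+-monoˡ-≤ δ p)) h (near x≈y δ 0<δ))

  Below⇒< : ∀ {x} → Below x 1ℚ → x <ʳ 1ʳ
  Below⇒< {x} (below b b<1 (N , h)) = mk< (1ℚ - b) (p<q⇒0<q-p b<1) (N , λ n N≤n →
    ≤-cert (p≤q⇒0≤q-p (h n N≤n)) (solve 2 (λ x b → (x :+ (con 1ℚ :- b)) :+ (b :- x) := con 1ℚ) refl (seq x n) b))

  <⇒Below : ∀ {x} → x <ʳ 1ʳ → Below x 1ℚ
  <⇒Below {x} (mk< g 0<g h) = below (1ℚ - g) (<-cert 0<g (solve 1 (λ g → (con 1ℚ :- g) :+ g := con 1ℚ) refl g))
    (ev-map (λ n x+g≤1 → ≤-cert (p≤q⇒0≤q-p x+g≤1) (solve 2 (λ x g → x :+ (con 1ℚ :- (x :+ g)) := con 1ℚ :- g) refl (seq x n) g)) h)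

  -- A term known to within half of `q − p`, compared with the midpoint, settles the alternative.
  located : ∀ x p q → p < q → (Ev λ n → seq x n ≤ q) ⊎ (Ev λ n → p ≤ seq x n)
  located x p q p<q =
    let δ , 0<δ , eq = half (p<q⇒0<q-p p<q)
        N , h = cauchy x δ 0<δ
    in decide δ N eq h (seq x N ℚₚ.≤? p + δ)
    where
    decide : ∀ δ N → δ + δ ≡ q - p → (∀ m n → N ℕ.≤ m → N ℕ.≤ n → ∣ seq x m - seq x n ∣ < δ) →
      Dec (seq x N ≤ p + δ) → (Ev λ n → seq x n ≤ q) ⊎ (Ev λ n → p ≤ seq x n)
    decide δ N eq h (yes low) = inj₁ (N , λ n N≤n →
      ≤-cert (0≤p+q (0≤p+q (p≤q⇒0≤q-p low) (p≤q⇒0≤q-p (ℚₚ.<⇒≤ (h n N N≤n ℕₚ.≤-refl))))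
          (p≤q⇒0≤q-p (p≤∣p∣ (seq x n - seq x N))))
        (trans (solve 5 (λ x y p d a → x :+ (((p :+ d) :- y) :+ (d :- a) :+ (a :- (x :- y))) := p :+ (d :+ d)) refl
            (seq x n) (seq x N) p δ (∣ seq x n - seq x N ∣))
          (trans (cong (λ t → p + t) eq) (p+[q-p]≡q p q))))
    decide δ N eq h (no high) = inj₂ (N , λ n N≤n →
      ≤-cert (0≤p+q (0≤p+q (p≤q⇒0≤q-p (ℚₚ.<⇒≤ (ℚₚ.≰⇒> high))) (p≤q⇒0≤q-p (ℚₚ.<⇒≤ (h N n ℕₚ.≤-refl N≤n))))
          (p≤q⇒0≤q-p (p≤∣p∣ (seq x N - seq x n))))
        (solve 5 (λ x y p d a → p :+ ((y :- (p :+ d)) :+ (d :- a) :+ (a :- (y :- x))) := x) refl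
            (seq x n) (seq x N) p δ (∣ seq x N - seq x n ∣)))

  located-Below : ∀ x p q → p < q → Below x q ⊎ ¬ Below x p
  located-Below x p q p<q =
    let δ , 0<δ , eq = half (p<q⇒0<q-p p<q) in decide δ 0<δ eq (located x p (p + δ) (<-cert 0<δ refl))
    where
    decide : ∀ δ → 0ℚ < δ → δ + δ ≡ q - p →
      (Ev λ n → seq x n ≤ p + δ) ⊎ (Ev λ n → p ≤ seq x n) → Below x q ⊎ ¬ Below x p
    decide δ 0<δ eq (inj₁ h) = inj₁ (below (p + δ)
      (<-cert 0<δ (trans (ℚₚ.+-assoc p δ δ) (trans (cong (λ t → p + t) eq) (p+[q-p]≡q p q)))) h)
    decide δ 0<δ eq (inj₂ h) = inj₂ λ (below b b<p k) →
      let _ , p≤b = ev-witness (ev-zip (λ n → ℚₚ.≤-trans) h k)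
      in ℚₚ.<-irrefl refl (ℚₚ.<-≤-trans b<p p≤b)

  ≯1⇒≤1+κ : ∀ {x} → x ≤ʳ 1ʳ → ∀ κ → 0ℚ < κ → Ev λ n → seq x n ≤ 1ℚ + κ
  ≯1⇒≤1+κ {x} x≯1 κ 0<κ = let δ , 0<δ , eq = half 0<κ in
    decide δ 0<δ (located x (1ℚ + δ) (1ℚ + κ) (ℚₚ.+-monoʳ-< 1ℚ {δ} {κ} (<-cert 0<δ eq)))
    where
    decide : ∀ δ → 0ℚ < δ → (Ev λ n → seq x n ≤ 1ℚ + κ) ⊎ (Ev λ n → 1ℚ + δ ≤ seq x n) →
      Ev λ n → seq x n ≤ 1ℚ + κ
    decide δ 0<δ (inj₁ h) = h
    decide δ 0<δ (inj₂ h) = ⊥-elim (x≯1 (mk< δ 0<δ h))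

  -- Positive form of `normSq z ≤ʳ 1ʳ`, which is itself a negation: every margin `κ` comes with a
  -- bound on a tail.
  InDisc : ℂ → Set
  InDisc z = ∀ κ → 0ℚ < κ → Ev λ n → seq (normSq z) n ≤ 1ℚ + κ

  InDisc-real : ∀ {x} → -ʳ 1ʳ ≤ʳ x → x ≤ʳ 1ʳ → InDisc (fromℝ x)
  InDisc-real {x} -1≤x x≤1 κ 0<κ = ev-zip (λ n x≤ -x≤ → bound (seq x n) x≤ -x≤)
      (≯1⇒≤1+κ x≤1 κ′ 0<κ′) (≯1⇒≤1+κ { -ʳ x} -x≤1 κ′ 0<κ′)
    where
    κ₁ κ′ : ℚ
    -- Since `κ₁ ≤ 1`, the square of `1 + κ₁/4` is at most `1 + κ₁`.
    κ₁ = κ ⊓ 1ℚ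
    κ′ = ½ * (½ * κ₁)
    0<κ₁ : 0ℚ < κ₁
    0<κ₁ = ⊓-pos (ℚₚ.⊓-sel κ 1ℚ)
      where
      ⊓-pos : κ₁ ≡ κ ⊎ κ₁ ≡ 1ℚ → 0ℚ < κ₁
      ⊓-pos (inj₁ eq) = subst (0ℚ <_) (sym eq) 0<κ
      ⊓-pos (inj₂ eq) = subst (0ℚ <_) (sym eq) 0<1
    0<κ′ : 0ℚ < κ′
    0<κ′ = 0<p*q 0<½ (0<p*q 0<½ 0<κ₁)
    -x≤1 : -ʳ x ≤ʳ 1ʳ
    -x≤1 (mk< g 0<g h) = -1≤x (mk< g 0<g (ev-map (λ n 1+g≤-x →
      ≤-cert (p≤q⇒0≤q-p 1+g≤-x) (solve 2 (λ x g → (x :+ g) :+ ((:- x) :- (con 1ℚ :+ g)) := :- con 1ℚ) refl (seq x n) g)) h))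
    bound : ∀ y → y ≤ 1ℚ + κ′ → - y ≤ 1ℚ + κ′ → y * y + 0ℚ * 0ℚ ≤ 1ℚ + κ
    bound y y≤ -y≤ = ≤-cert
      (0≤p+q (0≤p+q (p≤q⇒0≤q-p (p*p≤ {y} (∣p∣≤ y≤ -y≤)))
          (0≤p+q (0≤p*q (ℚₚ.<⇒≤ 0<κ′) (p≤q⇒0≤q-p (ℚₚ.p⊓q≤q κ 1ℚ)))
            (0≤p+q (ℚₚ.<⇒≤ 0<κ′) (0≤p+q (0≤p*p κ′) (0≤p+q (0≤p*p κ′) (0≤p*p κ′))))))
        (p≤q⇒0≤q-p (ℚₚ.p⊓q≤p κ 1ℚ)))
      (solve 3 (λ y κ κ₁ → let k = con ½ :* (con ½ :* κ₁) in
        (y :* y :+ con 0ℚ :* con 0ℚ) :+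
          ((((con 1ℚ :+ k) :* (con 1ℚ :+ k) :- y :* y)
            :+ (k :* (con 1ℚ :- κ₁) :+ (k :+ (k :* k :+ (k :* k :+ k :* k))))) :+ (κ :- κ₁))
        := con 1ℚ :+ κ) refl y κ κ₁)

  component≤2 : ∀ a b → a * a + b * b ≤ 1ℚ + 1ℚ → ∣ a ∣ ≤ 1ℚ + 1ℚ
  component≤2 a b h = ℚₚ.≮⇒≥ λ 2<∣a∣ → ℚₚ.<-irrefl refl (begin-strict
    1ℚ + 1ℚ                           ≤⟨ ≤-cert {1ℚ + 1ℚ} {(1ℚ + 1ℚ) * (1ℚ + 1ℚ)} (0≤p+q {1ℚ} {1ℚ} 0≤1 0≤1) refl ⟩
    (1ℚ + 1ℚ) * (1ℚ + 1ℚ)         <⟨ ℚₚ.*-monoʳ-<-pos (1ℚ + 1ℚ) 2<∣a∣ ⟩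
    (1ℚ + 1ℚ) * ∣ a ∣               ≤⟨ ℚₚ.*-monoʳ-≤-nonNeg (∣ a ∣) {{ℚₚ.∣-∣-nonNeg a}} (ℚₚ.<⇒≤ 2<∣a∣) ⟩
    ∣ a ∣ * ∣ a ∣                     ≡⟨ trans (sym (ℚₚ.∣p*q∣≡∣p∣*∣q∣ a a)) (ℚₚ.0≤p⇒∣p∣≡p (0≤p*p a)) ⟩
    a * a                             ≤⟨ ≤-cert (0≤p*p b) refl ⟩
    a * a + b * b                 ≤⟨ h ⟩
    1ℚ + 1ℚ                           ∎)
    where open ℚₚ.≤-Reasoning

  -- Shrinking the target by 1 − η leaves room for errors up to η²/4 inside the open disc.
  module Shrink (η : ℚ) (0<η : 0ℚ < η) (η≤1 : η ≤ 1ℚ) where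

    f e : ℚ
    f = ½ * (½ * η)
    e = η * f

    0<f : 0ℚ < f
    0<f = 0<p*q 0<½ (0<p*q 0<½ 0<η)

    0<e : 0ℚ < e
    0<e = 0<p*q 0<η 0<f

    e≤η : e ≤ η
    e≤η = ≤-cert (0≤p+q (0≤p*q (0≤p*q (ℚₚ.<⇒≤ 0<½) (ℚₚ.<⇒≤ (0<p*q 0<½ 0<η))) (p≤q⇒0≤q-p η≤1))
        (0≤p+q (ℚₚ.<⇒≤ 0<f) (ℚₚ.<⇒≤ (0<p*q 0<½ 0<η))))
      (solve 1 (λ η → η :* (con ½ :* (con ½ :* η)) :+ ((con ½ :* (con ½ :* η)) :* (con 1ℚ :- η)
        :+ ((con ½ :* (con ½ :* η)) :+ con ½ :* η)) := η) refl η)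

    shrink : ℂ → ℂ
    shrink q = ι (1ℚ - η) *ᶜ q

    private
      -- The cross term is at most `2∣a∣e = 2η∣a∣f`, and `η(∣a∣ − f)² ≥ 0` bounds this by
      -- `ηa² + ef`. The error thus becomes a relative factor `1 + η` and a small constant.
      square : ∀ a c → ∣ c ∣ ≤ e → (a + c) * (a + c) ≤
        (1ℚ + η) * (a * a) + (e * f + e * e)
      square a c ∣c∣≤e = ≤-cert
        (0≤p+q (0≤p+q (p≤q⇒0≤q-p (p*p≤ ∣c∣≤e)) (0≤p*q (ℚₚ.<⇒≤ 0<η) (0≤p*p (∣ a ∣ - f))))
          (0≤p+q (p≤q⇒0≤q-p ac≤) (p≤q⇒0≤q-p ac≤)))
        (trans (cong (λ t → (a + c) * (a + c) + ((e * e - c * c) + t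
            + ((∣ a ∣ * e - a * c) + (∣ a ∣ * e - a * c)))) expand)
          (solve 5 (λ a c η f A → (a :+ c) :* (a :+ c) :+ (((η :* f) :* (η :* f) :- c :* c)
              :+ (η :* (a :* a) :- (A :* (η :* f) :+ A :* (η :* f)) :+ (η :* f) :* f)
              :+ ((A :* (η :* f) :- a :* c) :+ (A :* (η :* f) :- a :* c)))
            := (con 1ℚ :+ η) :* (a :* a) :+ ((η :* f) :* f :+ (η :* f) :* (η :* f))) refl a c η f (∣ a ∣)))
        where
        ac≤ : a * c ≤ ∣ a ∣ * e
        ac≤ = ℚₚ.≤-trans (p≤∣p∣ (a * c)) (subst (_≤ ∣ a ∣ * e) (sym (ℚₚ.∣p*q∣≡∣p∣*∣q∣ a c))
          (*-monoˡ-≤′ (ℚₚ.0≤∣p∣ a) ∣c∣≤e))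
        ∣a∣² : ∣ a ∣ * ∣ a ∣ ≡ a * a
        ∣a∣² = trans (sym (ℚₚ.∣p*q∣≡∣p∣*∣q∣ a a)) (ℚₚ.0≤p⇒∣p∣≡p (0≤p*p a))
        expand : η * ((∣ a ∣ - f) * (∣ a ∣ - f)) ≡
          η * (a * a) - (∣ a ∣ * e + ∣ a ∣ * e) + e * f
        expand = trans (solve 3 (λ A η f → η :* ((A :- f) :* (A :- f)) :=
            η :* (A :* A) :- (A :* (η :* f) :+ A :* (η :* f)) :+ (η :* f) :* f) refl (∣ a ∣) η f)
          (cong (λ t → η * t - (∣ a ∣ * e + ∣ a ∣ * e) + e * f) ∣a∣²)

      triangle : ∀ x a → ∣ a ∣ ≤ 1ℚ + 1ℚ → ∣ x - (a + - (η * a)) ∣ ≤ e →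
        ∣ x - a ∣ ≤ η + (η + η)
      triangle x a a≤2 h = ℚₚ.≤-trans (ℚₚ.≤-trans (ℚₚ.≤-reflexive (cong ∣_∣
          (solve 3 (λ x a t → x :- a := (x :- (a :+ t)) :+ t) refl x a t))) (ℚₚ.∣p+q∣≤∣p∣+∣q∣ (x - (a + t)) t))
        (ℚₚ.+-mono-≤ (ℚₚ.≤-trans h e≤η) (ℚₚ.≤-trans (ℚₚ.≤-reflexive (trans (ℚₚ.∣-p∣≡∣p∣ (η * a))
            (trans (ℚₚ.∣p*q∣≡∣p∣*∣q∣ η a) (cong (λ u → u * ∣ a ∣) (ℚₚ.0≤p⇒∣p∣≡p (ℚₚ.<⇒≤ 0<η))))))
          (ℚₚ.≤-trans (*-monoˡ-≤′ (ℚₚ.<⇒≤ 0<η) a≤2)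
            (ℚₚ.≤-reflexive (solve 1 (λ η → η :* (con 1ℚ :+ con 1ℚ) := η :+ η) refl η)))))
        where
        t : ℚ
        t = - (η * a)

      expand-re : ∀ x a b → x + - ((1ℚ - η) * a + - (0ℚ * b)) ≡ x - (a + - (η * a))
      expand-re x a b = solve 4 (λ x a b η → x :+ (:- ((con 1ℚ :- η) :* a :+ (:- (con 0ℚ :* b))))
        := x :- (a :+ (:- (η :* a)))) refl x a b η

      expand-im : ∀ x a b → x + - ((1ℚ - η) * a + 0ℚ * b) ≡ x - (a + - (η * a))
      expand-im x a b = solve 4 (λ x a b η → x :+ (:- ((con 1ℚ :- η) :* a :+ con 0ℚ :* b))
        := x :- (a :+ (:- (η :* a)))) refl x a b η

      -- The main term is at most `(1 − η²)² ≤ 1 − η²`, and the error terms contribute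
      -- `(η³ + η⁴)/8 ≤ η²/4`.
      final : ∀ r → r ≤ 1ℚ + η →
        (1ℚ + η) * (((1ℚ - η) * (1ℚ - η)) * r) + ((e * f + e * e) + (e * f + e * e))
          ≤ 1ℚ - ½ * (η * η)
      final r r≤ = ≤-cert
        (0≤p+q (0≤p*q (0≤p*q (ℚₚ.<⇒≤ (0<p+q 0<1 0≤η)) (0≤p*p (1ℚ - η))) (p≤q⇒0≤q-p r≤))
          (0≤p+q (0≤p*q 0≤1-η (0≤p*q (0≤p*p η) (0≤p+q {1ℚ} {η} 0≤1 0≤η)))
            (0≤p+q
              (0≤p*q (0≤p*q {½ * (½ * ½)} (0≤p*q {½} {½ * ½} (ℚₚ.<⇒≤ 0<½) (0≤p*q {½} {½} (ℚₚ.<⇒≤ 0<½) (ℚₚ.<⇒≤ 0<½))) (0≤p*p η))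
                (0≤p+q 0≤1-η (0≤p*q 0≤1-η (0≤p+q {1ℚ} {η} 0≤1 0≤η))))
              (0≤p*q {½ * ½} (0≤p*q {½} {½} (ℚₚ.<⇒≤ 0<½) (ℚₚ.<⇒≤ 0<½)) (0≤p*p η)))))
        (solve 2 (λ η r → let f = con ½ :* (con ½ :* η) ; e = η :* f ; o = con 1ℚ ; h = con ½ in
          ((o :+ η) :* (((o :- η) :* (o :- η)) :* r) :+ ((e :* f :+ e :* e) :+ (e :* f :+ e :* e)))
          :+ (((o :+ η) :* ((o :- η) :* (o :- η)) :* ((o :+ η) :- r))
            :+ ((o :- η) :* ((η :* η) :* (o :+ η))
              :+ (((h :* (h :* h)) :* (η :* η)) :* ((o :- η) :+ (o :- η) :* (o :+ η))
                :+ (h :* h) :* (η :* η))))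
          := o :- h :* (η :* η)) refl η r)
        where
        0≤η = ℚₚ.<⇒≤ 0<η
        0≤1-η = p≤q⇒0≤q-p η≤1

    shrink-Below : ∀ {q z} → InDisc q → z -ᶜ shrink q ≺ᶜ e → Below (normSq z) 1ℚ
    shrink-Below {q} {z} q∈D (mk≺ᶜ (mk≺ r r<e h) (mk≺ r′ r′<e h′)) = below (1ℚ - ½ * (η * η))
      (<-cert (0<p*q 0<½ (0<p*q 0<η 0<η)) (solve 1 (λ t → (con 1ℚ :- t) :+ t := con 1ℚ) refl (½ * (η * η))))
      (ev-zip (λ n q≤ d≤ → bound n q≤ (proj₁ d≤) (proj₂ d≤)) (q∈D η 0<η)
        (ev-zip (λ n p q → ℚₚ.≤-trans p (ℚₚ.<⇒≤ r<e) , ℚₚ.≤-trans q (ℚₚ.<⇒≤ r′<e)) h h′))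
      where
      bound : ∀ n → seq (normSq q) n ≤ 1ℚ + η → ∣ seq (re (z -ᶜ shrink q)) n ∣ ≤ e →
        ∣ seq (im (z -ᶜ shrink q)) n ∣ ≤ e → seq (normSq z) n ≤ 1ℚ - ½ * (η * η)
      bound n q≤ c≤ d≤ = ℚₚ.≤-trans (subst₂ _≤_
          (solve 6 (λ x y a b g o → let a′ = g :* a :- o :* b ; b′ = g :* b :+ o :* a in
              (a′ :+ (x :- a′)) :* (a′ :+ (x :- a′)) :+ (b′ :+ (y :- b′)) :* (b′ :+ (y :- b′)) := x :* x :+ y :* y)
            refl x y a b g 0ℚ)
          (solve 4 (λ η a b t → let g = con 1ℚ :- η ; o = con 0ℚ ; a′ = g :* a :- o :* b ; b′ = g :* b :+ o :* a in
              ((con 1ℚ :+ η) :* (a′ :* a′) :+ t) :+ ((con 1ℚ :+ η) :* (b′ :* b′) :+ t)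
                := (con 1ℚ :+ η) :* ((g :* g) :* (a :* a :+ b :* b)) :+ (t :+ t)) refl η a b (e * f + e * e))
          (ℚₚ.+-mono-≤ (square a′ _ c≤) (square b′ _ d≤)))
        (final (seq (normSq q) n) q≤)
        where
        x y a b g a′ b′ : ℚ
        x = seq (re z) n
        y = seq (im z) n
        a = seq (re q) n
        b = seq (im q) n
        g = 1ℚ - η
        a′ = g * a - 0ℚ * b
        b′ = g * b + 0ℚ * a

    shrink-close : ∀ {q z} → InDisc q → z -ᶜ shrink q ≺ᶜ e →
      Ev λ n → ∣ seq (re z) n - seq (re q) n ∣ ≤ η + (η + η) × ∣ seq (im z) n - seq (im q) n ∣ ≤ η + (η + η)
    shrink-close {q} {z} q∈D (mk≺ᶜ (mk≺ r r<e h) (mk≺ r′ r′<e h′)) =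
      ev-zip both (q∈D 1ℚ 0<1) errors
      where
      errors : Ev λ n → ∣ seq (re (z -ᶜ shrink q)) n ∣ ≤ e × ∣ seq (im (z -ᶜ shrink q)) n ∣ ≤ e
      errors = ev-zip (λ n p q → ℚₚ.≤-trans p (ℚₚ.<⇒≤ r<e) , ℚₚ.≤-trans q (ℚₚ.<⇒≤ r′<e)) h h′
      bound-re : ∀ n → seq (normSq q) n ≤ 1ℚ + 1ℚ → ∣ seq (re (z -ᶜ shrink q)) n ∣ ≤ e →
        ∣ seq (re z) n - seq (re q) n ∣ ≤ η + (η + η)
      bound-re n q≤ h = triangle (seq (re z) n) (seq (re q) n)
        (component≤2 (seq (re q) n) (seq (im q) n) q≤)
        (subst (λ t → ∣ t ∣ ≤ e) (expand-re (seq (re z) n) (seq (re q) n) (seq (im q) n)) h)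
      bound-im : ∀ n → seq (normSq q) n ≤ 1ℚ + 1ℚ → ∣ seq (im (z -ᶜ shrink q)) n ∣ ≤ e →
        ∣ seq (im z) n - seq (im q) n ∣ ≤ η + (η + η)
      bound-im n q≤ h = triangle (seq (im z) n) (seq (im q) n)
        (component≤2 (seq (im q) n) (seq (re q) n) (subst (_≤ 1ℚ + 1ℚ) (ℚₚ.+-comm (seq (re q) n * seq (re q) n) (seq (im q) n * seq (im q) n)) q≤))
        (subst (λ t → ∣ t ∣ ≤ e) (expand-im (seq (im z) n) (seq (im q) n) (seq (re q) n)) h)

      both : ∀ n → seq (normSq q) n ≤ 1ℚ + 1ℚ →
        ∣ seq (re (z -ᶜ shrink q)) n ∣ ≤ e × ∣ seq (im (z -ᶜ shrink q)) n ∣ ≤ e →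
        ∣ seq (re z) n - seq (re q) n ∣ ≤ η + (η + η) × ∣ seq (im z) n - seq (im q) n ∣ ≤ η + (η + η)
      both n q≤ (p , p′) = bound-re n q≤ p , bound-im n q≤ p′

    module Tolerance (ε : ℝ) (h : Ev λ n → (η + η) + ((η + η) + (η + η)) ≤ seq ε n) where

      real-within : ∀ {q z} → InDisc (fromℝ q) → z -ᶜ shrink (fromℝ q) ≺ᶜ e → absʳ (re z -ʳ q) <ʳ ε
      real-within {q} {z} q∈D close = mk< η 0<η (ev-zip (λ n (p , _) 6η≤ε →
        ≤-cert (0≤p+q (0≤p+q (p≤q⇒0≤q-p p) (p≤q⇒0≤q-p 6η≤ε)) (0≤p+q (ℚₚ.<⇒≤ 0<η) (ℚₚ.<⇒≤ 0<η)))
          (solve 3 (λ a η ε → (a :+ η) :+ (((η :+ (η :+ η)) :- a) :+ (ε :- ((η :+ η) :+ ((η :+ η) :+ (η :+ η)))) :+ (η :+ η)) := ε)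
            refl (∣ seq (re z) n - seq q n ∣) η (seq ε n)))
        (shrink-close {fromℝ q} {z} q∈D close) h)

      -- Each component is off by at most `3η`, namely `e ≤ η` from the approximation and `2η` from
      -- the shrinking. So the squared distance is at most `18η²`, against `36η² ≤ ε²`; the gap
      -- takes one `η²`, and 17 remain.
      complex-within : ∀ {q z} → InDisc q → z -ᶜ shrink q ≺ᶜ e → normSq (z -ᶜ q) <ʳ ε *ʳ ε
      complex-within {q} {z} q∈D close = mk< (η * η) (0<p*q 0<η 0<η) (ev-zip (λ n (p , p′) 6η≤ε →
        ℚₚ.≤-trans (≤-cert
            (0≤p+q (0≤p+q (p≤q⇒0≤q-p (p*p≤ p)) (p≤q⇒0≤q-p (p*p≤ p′))) (0≤p*q 0≤17 (0≤p*p η)))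
            (solve 3 (λ a b η → let t = η :+ (η :+ η) ; c = con 1ℚ :+ con 1ℚ ; k = c :* (c :* (c :* c)) :+ con 1ℚ in
              (a :* a :+ b :* b :+ η :* η) :+ ((t :* t :- a :* a) :+ (t :* t :- b :* b) :+ k :* (η :* η))
                := ((η :+ η) :+ ((η :+ η) :+ (η :+ η))) :* ((η :+ η) :+ ((η :+ η) :+ (η :+ η)))) refl
              (seq (re z) n - seq (re q) n) (seq (im z) n - seq (im q) n) η))
          (*-mono-≤ (ℚₚ.≤-trans 0≤6η 6η≤ε) 0≤6η 6η≤ε 6η≤ε))
        (shrink-close {q} {z} q∈D close) h)
        where
        0≤2 = 0≤p+q {1ℚ} {1ℚ} 0≤1 0≤1
        2ℚ = 1ℚ + 1ℚ
        0≤17 : 0ℚ ≤ 2ℚ * (2ℚ * (2ℚ * 2ℚ)) + 1ℚ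
        0≤17 = 0≤p+q {2ℚ * (2ℚ * (2ℚ * 2ℚ))} {1ℚ} (0≤p*q {2ℚ} {2ℚ * (2ℚ * 2ℚ)} 0≤2 (0≤p*q {2ℚ} {2ℚ * 2ℚ} 0≤2 (0≤p*q {2ℚ} {2ℚ} 0≤2 0≤2))) 0≤1
        0≤2η = 0≤p+q (ℚₚ.<⇒≤ 0<η) (ℚₚ.<⇒≤ 0<η)
        0≤6η = 0≤p+q 0≤2η (0≤p+q 0≤2η 0≤2η)

  normSq-cong : ∀ {z w} → z ≈ᶜ w → normSq z ≈ʳ normSq w
  normSq-cong (mk≈ᶜ r i) = +-congʳ (*-congʳ r r) (*-congʳ i i)

  Below⇒≤ : ∀ {x} → Below x 1ℚ → x ≤ʳ 1ʳ
  Below⇒≤ {x} (below b b<1 k) (mk< g 0<g h) =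
    let _ , 1+g≤b = ev-witness (ev-zip (λ n → ℚₚ.≤-trans) h k)
    in ℚₚ.<-asym b<1 (ℚₚ.<-≤-trans (<-cert 0<g refl) 1+g≤b)

  re-Below : ∀ {x z} → x ≈ʳ re z → Below (normSq z) 1ℚ → -ʳ 1ʳ ≤ʳ x × x ≤ʳ 1ʳ
  re-Below {x} {z} x≈ (below b b<1 k) =
      (λ (mk< g 0<g h) → proj₂ (ev-witness (ev-zip (λ n p (q , r) → absurd n
        (ℚₚ.≤-trans (≤-cert (0≤p+q (p≤q⇒0≤q-p p) (p≤q⇒0≤q-p q))
            (solve 3 (λ x y g → con 1ℚ :+ (((:- con 1ℚ) :- (x :+ g)) :+ ((x :+ g) :- y)) := :- y) refl (seq x n) (seq (re z) n) g))
          (-p≤∣p∣ (seq (re z) n))) r)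
        h (ev-zip (λ n → _,_) (near x≈ g 0<g) k))))
    , (λ (mk< g 0<g h) → proj₂ (ev-witness (ev-zip (λ n p (q , r) → absurd n
        (ℚₚ.≤-trans (≤-cert (0≤p+q (p≤q⇒0≤q-p p) (p≤q⇒0≤q-p q))
            (solve 3 (λ x y g → con 1ℚ :+ ((x :- (con 1ℚ :+ g)) :+ ((y :+ g) :- x)) := y) refl (seq x n) (seq (re z) n) g))
          (p≤∣p∣ (seq (re z) n))) r)
        h (ev-zip (λ n → _,_) (near (≈-symʳ x≈) g 0<g) k))))
    where
    absurd : ∀ n → 1ℚ ≤ ∣ seq (re z) n ∣ → seq (normSq z) n ≤ b → ⊥
    absurd n 1≤ q≤ = ℚₚ.<-irrefl refl (ℚₚ.≤-<-trans (ℚₚ.≤-trans (≤-cert (0≤p+q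
          (p≤q⇒0≤q-p (subst (1ℚ ≤_) (trans (sym (ℚₚ.∣p*q∣≡∣p∣*∣q∣ a a)) (ℚₚ.0≤p⇒∣p∣≡p (0≤p*p a)))
            (*-mono-≤ {1ℚ} {∣ a ∣} {1ℚ} (ℚₚ.0≤∣p∣ a) 0≤1 1≤ 1≤))) (0≤p*p (seq (im z) n)))
        (solve 2 (λ a b → con 1ℚ :+ ((a :- con 1ℚ) :+ b) := a :+ b) refl (a * a) (seq (im z) n * seq (im z) n))) q≤) b<1)
      where
      a : ℚ
      a = seq (re z) n

  ≺-scale : ∀ {y r D} → 0ℚ < D → y ≺ r → fromℚ D *ʳ y ≺ D * r
  ≺-scale {y} {r} {D} 0<D (mk≺ b b<r h) = mk≺ (D * b) (ℚₚ.*-monoʳ-<-pos D {{positive 0<D}} b<r)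
    (ev-map (λ n ∣y∣≤b → subst (_≤ D * b)
      (sym (trans (ℚₚ.∣p*q∣≡∣p∣*∣q∣ D (seq y n)) (cong (λ t → t * ∣ seq y n ∣) (ℚₚ.0≤p⇒∣p∣≡p (ℚₚ.<⇒≤ 0<D)))))
      (*-monoˡ-≤′ (ℚₚ.<⇒≤ 0<D) ∣y∣≤b)) h)

  -- A real number cannot be rounded directly: `x/D` is approximated by a rational `p` to within 1,
  -- and `p` is rounded to within 1. The constant 3 leaves room for strict bounds.
  nearest-multiple : ∀ x D → 0ℚ < D → ∃ λ c → x -ʳ fromℚ (fromℤ c * D) ≺ D * (1ℚ + (1ℚ + 1ℚ))
  nearest-multiple x D 0<D = let c , c≤ = nearby-integer p in c , bound (fromℤ c) c≤
    where
    v p : ℚ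
    v = proj₁ (inverse>0 0<D)
    p = proj₁ (approximate (x *ʳ fromℚ v) 1ℚ 0<1)
    close : x *ʳ fromℚ v -ʳ fromℚ p ≺ 1ℚ
    close = proj₂ (approximate (x *ʳ fromℚ v) 1ℚ 0<1)
    identity : ∀ c x → D * ((x * v + - p) + (p - c)) ≡ x + - (c * D)
    identity c x = trans
      (solve 5 (λ D x v p c → D :* ((x :* v :+ (:- p)) :+ (p :- c)) := (D :* v) :* x :+ (:- (c :* D))) refl D x v p c)
      (cong (λ t → t + - (c * D)) (trans (cong (λ t → t * x) (proj₂ (proj₂ (inverse>0 0<D)))) (ℚₚ.*-identityˡ x)))
    bound : ∀ c → ∣ c - p ∣ ≤ 1ℚ → x -ʳ fromℚ (c * D) ≺ D * (1ℚ + (1ℚ + 1ℚ))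
    bound c c≤ = ≺-pointwise {fromℚ D *ʳ ((x *ʳ fromℚ v -ʳ fromℚ p) +ʳ fromℚ (p - c))} {x -ʳ fromℚ (c * D)}
      (λ n → identity c (seq x n)) (≺-scale 0<D (≺-+ close (≺-fromℚ (ℚₚ.≤-<-trans
        (subst (_≤ 1ℚ) (∣p-q∣≡∣q-p∣ c p) c≤) (<-cert {1ℚ} {1ℚ + 1ℚ} 0<1 refl)))))

  record IsReal (z : ℂ) : Set where
    constructor isReal
    field im≈0 : im z ≈ʳ 0ʳ
  open IsReal public

  real≈ : ∀ {z} → IsReal z → z ≈ᶜ fromℝ (re z)
  real≈ (isReal r) = mk≈ᶜ ≈-reflʳ r

  IsReal-resp : ∀ {z w} → z ≈ᶜ w → IsReal z → IsReal w
  IsReal-resp (mk≈ᶜ _ i) (isReal r) = isReal (≈-transʳ (≈-symʳ i) r)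

  IsReal-+ : ∀ {z w} → IsReal z → IsReal w → IsReal (z +ᶜ w)
  IsReal-+ (isReal r) (isReal s) = isReal (≈-transʳ (+-congʳ r s) (ℝᵣ.+-identityʳ 0ʳ))

  IsReal-* : ∀ {z w} → IsReal z → IsReal w → IsReal (z *ᶜ w)
  IsReal-* {z} {w} (isReal r) (isReal s) = isReal (≈-transʳ (+-congʳ (*-congʳ ≈-reflʳ s) (*-congʳ r ≈-reflʳ))
    (≈-transʳ (+-congʳ (ℝᵣ.zeroʳ (re z)) (ℝᵣ.zeroˡ (re w))) (ℝᵣ.+-identityʳ 0ʳ)))

  IsReal-fromℝ : ∀ x → IsReal (fromℝ x)
  IsReal-fromℝ x = isReal ≈-reflʳ

  IsReal-sum : ∀ {n} (f : Vector ℂ n) → (∀ i → IsReal (f i)) → IsReal (sum f)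
  IsReal-sum {zero} f h = IsReal-fromℝ 0ʳ
  IsReal-sum {suc n} f h = IsReal-+ (h zero) (IsReal-sum (f ∘ suc) (h ∘ suc))

  z+conj-z-real : ∀ z → IsReal (z +ᶜ conj z)
  z+conj-z-real z = isReal (ℝᵣ.-‿inverseʳ (im z))

-- Conjugates of Pisot numbers and a criterion for membership in `℘ K`

module PisotNumbers where

  open import Defs hiding (evalMonic)
  open Rationals
  open Reals
  open Fields
  open IntegerSpans
  open TraceForms
  open ComplexField
  open FieldElements
  open Estimates
  open import Data.Nat.Induction using (<-rec)
  open import Relation.Unary using (_∈_; _⊆_)
  open ≡ using (refl)
  open import Relation.Binary.Reasoning.Setoid ℂᵣ.setoid
  open FieldProperties ℂ-field using (sum; evalMonic; evalMonic-cong; module Solver)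
  open IntegerSpan ℂ-field using (_∈⟨_⟩)

  all-or-one : ∀ {A : Set} {m} {B : Fin m → Set} → (∀ i → A ⊎ B i) → A ⊎ (∀ i → B i)
  all-or-one {m = zero} h = inj₂ λ ()
  all-or-one {m = suc m} h with h zero | all-or-one (h ∘ suc)
  ... | inj₁ x | _ = inj₁ x
  ... | inj₂ _ | inj₁ x = inj₁ x
  ... | inj₂ p | inj₂ ps = inj₂ λ { zero → p ; (suc i) → ps i }

  module Conjugates {ℓ} (K : RealNumberField ℓ) (L : Labelling K) where

    open Elements K public
    open RealNumberField K using (basis; isBasis)
    open Labelling L

    n N : ℕ
    n = s-1 ℕ.+ (t ℕ.+ t)
    N = suc n

    private
      labelledBasis : ∃ λ (b : Vector ℝ N) → IsℚBasis b member
      labelledBasis = ≡.subst (λ m → ∃ λ (b : Vector ℝ m) → IsℚBasis b member) degree≡s+2t (basis , isBasis)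

    b : Vector ℝ N
    b = proj₁ labelledBasis
    open IsℚBasis (proj₂ labelledBasis)

    bᴱ : Fin N → Element
    bᴱ i = b i , basis∈ i

    module σₚ j = EmbeddingProperties (σ j)

    coord : Element → Vector ℚ N
    coord x = proj₁ (spanning (proj₂ x))

    expand : ∀ j x → ⟦ σ j ⟧ x ≈ᶜ sum (λ i → ⟦ σ j ⟧ (bᴱ i) *ᶜ ι (coord x i))
    expand j x = ℂᵣ.trans (σₚ.cong j {y = combo (coord x) bᴱ} (proj₂ (spanning (proj₂ x)))) (σₚ.on-combo j (coord x) bᴱ)

    σ₀-injective : ∀ {x y} → ⟦ σ zero ⟧ x ≈ᶜ ⟦ σ zero ⟧ y → proj₁ x ≈ʳ proj₁ y
    σ₀-injective {x} {y} e = _≈ᶜ_.re≈ (ℂᵣ.trans (ℂᵣ.sym (σ₁-identity x)) (ℂᵣ.trans e (σ₁-identity y)))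

    basis-independent : ∀ (c : Vector ℚ N) → sum (λ i → ⟦ σ zero ⟧ (bᴱ i) *ᶜ ι (c i)) ≈ᶜ 0ᶜ → ∀ i → c i ≡ 0ℚ
    basis-independent c e = independent c (_≈ᶜ_.re≈ (begin
      fromℝ (combination c b)                          ≈⟨ σ₁-identity (combo c bᴱ) ⟨
      ⟦ σ zero ⟧ (combo c bᴱ)                          ≈⟨ σₚ.on-combo zero c bᴱ ⟩
      sum (λ i → ⟦ σ zero ⟧ (bᴱ i) *ᶜ ι (c i))         ≈⟨ e ⟩
      0ᶜ                                               ∎))

    σ-distinct : ∀ i j → i ≢ j → ¬ (∀ x → ⟦ σ i ⟧ x ≈ᶜ ⟦ σ j ⟧ x)
    σ-distinct i j i≢j h = i≢j (proj₁ enumerates h)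

    open OverField.TraceForm ℂ-field _*ᴱ_ 1ᴱ zero (λ j → ⟦ σ j ⟧) σₚ.*-homo σₚ.1#-homo σ-distinct bᴱ coord expand (λ c → combo c bᴱ) (λ j c → σₚ.on-combo j c bᴱ) basis-independent public

    -- Membership of the conjugate tuples in the polydisc is a negative statement,
    -- so the minimal polynomial of θ need only exist up to double negation.

    ¬¬-least : ∀ {p} (P : ℕ → Set p) m → P m → ¬ ¬ (∃ λ k → P k × ∀ l → P l → k ℕ.≤ l)
    ¬¬-least P = <-rec (λ m → P m → ¬ ¬ (∃ λ k → P k × ∀ l → P l → k ℕ.≤ l)) λ m rec pm none →
      none (m , pm , λ l pl → ℕₚ.≮⇒≥ λ l<m → rec l<m pl none)

    minimalPolynomial-exists : ∀ {z} {m} (a : Vector ℚ m) → z IsRootOf a →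
      ¬ ¬ (∃ λ k → ∃ λ (a : Vector ℚ k) → IsMinimalPolynomial a z)
    minimalPolynomial-exists {z} {m} a root none = ¬¬-least (λ k → ∃ λ (a : Vector ℚ k) → z IsRootOf a) m (a , root)
      λ (k , (c , c-root) , least) → none (k , c , record { root = c-root ; minimal = λ d d-root → least _ (d , d-root) })

    σ₀-root⇒root : ∀ {k} (a : Vector ℚ k) x → evalMonic a (⟦ σ zero ⟧ x) ≈ᶜ 0ᶜ → fromℝ (proj₁ x) IsRootOf a
    σ₀-root⇒root a x root = ℂᵣ.trans (evalMonic-cong a (ℂᵣ.sym (σ₁-identity x))) root

    root⇒σ₀-root : ∀ {k} (a : Vector ℚ k) x → fromℝ (proj₁ x) IsRootOf a → evalMonic a (⟦ σ zero ⟧ x) ≈ᶜ 0ᶜ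
    root⇒σ₀-root a x root = ℂᵣ.trans (evalMonic-cong a (σ₁-identity x)) root

    root-conjugate : ∀ {k} (a : Vector ℚ k) x → fromℝ (proj₁ x) IsRootOf a → ∀ j → ⟦ σ j ⟧ x IsRootOf a
    root-conjugate a x root = conjugate-root a x (root⇒σ₀-root a x root)

    -- Induction on the generation of `ℚ⟨ θ ⟩`. The proof of membership in `K` is arbitrary, since
    -- embeddings respect equality of the underlying reals and cannot see it.
    fixes-generator⇒identity : ∀ j (θ : Element) → ℚ⟨ proj₁ θ ⟩ ⊆ member → ⟦ σ j ⟧ θ ≈ᶜ fromℝ (proj₁ θ) →
      ∀ {x} → x ∈ ℚ⟨ proj₁ θ ⟩ → (x∈ : x ∈ member) → ⟦ σ j ⟧ (x , x∈) ≈ᶜ fromℝ x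
    fixes-generator⇒identity j θ ⊆K fixed = go
      where
      go : ∀ {x} → x ∈ ℚ⟨ proj₁ θ ⟩ → (x∈ : x ∈ member) → ⟦ σ j ⟧ (x , x∈) ≈ᶜ fromℝ x
      go gen x∈ = ℂᵣ.trans (σₚ.cong j ≈-reflʳ) fixed
      go (eqv {x} {y} x≈y d) y∈ = ℂᵣ.trans (σₚ.cong j {_ , y∈} {_ , ⊆K d} (≈-symʳ x≈y)) (ℂᵣ.trans (go d (⊆K d)) (fromℝ-cong x≈y))
      go 0gen x∈ = ℂᵣ.trans (σₚ.cong j ≈-reflʳ) (σₚ.0#-homo j)
      go 1gen x∈ = ℂᵣ.trans (σₚ.cong j ≈-reflʳ) (σₚ.1#-homo j)
      go (add {x} {y} d d′) x∈ = ℂᵣ.trans (σₚ.cong j {_ , x∈} {(x , ⊆K d) +ᴱ (y , ⊆K d′)} ≈-reflʳ)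
        (ℂᵣ.trans (σₚ.+-homo j (x , ⊆K d) (y , ⊆K d′))
          (ℂᵣ.trans (ℂᵣ.+-cong (go d (⊆K d)) (go d′ (⊆K d′))) (ℂᵣ.sym (fromℝ-+ x y))))
      go (mul {x} {y} d d′) x∈ = ℂᵣ.trans (σₚ.cong j {_ , x∈} {(x , ⊆K d) *ᴱ (y , ⊆K d′)} ≈-reflʳ)
        (ℂᵣ.trans (σₚ.*-homo j (x , ⊆K d) (y , ⊆K d′))
          (ℂᵣ.trans (ℂᵣ.*-cong (go d (⊆K d)) (go d′ (⊆K d′))) (ℂᵣ.sym (fromℝ-* x y))))
      go (neg {x} d) x∈ = ℂᵣ.trans (σₚ.cong j {_ , x∈} { -ᴱ (x , ⊆K d)} ≈-reflʳ)
        (ℂᵣ.trans (σₚ.-‿homo j (x , ⊆K d)) (ℂᵣ.trans (ℂᵣ.-‿cong (go d (⊆K d))) (ℂᵣ.sym (fromℝ-neg x))))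
      go (inv {x} {y} xy≈1 d) y∈ = begin
        w                                   ≈⟨ ℂᵣ.*-identityʳ w ⟨
        w *ᶜ 1ᶜ                             ≈⟨ ℂᵣ.*-congˡ (ℂᵣ.trans (ℂᵣ.sym (fromℝ-* x y)) (fromℝ-cong xy≈1)) ⟨
        w *ᶜ (fromℝ x *ᶜ fromℝ y)           ≈⟨ Solver.solve 3 (λ w x y → w S:* (x S:* y) S:= (x S:* w) S:* y) ℂᵣ.refl w (fromℝ x) (fromℝ y) ⟩
        (fromℝ x *ᶜ w) *ᶜ fromℝ y           ≈⟨ ℂᵣ.*-congʳ (ℂᵣ.*-congʳ (go d (⊆K d))) ⟨
        (⟦ σ j ⟧ (x , ⊆K d) *ᶜ w) *ᶜ fromℝ y
          ≈⟨ ℂᵣ.*-congʳ (ℂᵣ.trans (ℂᵣ.sym (σₚ.*-homo j (x , ⊆K d) (y , y∈))) (ℂᵣ.trans (σₚ.cong j {_} {1ᴱ} xy≈1) (σₚ.1#-homo j))) ⟩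
        1ᶜ *ᶜ fromℝ y                       ≈⟨ ℂᵣ.*-identityˡ (fromℝ y) ⟩
        fromℝ y                             ∎
        where
        open Solver using () renaming (_:*_ to _S:*_; _:=_ to _S:=_)
        w : ℂ
        w = ⟦ σ j ⟧ (y , y∈)

    -- An embedding that fixes the generator `θ` is the inclusion, so `σ (suc j)` sends `θ` to a
    -- different root of its minimal polynomial, and the Pisot condition applies to that root.
    Pisot-conjugates : ∀ θ → θ ∈ ℘ K → ∀ j → ¬ ¬ Below (normSq (⟦ σ (suc j) ⟧ θ)) 1ℚ
    Pisot-conjugates θ (pisot , K⊆ , ⊆K) j none =
      let m , a , root = isAlgebraicInteger in
      minimalPolynomial-exists (fromℤ ∘ a) root λ (k , c , min) →
        none (<⇒Below (conjugates<1 (⟦ σ (suc j) ⟧ θ)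
          (k , c , min , root-conjugate c θ (IsMinimalPolynomial.root min) (suc j)) moved))
      where
      open IsPisot pisot
      moved : ¬ (⟦ σ (suc j) ⟧ θ ≈ᶜ fromℝ (proj₁ θ))
      moved fixed = σ-distinct (suc j) zero (λ ()) λ x → ℂᵣ.trans
        (fixes-generator⇒identity (suc j) θ ⊆K fixed (K⊆ (proj₂ x)) (proj₂ x)) (ℂᵣ.sym (σ₁-identity x))

    conjugateTuples⊆Polydisc : conjugateTuples L ⊆ Polydisc s-1 t
    conjugateTuples⊆Polydisc {x , z} (θ , θ∈℘ , x≈ , z≈) =
        (λ i → (λ x<-1 → Pisot-conjugates θ θ∈℘ (i ↑ˡ (t ℕ.+ t)) λ h → proj₁ (re-Below (x≈ i) h) x<-1)
             , (λ 1<x → Pisot-conjugates θ θ∈℘ (i ↑ˡ (t ℕ.+ t)) λ h → proj₂ (re-Below (x≈ i) h) 1<x))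
      , (λ j 1<z → Pisot-conjugates θ θ∈℘ (s-1 ↑ʳ (j ↑ˡ t)) λ h →
          Below⇒≤ (Below-resp (≈-symʳ (normSq-cong (z≈ j))) h) 1<z)

    module PisotCriterion (θ : Element)
      (θ≥2 : Ev λ k → 1ℚ ℚ.+ 1ℚ ℚ.≤ seq (proj₁ θ) k)
      (small : ∀ j → Below (normSq (⟦ σ (suc j) ⟧ θ)) 1ℚ) where

      θ-isolated : ∀ j → j ≢ zero → ¬ (⟦ σ j ⟧ θ ≈ᶜ ⟦ σ zero ⟧ θ)
      θ-isolated zero j≢0 = ⊥-elim (j≢0 refl)
      θ-isolated (suc j) _ e = absurd (Below-resp (normSq-cong (ℂᵣ.trans e (σ₁-identity θ))) (small j))
        where
        absurd : ¬ Below (normSq (fromℝ (proj₁ θ))) 1ℚ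
        absurd (below r r<1 h) =
          let k , p , q = ev-witness (ev-zip (λ k → _,_) θ≥2 h)
              x = seq (proj₁ θ) k
          in ℚₚ.<-irrefl refl (ℚₚ.<-≤-trans r<1 (ℚₚ.≤-trans
            (≤-cert (0≤p+q (0≤p*q (p≤q⇒0≤q-p p) (0≤p+q {x ℚ.- (1ℚ ℚ.+ 1ℚ)} {1ℚ ℚ.+ 1ℚ} (p≤q⇒0≤q-p p) (0≤p+q {1ℚ} {1ℚ} 0≤1 0≤1)))
                      (0≤p+q (p≤q⇒0≤q-p p) (0≤p+q (p≤q⇒0≤q-p p) (0≤p+q {1ℚ} {1ℚ ℚ.+ 1ℚ} 0≤1 (0≤p+q {1ℚ} {1ℚ} 0≤1 0≤1)))))
              (identity x)) q))
          where
          open import Data.Rational.Solver using (module +-*-Solver)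
          open +-*-Solver
          identity : ∀ x → 1ℚ ℚ.+ ((x ℚ.- (1ℚ ℚ.+ 1ℚ)) ℚ.* ((x ℚ.- (1ℚ ℚ.+ 1ℚ)) ℚ.+ (1ℚ ℚ.+ 1ℚ))
            ℚ.+ ((x ℚ.- (1ℚ ℚ.+ 1ℚ)) ℚ.+ ((x ℚ.- (1ℚ ℚ.+ 1ℚ)) ℚ.+ (1ℚ ℚ.+ (1ℚ ℚ.+ 1ℚ))))) ≡ x ℚ.* x ℚ.+ 0ℚ ℚ.* 0ℚ
          identity = solve 1 (λ x → let two = con 1ℚ :+ con 1ℚ in con 1ℚ :+ ((x :- two) :* ((x :- two) :+ two)
            :+ ((x :- two) :+ ((x :- two) :+ (con 1ℚ :+ two)))) := x :* x :+ con 0ℚ :* con 0ℚ) refl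

      open Primitive θ θ-isolated

      ℚ⟨θ⟩-isSubfield : IsSubfield ℚ⟨ proj₁ θ ⟩
      ℚ⟨θ⟩-isSubfield = record { resp = eqv ; 0∈ = 0gen ; 1∈ = 1gen ; +-closed = add ; *-closed = mul ; neg-closed = neg ; inv-closed = inv }

      power∈ℚ⟨θ⟩ : ∀ k → proj₁ (θ ^ᴱ k) ∈ ℚ⟨ proj₁ θ ⟩
      power∈ℚ⟨θ⟩ zero = 1gen
      power∈ℚ⟨θ⟩ (suc k) = mul gen (power∈ℚ⟨θ⟩ k)

      K⊆ℚ⟨θ⟩ : member ⊆ ℚ⟨ proj₁ θ ⟩
      K⊆ℚ⟨θ⟩ {x} x∈ = eqv (≈-symʳ (σ₀-injective {x , x∈} {y} same)) y∈
        where
        powersᴱ : Fin N → Element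
        powersᴱ k = θ ^ᴱ toℕ k
        c : Vector ℚ N
        c = proj₁ (powersᴱ-span (x , x∈))
        y : Element
        y = combo c powersᴱ
        same : ⟦ σ zero ⟧ (x , x∈) ≈ᶜ ⟦ σ zero ⟧ y
        same = ℂᵣ.trans p1 (ℂᵣ.sym p2)
          where
          rhs : ℂ
          rhs = sum (λ k → ⟦ σ zero ⟧ (powersᴱ k) *ᶜ ι (c k))
          p1 : ⟦ σ zero ⟧ (x , x∈) ≈ᶜ rhs
          p1 = proj₂ (powersᴱ-span (x , x∈)) zero
          p2 : ⟦ σ zero ⟧ y ≈ᶜ rhs
          p2 = σₚ.on-combo zero c powersᴱ
        y∈ : proj₁ y ∈ ℚ⟨ proj₁ θ ⟩
        y∈ = Subfield.combination∈ ℚ⟨θ⟩-isSubfield c (λ k → proj₁ (powersᴱ k)) (λ k → power∈ℚ⟨θ⟩ (toℕ k))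

      ℚ⟨θ⟩⊆K : ∀ {x} → x ∈ ℚ⟨ proj₁ θ ⟩ → x ∈ member
      ℚ⟨θ⟩⊆K gen = proj₂ θ
      ℚ⟨θ⟩⊆K (eqv x≈y d) = resp x≈y (ℚ⟨θ⟩⊆K d)
      ℚ⟨θ⟩⊆K 0gen = 0∈
      ℚ⟨θ⟩⊆K 1gen = 1∈
      ℚ⟨θ⟩⊆K (add d d′) = +-closed (ℚ⟨θ⟩⊆K d) (ℚ⟨θ⟩⊆K d′)
      ℚ⟨θ⟩⊆K (mul d d′) = *-closed (ℚ⟨θ⟩⊆K d) (ℚ⟨θ⟩⊆K d′)
      ℚ⟨θ⟩⊆K (neg d) = neg-closed (ℚ⟨θ⟩⊆K d)
      ℚ⟨θ⟩⊆K (inv xy≈1 d) = inv-closed xy≈1 (ℚ⟨θ⟩⊆K d)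

      -- Which conjugate `w` equals cannot be decided, yet a strict bound is due. The gap between
      -- `normSq (σ (suc j) θ)` and 1 allows a comparison that either bounds `w` at once or shows
      -- `w` different from that conjugate. If it never bounds `w`, then `w` avoids all conjugates,
      -- against `all-conjugates`.
      conjugate-small : ∀ w → IsConjugate (fromℝ (proj₁ θ)) w → ¬ (w ≈ᶜ fromℝ (proj₁ θ)) → Below (normSq w) 1ℚ
      conjugate-small w (k , a , min , w-root) w≉θ = decide (all-or-one separate)
        where
        open IsMinimalPolynomial min
        separate : ∀ j → Below (normSq w) 1ℚ ⊎ ¬ (w ≈ᶜ ⟦ σ (suc j) ⟧ θ)
        separate j = split (small j)
          where
          split : Below (normSq (⟦ σ (suc j) ⟧ θ)) 1ℚ → Below (normSq w) 1ℚ ⊎ ¬ (w ≈ᶜ ⟦ σ (suc j) ⟧ θ)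
          split (below r r<1 h) = let d , 0<d , eq = half (p<q⇒0<q-p r<1) in
            choose d 0<d (located-Below (normSq w) (r ℚ.+ d) 1ℚ
              (<-cert 0<d (≡.trans (ℚₚ.+-assoc r d d) (≡.trans (≡.cong (λ u → r ℚ.+ u) eq) (p+[q-p]≡q r 1ℚ)))))
            where
            choose : ∀ d → 0ℚ ℚ.< d → Below (normSq w) 1ℚ ⊎ ¬ Below (normSq w) (r ℚ.+ d) →
              Below (normSq w) 1ℚ ⊎ ¬ (w ≈ᶜ ⟦ σ (suc j) ⟧ θ)
            choose d 0<d (inj₁ lt) = inj₁ lt
            choose d 0<d (inj₂ ¬lt) = inj₂ λ e → ¬lt (Below-resp (≈-symʳ (normSq-cong e)) (below r (<-cert 0<d refl) h))
        N-relation : fromℝ (proj₁ θ) IsRootOf proj₁ monic-relation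
        N-relation = σ₀-root⇒root (proj₁ monic-relation) θ (proj₂ monic-relation)
        decide : Below (normSq w) 1ℚ ⊎ (∀ j → ¬ (w ≈ᶜ ⟦ σ (suc j) ⟧ θ)) → Below (normSq w) 1ℚ
        decide (inj₁ lt) = lt
        decide (inj₂ w≉) = ⊥-elim (all-conjugates a (minimal (proj₁ monic-relation) N-relation)
          (root⇒σ₀-root a θ root) w w-root
          λ { zero e → w≉θ (ℂᵣ.trans e (σ₁-identity θ)) ; (suc j) → w≉ j })

      1<θ : 1ʳ <ʳ proj₁ θ
      1<θ = mk< 1ℚ 0<1 θ≥2

      integer-root : (∃ λ m → ∃ λ (a : Vector ℤ m) → evalMonic (fromℤ ∘ a) (⟦ σ zero ⟧ θ) ≈ᶜ 0ᶜ) →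
        IsAlgebraicInteger (fromℝ (proj₁ θ))
      integer-root (m , a , root) = m , a , σ₀-root⇒root (fromℤ ∘ a) θ root

      θ∈℘ : ∀ D (D-clears : ∀ i k l → Clears (coord (bᴱ i *ᴱ bᴱ k) l) D) →
        ⟦ σ zero ⟧ θ ∈⟨ Order.W D D-clears ⟩ → θ ∈ ℘ K
      θ∈℘ D D-clears θ∈W = record
          { isAlgebraicInteger = integer-root (integral-relation D D-clears θ∈W)
          ; >1 = 1<θ
          ; conjugates<1 = λ w w∼θ w≉θ → Below⇒< (conjugate-small w w∼θ w≉θ) }
        , K⊆ℚ⟨θ⟩ , ℚ⟨θ⟩⊆K

-- Construction of the approximating Pisot number

module Approximations where

  open import Defs hiding (evalMonic)
  open Rationals
  open Reals
  open Fields
  open IntegerSpans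
  open ComplexField
  open FieldElements
  open LinearForms using (linearFormsTheorem; bounded-family₂; module ∑ℝ)
  open Estimates
  open PisotNumbers
  open import Data.Rational.Base
  open import Data.Rational.Solver using (module +-*-Solver)
  open import Function.Bundles using (Equivalence)
  open import Relation.Unary using (_∈_)
  open ≡ using (refl)
  open FieldProperties ℂ-field using (sum; sum-split; ∑-distrib-+)

  Fin-split : ∀ {p} m {n} (P : Fin (m ℕ.+ n) → Set p) → (∀ i → P (i ↑ˡ n)) → (∀ j → P (m ↑ʳ j)) → ∀ k → P k
  Fin-split zero P left right k = right k
  Fin-split (suc m) P left right zero = left zero
  Fin-split (suc m) P left right (suc k) = Fin-split m (P ∘ suc) (left ∘ suc) right k

  -- The last `2t` terms are regrouped into sums `z + conj z`.
  sum-real : ∀ m t (f : Vector ℂ (m ℕ.+ (t ℕ.+ t))) → (∀ (i : Fin m) → IsReal (f (i ↑ˡ (t ℕ.+ t)))) →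
    (∀ (j : Fin t) → f (m ↑ʳ (t ↑ʳ j)) ≈ᶜ conj (f (m ↑ʳ (j ↑ˡ t)))) → IsReal (sum f)
  sum-real m t f real paired = IsReal-resp (ℂᵣ.sym (sum-split m {t ℕ.+ t} f))
    (IsReal-+ (IsReal-sum (λ (i : Fin m) → f (i ↑ˡ (t ℕ.+ t))) real)
      (IsReal-resp (ℂᵣ.sym (ℂᵣ.trans (sum-split t {t} (λ j → f (m ↑ʳ j)))
          (ℂᵣ.sym (∑-distrib-+ (λ j → f (m ↑ʳ (j ↑ˡ t))) (λ j → f (m ↑ʳ (t ↑ʳ j)))))))
        (IsReal-sum (λ j → f (m ↑ʳ (j ↑ˡ t)) +ᶜ f (m ↑ʳ (t ↑ʳ j)))
          λ j → IsReal-resp (ℂᵣ.+-congˡ {f (m ↑ʳ (j ↑ˡ t))} (ℂᵣ.sym (paired j))) (z+conj-z-real (f (m ↑ʳ (j ↑ˡ t)))))))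

  conj-ι : ∀ q → ι q ≈ᶜ conj (ι q)
  conj-ι q = mk≈ᶜ ≈-reflʳ (pointwise λ _ → refl)

  conj-*₂ : ∀ {a b a′ b′} → a ≈ᶜ conj a′ → b ≈ᶜ conj b′ → a *ᶜ b ≈ᶜ conj (a′ *ᶜ b′)
  conj-*₂ {a} {b} {a′} {b′} p q = ℂᵣ.trans (ℂᵣ.*-cong p q) (ℂᵣ.sym (conj-* a′ b′))

  ≺ᶜ-conj : ∀ {z r} → z ≺ᶜ r → conj z ≺ᶜ r
  ≺ᶜ-conj (mk≺ᶜ p q) = mk≺ᶜ p (≺-neg q)

  ≺ᶜ-neg : ∀ {z r} → z ≺ᶜ r → -ᶜ z ≺ᶜ r
  ≺ᶜ-neg (mk≺ᶜ p q) = mk≺ᶜ (≺-neg p) (≺-neg q)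

  InDisc-conj : ∀ {z} → InDisc z → InDisc (conj z)
  InDisc-conj {z} h κ 0<κ = ev-map (λ n → ≡.subst (_≤ 1ℚ + κ) (identity (seq (re z) n) (seq (im z) n))) (h κ 0<κ)
    where
    open +-*-Solver
    identity : ∀ x y → x * x + y * y ≡ x * x + (- y) * (- y)
    identity = solve 2 (λ x y → x :* x :+ y :* y := x :* x :+ (:- y) :* (:- y)) refl

  re-combination : ∀ {m} (S : Vector ℂ m) (c : Vector ℤ m) D →
    ∑ℝ.sum (λ i → (re (S i) *ʳ fromℚ D) *ʳ fromℚ (fromℤ (c i))) ≈ʳ re (sum (λ i → S i *ᶜ ι (fromℤ (c i) * D)))
  re-combination {zero} S c D = ≈-reflʳ
  re-combination {suc m} S c D = +-congʳ (step (S zero) (fromℤ (c zero))) (re-combination (S ∘ suc) (c ∘ suc) D)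
    where
    step : ∀ z c → (re z *ʳ fromℚ D) *ʳ fromℚ c ≈ʳ re (z *ᶜ ι (c * D))
    step z c = pointwise λ n → solve 4 (λ x y D c → (x :* D) :* c := x :* (c :* D) :+ (:- (y :* con 0ℚ))) refl (seq (re z) n) (seq (im z) n) D c
      where open +-*-Solver

  im-combination : ∀ {m} (S : Vector ℂ m) (c : Vector ℤ m) D →
    ∑ℝ.sum (λ i → (im (S i) *ʳ fromℚ D) *ʳ fromℚ (fromℤ (c i))) ≈ʳ im (sum (λ i → S i *ᶜ ι (fromℤ (c i) * D)))
  im-combination {zero} S c D = ≈-reflʳ
  im-combination {suc m} S c D = +-congʳ (step (S zero) (fromℤ (c zero))) (im-combination (S ∘ suc) (c ∘ suc) D)
    where
    step : ∀ z c → (im z *ʳ fromℚ D) *ʳ fromℚ c ≈ʳ im (z *ᶜ ι (c * D))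
    step z c = pointwise λ n → solve 4 (λ x y D c → (y :* D) :* c := x :* con 0ℚ :+ y :* (c :* D)) refl (seq (re z) n) (seq (im z) n) D c
      where open +-*-Solver

  rounding-bound : ∀ {m} (S : Vector ℂ m) (x : Vector ℝ m) (c : Vector ℚ m) {B E} → 0ℚ < B → 0ℚ < E →
    (∀ i → S i ≺ᶜ B) → (∀ i → x i -ʳ fromℚ (c i) ≺ E) →
    sum (λ i → S i *ᶜ (fromℝ (x i) -ᶜ ι (c i))) ≺ᶜ fromℕ′ (suc m) * (B * E + B * E)
  rounding-bound S x c 0<B 0<E hS hx = ≺ᶜ-sum _ (0<p+q (0<p*q 0<B 0<E) (ℚₚ.<⇒≤ (0<p*q 0<B 0<E)))
    λ i → ≺ᶜ-* {S i} {fromℝ (x i) -ᶜ ι (c i)} (hS i) (mk≺ᶜ (hx i) (mk≺ 0ℚ 0<E (0 , λ _ _ → ℚₚ.≤-refl)))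

  tolerance : ∀ ε → 0ʳ <ʳ ε → ∃ λ η → 0ℚ < η × η ≤ 1ℚ ×
    Ev λ n → (η + η) + ((η + η) + (η + η)) ≤ seq ε n
  tolerance ε (mk< g 0<g h) = η , 0<η
      , ≤-cert (0≤p+q (0≤p+q 0≤η 0≤4η) (0≤p+q 0≤2η (p≤q⇒0≤q-p (ℚₚ.p⊓q≤q g 1ℚ))))
          (solve 1 (λ g → let η = con ½ :* (con ½ :* (con ½ :* g)) in
            η :+ ((η :+ ((η :+ η) :+ (η :+ η))) :+ ((η :+ η) :+ (con 1ℚ :- g))) := con 1ℚ) refl g′)
      , ev-map (λ n 0+g≤ε → ≤-cert (0≤p+q 0≤2η (0≤p+q (p≤q⇒0≤q-p (ℚₚ.p⊓q≤p g 1ℚ)) (p≤q⇒0≤q-p 0+g≤ε)))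
          (solve 3 (λ g′ g ε → let η = con ½ :* (con ½ :* (con ½ :* g′)) in
            ((η :+ η) :+ ((η :+ η) :+ (η :+ η))) :+ ((η :+ η) :+ ((g :- g′) :+ (ε :- (con 0ℚ :+ g)))) := ε) refl g′ g (seq ε n))) h
    where
    open +-*-Solver
    g′ η : ℚ
    g′ = g ⊓ 1ℚ
    -- One eighth of the gap, so that `6η ≤ g`; capping by 1 gives `η ≤ 1`.
    η = ½ * (½ * (½ * g′))
    ⊓-pos : g′ ≡ g ⊎ g′ ≡ 1ℚ → 0ℚ < g′
    ⊓-pos (inj₁ eq) = ≡.subst (0ℚ <_) (≡.sym eq) 0<g
    ⊓-pos (inj₂ eq) = ≡.subst (0ℚ <_) (≡.sym eq) 0<1
    0<η : 0ℚ < η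
    0<η = 0<p*q 0<½ (0<p*q 0<½ (0<p*q 0<½ (⊓-pos (ℚₚ.⊓-sel g 1ℚ))))
    0≤η : 0ℚ ≤ η
    0≤η = ℚₚ.<⇒≤ 0<η
    0≤2η : 0ℚ ≤ η + η
    0≤2η = 0≤p+q 0≤η 0≤η
    0≤4η : 0ℚ ≤ (η + η) + (η + η)
    0≤4η = 0≤p+q 0≤2η 0≤2η

  module Density {ℓ} (K : RealNumberField ℓ) (L : Labelling K) where

    open Conjugates K L
    open Labelling L

    re-combo : ∀ {m} (τ : Embedding K) (v : Fin m → Element) (c : Vector ℤ m) q →
      ∑ℝ.sum (λ i → (re (⟦ τ ⟧ (v i)) *ʳ fromℚ q) *ʳ fromℚ (fromℤ (c i))) ≈ʳ re (⟦ τ ⟧ (combo (λ i → fromℤ (c i) * q) v))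
    re-combo τ v c q = ≈-transʳ (re-combination (λ i → ⟦ τ ⟧ (v i)) c q)
      (≈-symʳ (_≈ᶜ_.re≈ (EmbeddingProperties.on-combo τ (λ i → fromℤ (c i) * q) v)))

    im-combo : ∀ {m} (τ : Embedding K) (v : Fin m → Element) (c : Vector ℤ m) q →
      ∑ℝ.sum (λ i → (im (⟦ τ ⟧ (v i)) *ʳ fromℚ q) *ʳ fromℚ (fromℤ (c i))) ≈ʳ im (⟦ τ ⟧ (combo (λ i → fromℤ (c i) * q) v))
    im-combo τ v c q = ≈-transʳ (im-combination (λ i → ⟦ τ ⟧ (v i)) c q)
      (≈-symʳ (_≈ᶜ_.im≈ (EmbeddingProperties.on-combo τ (λ i → fromℤ (c i) * q) v)))

    module Denominator (D : ℕ) (D≢0 : ℕ.NonZero D)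
      (D-clears : ∀ i k l → Clears (coord (bᴱ i *ᴱ bᴱ k) l) D) where

      open Order D D-clears

      Dℚ : ℚ
      Dℚ = fromℤ (+ D)
      0<Dℚ : 0ℚ < Dℚ
      0<Dℚ = 0<fromℕ D {{D≢0}}

      real-embedding : ∀ (i : Fin s) x → IsReal (⟦ σ (i ↑ˡ (t ℕ.+ t)) ⟧ x)
      real-embedding i x = isReal (Equivalence.from (σ-real (i ↑ˡ (t ℕ.+ t)))
        (≡.subst (ℕ._< s) (≡.sym (Finₚ.toℕ-↑ˡ i (t ℕ.+ t))) (Finₚ.toℕ<n i)) x)

      -- The `s − 1` real embeddings give one form each and the `t` complex ones a real and an
      -- imaginary part: `n` forms in `N = n + 1` unknowns, exactly what the box principle admits.
      -- The conjugate embeddings follow by symmetry.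
      small-lattice-element : ∀ δ → 0ℚ < δ → ∃ λ (c : Vector ℤ N) → ¬ (∀ i → c i ≡ 0ℤ) ×
        ∀ k → ⟦ σ (suc k) ⟧ (lattice c) ≺ᶜ δ
      small-lattice-element δ 0<δ = conclude (linearFormsTheorem n forms δ 0<δ)
        where
        realForms : Fin s-1 → Vector ℝ N
        realForms i k = re (S (suc i ↑ˡ (t ℕ.+ t)) k) *ʳ fromℚ Dℚ
        reForms imForms : Fin t → Vector ℝ N
        reForms j k = re (S (s ↑ʳ (j ↑ˡ t)) k) *ʳ fromℚ Dℚ
        imForms j k = im (S (s ↑ʳ (j ↑ˡ t)) k) *ʳ fromℚ Dℚ
        forms : Fin n → Vector ℝ N
        forms = realForms ++ (reForms ++ imForms)
        conclude : (∃ λ (c : Vector ℤ N) → ¬ (∀ i → c i ≡ 0ℤ) × ∀ k → ∑ℝ.sum (λ i → forms k i *ʳ fromℚ (fromℤ (c i))) ≺ δ) →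
          ∃ λ (c : Vector ℤ N) → ¬ (∀ i → c i ≡ 0ℤ) × ∀ k → ⟦ σ (suc k) ⟧ (lattice c) ≺ᶜ δ
        conclude (c , c≢0 , small) = c , c≢0 , Fin-split s-1 _ real-case (Fin-split t _ complex-case conjugate-case)
          where
          value : Vector ℝ N → ℝ
          value form = ∑ℝ.sum (λ i → form i *ʳ fromℚ (fromℤ (c i)))
          β : Element
          β = lattice c
          re-β : ∀ j → value (λ k → re (S j k) *ʳ fromℚ Dℚ) ≈ʳ re (⟦ σ j ⟧ β)
          re-β j = re-combo (σ j) bᴱ c Dℚ
          im-β : ∀ j → value (λ k → im (S j k) *ʳ fromℚ Dℚ) ≈ʳ im (⟦ σ j ⟧ β)
          im-β j = im-combo (σ j) bᴱ c Dℚ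
          real-case : ∀ i → ⟦ σ (suc (i ↑ˡ (t ℕ.+ t))) ⟧ β ≺ᶜ δ
          real-case i = mk≺ᶜ
            (≺-resp (re-β (suc i ↑ˡ (t ℕ.+ t))) (≡.subst (λ form → value form ≺ δ) (Vecₚ.lookup-++ˡ realForms (reForms ++ imForms) i) (small (i ↑ˡ (t ℕ.+ t)))))
            (≺-resp (≈-symʳ (im≈0 (real-embedding (suc i) β))) (≺-fromℚ 0<δ))
          complex-case : ∀ j → ⟦ σ (suc (s-1 ↑ʳ (j ↑ˡ t))) ⟧ β ≺ᶜ δ
          complex-case j = mk≺ᶜ
            (≺-resp (re-β (s ↑ʳ (j ↑ˡ t))) (≡.subst (λ form → value form ≺ δ)
              (≡.trans (Vecₚ.lookup-++ʳ realForms (reForms ++ imForms) (j ↑ˡ t)) (Vecₚ.lookup-++ˡ reForms imForms j)) (small (s-1 ↑ʳ (j ↑ˡ t)))))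
            (≺-resp (im-β (s ↑ʳ (j ↑ˡ t))) (≡.subst (λ form → value form ≺ δ)
              (≡.trans (Vecₚ.lookup-++ʳ realForms (reForms ++ imForms) (t ↑ʳ j)) (Vecₚ.lookup-++ʳ reForms imForms j)) (small (s-1 ↑ʳ (t ↑ʳ j)))))
          conjugate-case : ∀ j → ⟦ σ (suc (s-1 ↑ʳ (t ↑ʳ j))) ⟧ β ≺ᶜ δ
          conjugate-case j = ≺ᶜ-resp (ℂᵣ.sym (σ-conj j β)) (≺ᶜ-conj (complex-case j))

      bound : ∃ λ B → ∀ j i → S j i ≺ᶜ B
      bound =
        let r , hr = bounded-family₂ (λ j i → re (S j i))
            q , hq = bounded-family₂ (λ j i → im (S j i))
        in r ⊔ q , λ j i → mk≺ᶜ (≺-weaken (ℚₚ.p≤p⊔q r q) (hr j i)) (≺-weaken (ℚₚ.p≤q⊔p r q) (hq j i))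

      module Bounded (B : ℚ) (S≺B : ∀ j i → S j i ≺ᶜ B) where

        -- `E₀` bounds the rounding error of one coefficient, and `C` bounds its effect on any
        -- embedding. Neither involves `β`, whose size is prescribed in terms of `C`.
        E₀ C : ℚ
        E₀ = Dℚ * (1ℚ + (1ℚ + 1ℚ))
        C = fromℕ′ (suc N) * (B * E₀ + B * E₀)

        0<B : 0ℚ < B
        0<B = ≺-0< (_≺ᶜ_.re≺ (S≺B zero zero))
        0<E₀ : 0ℚ < E₀
        0<E₀ = 0<p*q 0<Dℚ (0<p+q {1ℚ} {1ℚ + 1ℚ} 0<1 (0≤p+q {1ℚ} {1ℚ} 0≤1 0≤1))
        0<C : 0ℚ < C
        0<C = 0<p*q (0<fromℕ-suc N) (0<p+q (0<p*q 0<B 0<E₀) (ℚₚ.<⇒≤ (0<p*q 0<B 0<E₀)))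

        nearest-multiples : ∀ {m} (y : Vector ℝ m) →
          ∃ λ (c : Vector ℤ m) → ∀ i → y i -ʳ fromℚ (fromℤ (c i) * Dℚ) ≺ E₀
        nearest-multiples y = (λ i → proj₁ (nearest-multiple (y i) Dℚ 0<Dℚ)) , λ i → proj₂ (nearest-multiple (y i) Dℚ 0<Dℚ)

        module Approximation (x : Vector ℝ s-1) (z : Vector ℂ t)
          (x∈ : ∀ i → InDisc (fromℝ (x i))) (z∈ : ∀ j → InDisc (z j))
          (η : ℚ) (0<η : 0ℚ < η) (η≤1 : η ≤ 1ℚ) where

          open Shrink η 0<η η≤1

          P : Vector ℂ n
          P = (fromℝ ∘ x) ++ (z ++ (conj ∘ z))

          P-real : ∀ i → P (i ↑ˡ (t ℕ.+ t)) ≡ fromℝ (x i)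
          P-real i = Vecₚ.lookup-++ˡ (fromℝ ∘ x) (z ++ (conj ∘ z)) i
          P-complex : ∀ j → P (s-1 ↑ʳ (j ↑ˡ t)) ≡ z j
          P-complex j = ≡.trans (Vecₚ.lookup-++ʳ (fromℝ ∘ x) (z ++ (conj ∘ z)) (j ↑ˡ t)) (Vecₚ.lookup-++ˡ z (conj ∘ z) j)
          P-conj : ∀ j → P (s-1 ↑ʳ (t ↑ʳ j)) ≡ conj (z j)
          P-conj j = ≡.trans (Vecₚ.lookup-++ʳ (fromℝ ∘ x) (z ++ (conj ∘ z)) (t ↑ʳ j)) (Vecₚ.lookup-++ʳ z (conj ∘ z) j)

          P∈ : ∀ k → InDisc (P k)
          P∈ = Fin-split s-1 _ (λ i → ≡.subst InDisc (≡.sym (P-real i)) (x∈ i))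
            (Fin-split t _ (λ j → ≡.subst InDisc (≡.sym (P-complex j)) (z∈ j))
              (λ j → ≡.subst InDisc (≡.sym (P-conj j)) (InDisc-conj {z j} (z∈ j))))

          -- β, its inverse and later the rounded coefficients are parameters rather than
          -- projections, so that the pigeonhole search behind them is never unfolded.
          module Solve (δ₀ : ℚ) (δ₀-exact : (C + C) * δ₀ ≡ e)
            (cβ : Vector ℤ N) (β-small : ∀ k → ⟦ σ (suc k) ⟧ (lattice cβ) ≺ᶜ δ₀)
            (r : ℚ) (β≺r : ⟦ σ zero ⟧ (lattice cβ) ≺ᶜ r)
            (g : Vector ℚ N) (β-inverse : ∀ j → ⟦ σ j ⟧ (lattice cβ) *ᶜ sum (λ k → S j k *ᶜ ι (g k)) ≈ᶜ 1ᶜ) where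

            β : Element
            β = lattice cβ

            -- The conjugates of `β⁻¹`. Being the images of the field element `combo g bᴱ`, they
            -- inherit the symmetry under complex conjugation that makes the solution real.
            γ : Fin N → ℂ
            γ j = sum (λ k → S j k *ᶜ ι (g k))

            γ≈ : ∀ j → γ j ≈ᶜ ⟦ σ j ⟧ (combo g bᴱ)
            γ≈ j = ℂᵣ.sym (σₚ.on-combo j g bᴱ)

            -- `M` bounds the error at the inclusion, where `β` is only known to be below `r`. The
            -- target `R` exceeds it by 2, so that `θ ≥ 2` however large `β` is.
            M R : ℚ
            M = r * C + r * C
            R = (1ℚ + 1ℚ) + M

            Q : Fin N → ℂ
            Q zero = ι R
            Q (suc k) = shrink (P k)

            v : Fin N → ℂ
            v l = Q l *ᶜ γ l

            Q-real : ∀ (i : Fin s) → IsReal (Q (i ↑ˡ (t ℕ.+ t)))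
            Q-real zero = IsReal-fromℝ (fromℚ R)
            Q-real (suc i) = ≡.subst (λ p → IsReal (shrink p)) (≡.sym (P-real i)) (IsReal-* (IsReal-fromℝ (fromℚ (1ℚ - η))) (IsReal-fromℝ (x i)))

            Q-conj : ∀ j → Q (s ↑ʳ (t ↑ʳ j)) ≈ᶜ conj (Q (s ↑ʳ (j ↑ˡ t)))
            Q-conj j = ≡.subst₂ (λ p q → shrink p ≈ᶜ conj (shrink q)) (≡.sym (P-conj j)) (≡.sym (P-complex j))
              (conj-*₂ {ι (1ℚ - η)} {conj (z j)} {ι (1ℚ - η)} {z j} (conj-ι (1ℚ - η)) ℂᵣ.refl)

            Sv-real : ∀ k → IsReal (sum (λ l → S l k *ᶜ v l))
            Sv-real k = sum-real s t (λ l → S l k *ᶜ v l) real paired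
              where
              real : ∀ i → IsReal (S (i ↑ˡ (t ℕ.+ t)) k *ᶜ v (i ↑ˡ (t ℕ.+ t)))
              real i = IsReal-* {S (i ↑ˡ (t ℕ.+ t)) k} {v (i ↑ˡ (t ℕ.+ t))} (real-embedding i (bᴱ k))
                (IsReal-* {Q (i ↑ˡ (t ℕ.+ t))} {γ (i ↑ˡ (t ℕ.+ t))} (Q-real i)
                  (IsReal-resp (ℂᵣ.sym (γ≈ (i ↑ˡ (t ℕ.+ t)))) (real-embedding i (combo g bᴱ))))
              γ-conj : ∀ j → γ (s ↑ʳ (t ↑ʳ j)) ≈ᶜ conj (γ (s ↑ʳ (j ↑ˡ t)))
              γ-conj j = ℂᵣ.trans (γ≈ (s ↑ʳ (t ↑ʳ j))) (ℂᵣ.trans (σ-conj j (combo g bᴱ)) (conj-cong (ℂᵣ.sym (γ≈ (s ↑ʳ (j ↑ˡ t))))))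
              paired : ∀ j → S (s ↑ʳ (t ↑ʳ j)) k *ᶜ v (s ↑ʳ (t ↑ʳ j)) ≈ᶜ conj (S (s ↑ʳ (j ↑ˡ t)) k *ᶜ v (s ↑ʳ (j ↑ˡ t)))
              paired j = conj-*₂ {S (s ↑ʳ (t ↑ʳ j)) k} {v (s ↑ʳ (t ↑ʳ j))} {S (s ↑ʳ (j ↑ˡ t)) k} {v (s ↑ʳ (j ↑ˡ t))} (σ-conj j (bᴱ k))
                (conj-*₂ {Q (s ↑ʳ (t ↑ʳ j))} {γ (s ↑ʳ (t ↑ʳ j))} {Q (s ↑ʳ (j ↑ˡ t))} {γ (s ↑ʳ (j ↑ˡ t))} (Q-conj j) (γ-conj j))

            solution-real : ∀ i → IsReal (solution v i)
            solution-real = solution-closed IsReal (IsReal-fromℝ 0ʳ) IsReal-+ (λ q → IsReal-* (IsReal-fromℝ (fromℚ q))) v Sv-real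

            y : Vector ℝ N
            y i = re (solution v i)

            Sy≈v : ∀ j → sum (λ i → S j i *ᶜ fromℝ (y i)) ≈ᶜ v j
            Sy≈v = solve-target-≈ v (fromℝ ∘ y) (λ i → ℂᵣ.sym (real≈ (solution-real i)))

            module Rounded (c : Vector ℤ N) (y-c≺E₀ : ∀ i → y i -ʳ fromℚ (fromℤ (c i) * Dℚ) ≺ E₀) where

              θ : Element
              θ = β *ᴱ lattice c

              error : ∀ j ρ → ⟦ σ j ⟧ β ≺ᶜ ρ → ⟦ σ j ⟧ θ -ᶜ Q j ≺ᶜ ρ * C + ρ * C
              error j ρ h = ≺ᶜ-resp rounded (≺ᶜ-neg (≺ᶜ-* h bounded))
                where
                rounding : ℂ
                rounding = sum (λ i → S j i *ᶜ (fromℝ (y i) -ᶜ ι (fromℤ (c i) * Dℚ)))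
                bounded : rounding ≺ᶜ C
                bounded = rounding-bound (S j) y (λ i → fromℤ (c i) * Dℚ) 0<B 0<E₀ (S≺B j) y-c≺E₀
                rounded : -ᶜ (⟦ σ j ⟧ β *ᶜ rounding) ≈ᶜ ⟦ σ j ⟧ θ -ᶜ Q j
                rounded = rounding-error β g (λ i → fromℤ (c i) * Dℚ) Q (fromℝ ∘ y) β-inverse Sy≈v j

              -- The error is at most `2 C δ₀`, with the 2 from complex multiplication, and `δ₀` was
              -- chosen to make this exactly `e`.
              conjugate-close : ∀ k → ⟦ σ (suc k) ⟧ θ -ᶜ shrink (P k) ≺ᶜ e
              conjugate-close k = ≡.subst (λ u → ⟦ σ (suc k) ⟧ θ -ᶜ shrink (P k) ≺ᶜ u)
                (≡.trans (solve 2 (λ d C → d :* C :+ d :* C := (C :+ C) :* d) refl δ₀ C) δ₀-exact)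
                (error (suc k) δ₀ (β-small k))
                where open +-*-Solver using (solve; _:+_; _:*_; _:=_)

              θ≥2 : Ev λ k → 1ℚ + 1ℚ ≤ seq (proj₁ θ) k
              θ≥2 = lower (_≺ᶜ_.re≺ (≺ᶜ-resp (ℂᵣ.+-congʳ (σ₁-identity θ)) (error zero r β≺r)))
                where
                lower : proj₁ θ -ʳ fromℚ R ≺ M → Ev λ k → 1ℚ + 1ℚ ≤ seq (proj₁ θ) k
                lower (mk≺ u u<M h) = ev-map (λ k ∣θ-R∣≤u → ≤-cert
                  (0≤p+q (0≤p+q (p≤q⇒0≤q-p (-p≤∣p∣ (seq (proj₁ θ) k - R))) (p≤q⇒0≤q-p ∣θ-R∣≤u)) (p≤q⇒0≤q-p (ℚₚ.<⇒≤ u<M)))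
                  (solve 4 (λ θ M u a → let two = con 1ℚ :+ con 1ℚ in
                    two :+ (((a :- (:- (θ :- (two :+ M)))) :+ (u :- a)) :+ (M :- u)) := θ) refl
                    (seq (proj₁ θ) k) M u (∣ seq (proj₁ θ) k - R ∣))) h
                  where open +-*-Solver

              open PisotCriterion θ θ≥2 (λ k → shrink-Below {P k} {⟦ σ (suc k) ⟧ θ} (P∈ k) (conjugate-close k))

              θ∈℘K : θ ∈ ℘ K
              θ∈℘K = θ∈℘ D D-clears (product∈ cβ c)

              module _ (ε : ℝ) (6η≤ε : Ev λ n → (η + η) + ((η + η) + (η + η)) ≤ seq ε n) where
                open Tolerance ε 6η≤ε

                conjugates-within : Within ε (conjugateTuple L θ) (x , z)
                conjugates-within =
                    (λ i → real-within {x i} {⟦ σ (suc i ↑ˡ (t ℕ.+ t)) ⟧ θ} (x∈ i)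
                      (≡.subst (λ p → ⟦ σ (suc i ↑ˡ (t ℕ.+ t)) ⟧ θ -ᶜ shrink p ≺ᶜ e) (P-real i) (conjugate-close (i ↑ˡ (t ℕ.+ t)))))
                  , (λ j → complex-within {z j} {⟦ σ (s ↑ʳ (j ↑ˡ t)) ⟧ θ} (z∈ j)
                      (≡.subst (λ p → ⟦ σ (s ↑ʳ (j ↑ˡ t)) ⟧ θ -ᶜ shrink p ≺ᶜ e) (P-complex j) (conjugate-close (s-1 ↑ʳ (j ↑ˡ t)))))

              result : ∀ ε → (Ev λ n → (η + η) + ((η + η) + (η + η)) ≤ seq ε n) →
                ∃ λ p → p ∈ conjugateTuples L × Within ε p (x , z)
              result ε 6η≤ε = conjugateTuple L θ , (θ , θ∈℘K , (λ _ → ≈-reflʳ) , λ _ → ℂᵣ.refl) , conjugates-within ε 6η≤ε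

      approximate-target : ∀ {q} → q ∈ Polydisc s-1 t → ∀ ε → 0ʳ <ʳ ε → ∃ λ p → p ∈ conjugateTuples L × Within ε p q
      approximate-target {x , z} (x∈ , z∈) ε 0<ε = with-bound bound (tolerance ε 0<ε)
        where
        with-bound : (∃ λ B → ∀ j i → S j i ≺ᶜ B) →
          (∃ λ η → 0ℚ < η × η ≤ 1ℚ × Ev λ n → (η + η) + ((η + η) + (η + η)) ≤ seq ε n) →
          ∃ λ p → p ∈ conjugateTuples L × Within ε p (x , z)
        with-bound (B , S≺B) (η , 0<η , η≤1 , 6η≤ε) = with-δ (divide (0<p+q 0<C (ℚₚ.<⇒≤ 0<C)) 0<e)
          where
          open Bounded B S≺B
          open Approximation x z (λ i → InDisc-real (proj₁ (x∈ i)) (proj₂ (x∈ i))) (λ j → ≯1⇒≤1+κ (z∈ j)) η 0<η η≤1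
          open Shrink η 0<η η≤1
          with-δ : (∃ λ δ → 0ℚ < δ × (C + C) * δ ≡ e) → ∃ λ p → p ∈ conjugateTuples L × Within ε p (x , z)
          with-δ (δ , 0<δ , δ-exact) = with-β (small-lattice-element δ 0<δ)
            where
            with-β : (∃ λ (c : Vector ℤ N) → ¬ (∀ i → c i ≡ 0ℤ) × ∀ k → ⟦ σ (suc k) ⟧ (lattice c) ≺ᶜ δ) →
              ∃ λ p → p ∈ conjugateTuples L × Within ε p (x , z)
            with-β (cβ , cβ≢0 , β-small) = with-inverse (≺ᶜ-bounded (⟦ σ zero ⟧ (lattice cβ)))
                (inverse (lattice cβ) (lattice≉0 {{D≢0}} cβ cβ≢0))
              where
              with-inverse : (∃ λ r → ⟦ σ zero ⟧ (lattice cβ) ≺ᶜ r) →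
                (∃ λ (g : Vector ℚ N) → ∀ j → ⟦ σ j ⟧ (lattice cβ) *ᶜ sum (λ k → S j k *ᶜ ι (g k)) ≈ᶜ 1ᶜ) →
                ∃ λ p → p ∈ conjugateTuples L × Within ε p (x , z)
              with-inverse (r , β≺r) (g , β-inverse) = with-c (nearest-multiples y)
                where
                open Solve δ δ-exact cβ β-small r β≺r g β-inverse
                with-c : (∃ λ (c : Vector ℤ N) → ∀ i → y i -ʳ fromℚ (fromℤ (c i) * Dℚ) ≺ E₀) →
                  ∃ λ p → p ∈ conjugateTuples L × Within ε p (x , z)
                with-c (c , y-c≺E₀) = Rounded.result c y-c≺E₀ ε 6η≤ε

  dense : ∀ {ℓ} (K : RealNumberField ℓ) (L : Labelling K) → conjugateTuples L IsDenseIn Polydisc (Labelling.s-1 L) (Labelling.t L)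
  dense K L = conjugateTuples⊆Polydisc , with-denominator (common-denominator₃ λ i k → coord (bᴱ i *ᴱ bᴱ k))
    where
    open Conjugates K L
    open Labelling L
    with-denominator : (∃ λ D → ℕ.NonZero D × ∀ i k l → Clears (coord (bᴱ i *ᴱ bᴱ k) l) D) →
      ∀ {q} → q ∈ Polydisc s-1 t → ∀ ε → 0ʳ <ʳ ε → ∃ λ p → p ∈ conjugateTuples L × Within ε p q
    with-denominator (D , D≢0 , D-clears) = Density.Denominator.approximate-target K L D D≢0 D-clears

open import Defs
open import Data.Nat.Base using (_<_)
open import Level using (Level)

corollary2 : ∀ {ℓ : Level} (K : RealNumberField ℓ) → 1 < RealNumberField.degree K →
    (L : Labelling K) →
    conjugateTuples L IsDenseIn Polydisc (Labelling.s-1 L) (Labelling.t L)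
corollary2 K _ L = Approximations.dense K L
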